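{- For all positive integers $t,r$ there exists a number $f(t,r)$ such that if $G$ is a graph and $S\subseteq V(G)$ is a $(15t-6)$-edge-connected set with $|S|\geq f(t,r)$, then $G$ contains a $C_{t,r}$ immersion all of whose terminals lie in $S$.
   Context: Graphs are finite and loopless but may have multiple edges. A set $S\subseteq V(G)$ is $k$-edge-connected (in $G$) if no two vertices of $S$ are separated by deleting fewer than $k$ edges of $G$. $C_{t,r}$ is the cycle on $r$ vertices with each edge replaced by $t$ parallel edges. A $C_{t,r}$ immersion in $G$ consists of an injective map from $V(C_{t,r})$ to $V(G)$ (the images are the terminals) and an assignment to each edge $uv$ of $C_{t,r}$ of a path in $G$ between the images of $u,v$, the paths being pairwise edge-disjoint. -}

module Defs where

open import Data.Nat using (ℕ; zero; suc; _<_; _≤_; _∸_; _*_)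
open import Data.Nat.DivMod using (_%_; m%n<n)
open import Data.Fin using (Fin; toℕ; fromℕ<)
open import Data.Fin.Subset using (Subset; _∈_; ∣_∣)
open import Data.Product using (Σ; _×_; _,_; proj₁; proj₂; ∃)
open import Data.Sum using (_⊎_)
open import Data.List using (List; []; _∷_; length)
open import Data.List.Relation.Unary.All using (All)
open import Data.List.Relation.Unary.Unique.Propositional using (Unique)
open import Data.List.Relation.Binary.Disjoint.Propositional using (Disjoint)
open import Data.List.Membership.Propositional using () renaming (_∉_ to _∉ₗ_)
open import Relation.Binary.PropositionalEquality using (_≡_; _≢_)
open import Function.Definitions using (Injective)

-- A finite loopless multigraph: vertices Fin nV, edges Fin nE, each edge
-- has an (unordered) pair of distinct endpoints, stored as an ordered pair.
record Graph : Set where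
  field
    nV : ℕ
    nE : ℕ
    ends : Fin nE → Fin nV × Fin nV
    loopless : ∀ e → proj₁ (ends e) ≢ proj₂ (ends e)
open Graph public

module _ (G : Graph) where

  Joins : Fin (nE G) → Fin (nV G) → Fin (nV G) → Set
  Joins e u w = (ends G e ≡ (u , w)) ⊎ (ends G e ≡ (w , u))

  data Walk : Fin (nV G) → Fin (nV G) → Set where
    stop : ∀ {u} → Walk u u
    step : ∀ {u w v} (e : Fin (nE G)) → Joins e u w → Walk w v → Walk u v

  verts : ∀ {u v} → Walk u v → List (Fin (nV G))
  verts {u} stop = u ∷ []
  verts {u} (step e _ p) = u ∷ verts p

  edges : ∀ {u v} → Walk u v → List (Fin (nE G))
  edges stop = []
  edges (step e _ p) = e ∷ edges p

  IsPath : ∀ {u v} → Walk u v → Set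
  IsPath p = Unique (verts p)

  ConnectedAvoiding : List (Fin (nE G)) → Fin (nV G) → Fin (nV G) → Set
  ConnectedAvoiding F u v =
    Σ (Walk u v) λ p → IsPath p × All (λ e → e ∉ₗ F) (edges p)

  EdgeConnectedSet : ℕ → Subset (nV G) → Set
  EdgeConnectedSet k S = ∀ u v → u ∈ S → v ∈ S →
    (F : List (Fin (nE G))) → length F < k → ConnectedAvoiding F u v

cnext : ∀ {r} → Fin r → Fin r
cnext {suc k} i = fromℕ< (m%n<n (suc (toℕ i)) (suc k))

-- C_{t,r}: vertices Fin r; for each i : Fin r and j : Fin t an edge (i,j)
-- joining i and cnext i.  A C_{t,r} immersion in G with terminals in S:
record CImmersion (t r : ℕ) (G : Graph) (S : Subset (nV G)) : Set where
  field
    π : Fin r → Fin (nV G)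
    π-inj : Injective _≡_ _≡_ π
    π-in-S : ∀ i → π i ∈ S
    path : (i : Fin r) (j : Fin t) → Walk G (π i) (π (cnext i))
    path-isPath : ∀ i j → IsPath G (path i j)
    edge-disjoint : ∀ i j i′ j′ → (i , j) ≢ (i′ , j′) →
      Disjoint (edges G (path i j)) (edges G (path i′ j′))

module Submission where

-- All reductions are immersions generated by deleting edges and by splitting off pairs uv, vw into uw. Deleting edges that
-- lie in no tight cut and contracting sides of tight cuts (which Menger's theorem turns into an immersion) ends in one of
-- two ways. Either many terminals remain and no edge joins two non-terminals. Then splitting off leaves only edges between
-- terminals and non-terminals of degree three, Kaiser's proof of the tree-packing theorem yields 2t edge-disjoint connected
-- subgraphs spanning the terminals, two of these contain a closed walk through all terminals, and by Erdős–Szekeres the t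
-- closed walks visit some r terminals in the same cyclic order. Or there is a long nested chain of tight sets with a terminal
-- in each difference. Then each region between consecutive cuts reduces to k strands at least half of which meet its
-- terminal, many regions agree on which strands these are (at least 4t), and using 2t of them to arrive and 2t to depart,
-- alternately, gives a path through terminals with 2t-fold edges; it folds up into t closed walks.

open import Defs
open import Data.Nat using (ℕ; zero; suc; _+_; _*_; _∸_; _^_; _≤_; _<_; _≥_; z≤n; s≤s; _≤ᵇ_)
open import Data.Nat.DivMod using (_%_; n%n≡0; m<n⇒m%n≡m)
open import Data.Nat.Properties using (≤-refl; ≤-reflexive; ≤-trans; ≤-antisym; ≤-total; <⇒≤; <⇒≱; ≰⇒>; ≮⇒≥; n≤1+n; m≤m+n; m≤n+m; +-mono-≤; +-monoˡ-≤; +-monoʳ-≤; +-mono-<-≤; +-mono-≤-<; *-monoˡ-≤; *-monoʳ-≤; +-cancelˡ-≤; +-cancelʳ-≤; +-cancelʳ-≡; +-comm; +-assoc; +-suc; +-identityʳ; *-comm; *-assoc; *-identityʳ; *-identityˡ; *-zeroʳ; *-distribˡ-+; ≤ᵇ⇒≤; suc-injective; 1+n≰n; m≤n⇒m<n∨m≡n; n≮0; n≤0⇒n≡0; _≤?_; _<?_; ≤-pred; m∸n+n≡m; m+n∸n≡m; module ≤-Reasoning)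
open import Data.Bool using (Bool; true; false; _∧_; _∨_; not; _xor_; T; if_then_else_)
open import Data.Fin using (Fin; toℕ; fromℕ<)
open import Data.Product using (Σ; _×_; _,_; proj₁; proj₂; Σ-syntax; ∃-syntax)
open import Data.Sum using (_⊎_; inj₁; inj₂; [_,_]′)
open import Data.Empty using (⊥; ⊥-elim)
open import Data.Unit using (⊤; tt)
open import Data.List using (List; []; _∷_; _++_; map; length; concat; allFin; replicate; [_]; cartesianProduct; upTo; reverse; take; tabulate) renaming (lookup to _‼_)
open import Data.List.Properties using (map-++; length-++; length-map; ++-assoc; ++-identityʳ; map-∘; map-cong; unfold-reverse; reverse-++; reverse-involutive; length-take; ∷-injectiveˡ; ∷-injectiveʳ; map-tabulate; length-tabulate)
open import Data.List.Membership.Propositional using () renaming (_∈_ to _∈ₗ_; _∉_ to _∉ₗ_)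
open import Data.List.Membership.Propositional.Properties using (∈-++⁺ˡ; ∈-++⁺ʳ; ∈-++⁻; ∈-map⁺; ∈-map⁻; ∈-allFin; ∈-∃++; ∈-cartesianProduct⁺; ∈-cartesianProduct⁻; ∈-upTo⁺; ∈-lookup)
open import Data.List.Relation.Unary.Any using (here; there)
open import Data.List.Relation.Unary.All using (All; []; _∷_)
open import Data.List.Relation.Unary.AllPairs using (AllPairs; []; _∷_)
open import Data.List.Relation.Binary.Permutation.Propositional using (_↭_; ↭-refl; ↭-sym; ↭-trans; ↭-reflexive; ↭⇒↭ₛ)
open import Relation.Binary.PropositionalEquality using (_≡_; _≢_; refl; sym; trans; cong; cong₂; subst; subst₂; module ≡-Reasoning; setoid)
open import Data.List.Relation.Unary.Unique.Propositional using (Unique)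
open import Data.List.Relation.Unary.Unique.Propositional.Properties using (allFin⁺)
open import Relation.Nullary using (¬_; Dec; yes; no; contradiction)
open import Relation.Nullary.Decidable using (⌊_⌋; _×-dec_; _⊎-dec_; ¬?; map′)
open import Function using (_∘_; id; case_of_)
open import Data.Nat.Tactic.RingSolver using (solve-∀)
open import Data.Fin.Subset using (Subset; ∣_∣)
open import Data.List.Relation.Binary.Disjoint.Propositional using (Disjoint)
import Data.Bool.Properties as 𝔹
import Data.Fin as F
import Data.Fin.Properties as FP
import Data.List.Relation.Unary.All as All
import Data.List.Relation.Unary.All.Properties as AllP
import Data.List.Relation.Binary.Permutation.Propositional as P
import Data.List.Relation.Binary.Permutation.Propositional.Properties as PP
import Data.List.Relation.Binary.Sublist.Propositional as Sublist
import Data.List.Relation.Binary.Sublist.Propositional.Properties as SublistP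
import Data.List.Relation.Unary.AllPairs.Properties as AllPairsP
import Data.Vec as Vec
import Data.Vec.Properties as VecP

variable
  n : ℕ
  A B C : Set

b2n : Bool → ℕ
b2n true  = 1
b2n false = 0

sumOf : (A → ℕ) → List A → ℕ
sumOf f []       = 0
sumOf f (x ∷ xs) = f x + sumOf f xs

swap₄ : ∀ a b c d → (a + b) + (c + d) ≡ (a + c) + (b + d)
swap₄ = solve-∀

sumOf-cong : ∀ {f g : A → ℕ} xs → (∀ x → f x ≡ g x) → sumOf f xs ≡ sumOf g xs
sumOf-cong []       e = refl
sumOf-cong (x ∷ xs) e = cong₂ _+_ (e x) (sumOf-cong xs e)

sumOf-++ : (f : A → ℕ) → ∀ xs ys → sumOf f (xs ++ ys) ≡ sumOf f xs + sumOf f ys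
sumOf-++ f []       ys = refl
sumOf-++ f (x ∷ xs) ys = trans (cong (f x +_) (sumOf-++ f xs ys)) (sym (+-assoc (f x) _ _))

sumOf-map : (f : B → ℕ) (g : A → B) → ∀ xs → sumOf f (map g xs) ≡ sumOf (f ∘ g) xs
sumOf-map f g []       = refl
sumOf-map f g (x ∷ xs) = cong (f (g x) +_) (sumOf-map f g xs)

sumOf-↭ : (f : A → ℕ) → ∀ {xs ys} → xs ↭ ys → sumOf f xs ≡ sumOf f ys
sumOf-↭ f P.refl         = refl
sumOf-↭ f (P.prep x p)   = cong (f x +_) (sumOf-↭ f p)
sumOf-↭ f {x ∷ y ∷ xs} {_ ∷ _ ∷ ys} (P.swap x y p) = trans (cong (λ z → f x + (f y + z)) (sumOf-↭ f p)) (comm₃ (f x) (f y) (sumOf f ys))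
  where comm₃ : ∀ a b c → a + (b + c) ≡ b + (a + c)
        comm₃ = solve-∀
sumOf-↭ f (P.trans p q)  = trans (sumOf-↭ f p) (sumOf-↭ f q)

sumOf-+ : (f g : A → ℕ) → ∀ xs → sumOf (λ x → f x + g x) xs ≡ sumOf f xs + sumOf g xs
sumOf-+ f g []       = refl
sumOf-+ f g (x ∷ xs) = trans (cong (f x + g x +_) (sumOf-+ f g xs)) (swap₄ (f x) (g x) _ _)

sumOf-≤ : ∀ {f g : A → ℕ} xs → (∀ {x} → x ∈ₗ xs → f x ≤ g x) → sumOf f xs ≤ sumOf g xs
sumOf-≤ []       h = z≤n
sumOf-≤ (x ∷ xs) h = +-mono-≤ (h (here refl)) (sumOf-≤ xs (h ∘ there))

sumOf-0 : ∀ {f : A → ℕ} xs → (∀ {x} → x ∈ₗ xs → f x ≡ 0) → sumOf f xs ≡ 0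
sumOf-0 []       h = refl
sumOf-0 (x ∷ xs) h = cong₂ _+_ (h (here refl)) (sumOf-0 xs (h ∘ there))

sumOf-const : (c : ℕ) → ∀ (xs : List A) → sumOf (λ _ → c) xs ≡ length xs * c
sumOf-const c []       = refl
sumOf-const c (x ∷ xs) = cong (c +_) (sumOf-const c xs)

sumOf-* : (c : ℕ) (f : A → ℕ) → ∀ xs → sumOf (λ x → c * f x) xs ≡ c * sumOf f xs
sumOf-* c f []       = sym (*-zeroʳ c)
sumOf-* c f (x ∷ xs) = trans (cong (c * f x +_) (sumOf-* c f xs)) (sym (*-distribˡ-+ c (f x) _))

sumOf-swap : (f : A → B → ℕ) → ∀ xs ys → sumOf (λ x → sumOf (f x) ys) xs ≡ sumOf (λ y → sumOf (λ x → f x y) xs) ys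
sumOf-swap f []       ys = sym (sumOf-0 ys (λ _ → refl))
sumOf-swap f (x ∷ xs) ys = trans (cong (sumOf (f x) ys +_) (sumOf-swap f xs ys)) (sym (sumOf-+ (f x) (λ y → sumOf (λ x → f x y) xs) ys))

sumOf-∈ : (f : A → ℕ) → ∀ {x xs} → x ∈ₗ xs → f x ≤ sumOf f xs
sumOf-∈ f (here refl) = m≤m+n _ _
sumOf-∈ f {xs = y ∷ _} (there i) = ≤-trans (sumOf-∈ f i) (m≤n+m _ (f y))

sumOf-< : ∀ {f g : A → ℕ} {x} xs → (∀ {x} → x ∈ₗ xs → f x ≤ g x) → x ∈ₗ xs → f x < g x → sumOf f xs < sumOf g xs
sumOf-< (x ∷ xs) h (here refl) l = +-mono-<-≤ l (sumOf-≤ xs (h ∘ there))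
sumOf-< (x ∷ xs) h (there i)   l = +-mono-≤-< (h (here refl)) (sumOf-< xs (h ∘ there) i l)

sumOf-≡ : ∀ {f g : A → ℕ} xs → (∀ {x} → x ∈ₗ xs → f x ≤ g x) → sumOf g xs ≤ sumOf f xs → ∀ {x} → x ∈ₗ xs → f x ≡ g x
sumOf-≡ {f = f} {g} xs h l {x} i with m≤n⇒m<n∨m≡n (h i)
... | inj₂ e = e
... | inj₁ lt = contradiction l (<⇒≱ (sumOf-< xs h i lt))

-- For linear arithmetic: L ≤ R is the sum of the hypotheses used, and the equation is left to the ring solver.
lin : ∀ {a b L R} c → L ≤ R → a + R + c ≡ b + L → a ≤ b
lin {a} {b} {L} {R} c h e = +-cancelʳ-≤ L a b (≤-trans (+-monoʳ-≤ a h) (≤-trans (m≤m+n (a + R) c) (≤-reflexive e)))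

_∈?_ : (x : Fin n) (xs : List (Fin n)) → Dec (x ∈ₗ xs)
x ∈? xs = Data.List.Relation.Unary.Any.any? (x F.≟_) xs
  where import Data.List.Relation.Unary.Any

_==_ : Fin n → Fin n → Bool
u == v = ⌊ u F.≟ v ⌋

==-refl : (u : Fin n) → (u == u) ≡ true
==-refl u with u F.≟ u
... | yes _ = refl
... | no  h = contradiction refl h

==⇒≡ : ∀ {u v : Fin n} → (u == v) ≡ true → u ≡ v
==⇒≡ {u = u} {v} e with u F.≟ v
... | yes p = p

≢⇒== : ∀ {u v : Fin n} → u ≢ v → (u == v) ≡ false
≢⇒== {u = u} {v} h with u F.≟ v
... | yes p = contradiction p h
... | no _ = refl

==-sym : (u v : Fin n) → (u == v) ≡ (v == u)
==-sym u v with u F.≟ v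
... | yes refl = sym (==-refl u)
... | no  h = sym (≢⇒== (h ∘ sym))

VSet : ℕ → Set
VSet n = Fin n → Bool

infixr 7 _∩_
infixr 6 _∪_ _∖_

_∩_ _∪_ _∖_ : VSet n → VSet n → VSet n
(X ∩ Y) v = X v ∧ Y v
(X ∪ Y) v = X v ∨ Y v
(X ∖ Y) v = X v ∧ not (Y v)

∁ : VSet n → VSet n
∁ X v = not (X v)

sg : Fin n → VSet n
sg s v = v == s

_⊆_ : VSet n → VSet n → Set
X ⊆ Y = ∀ v → X v ≡ true → Y v ≡ true

size : VSet n → ℕ
size X = sumOf (b2n ∘ X) (allFin _)

true≢false : ∀ {b} → b ≡ true → b ≡ false → ⊥
true≢false refl ()

¬true : ∀ {b} → ¬ (b ≡ true) → b ≡ false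
¬true {true}  h = ⊥-elim (h refl)
¬true {false} h = refl

∧-elim : ∀ {a b} → a ∧ b ≡ true → a ≡ true × b ≡ true
∧-elim {true} {true} _ = refl , refl

∧-intro : ∀ {a b} → a ≡ true → b ≡ true → a ∧ b ≡ true
∧-intro refl refl = refl

∨-introˡ : ∀ {a b} → a ≡ true → a ∨ b ≡ true
∨-introˡ refl = refl

∨-introʳ : ∀ {a b} → b ≡ true → a ∨ b ≡ true
∨-introʳ {true}  _ = refl
∨-introʳ {false} e = e

not-t : ∀ {a} → a ≡ false → not a ≡ true
not-t refl = refl

not-f : ∀ {a} → not a ≡ true → a ≡ false
not-f {false} _ = refl

unnot : ∀ {a} → not a ≡ false → a ≡ true
unnot {true} _ = refl

b2n≤1 : ∀ a → b2n a ≤ 1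
b2n≤1 true  = ≤-refl
b2n≤1 false = z≤n

b2n-mono : ∀ {a b} → (a ≡ true → b ≡ true) → b2n a ≤ b2n b
b2n-mono {false} h = z≤n
b2n-mono {true}  h = ≤-reflexive (cong b2n (sym (h refl)))

lin⊥ : ∀ {L R} c → L ≤ R → L ≡ suc (R + c) → ⊥
lin⊥ {L} {R} c h e = 1+n≰n (≤-trans (s≤s (m≤m+n R c)) (≤-trans (≤-reflexive (sym e)) h))

∨-false : ∀ {a b} → a ≡ false → b ≡ false → a ∨ b ≡ false
∨-false refl refl = refl

bool? : (b : Bool) → (b ≡ true) ⊎ (b ≡ false)
bool? true  = inj₁ refl
bool? false = inj₂ refl

Pred𝔹 : ℕ → Set
Pred𝔹 zero    = Bool
Pred𝔹 (suc m) = Bool → Pred𝔹 m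

all𝔹 : ∀ m → Pred𝔹 m → Bool
all𝔹 zero    b = b
all𝔹 (suc m) p = all𝔹 m (p true) ∧ all𝔹 m (p false)

Holds : ∀ m → Pred𝔹 m → Set
Holds zero    b = b ≡ true
Holds (suc m) p = ∀ b → Holds m (p b)

all𝔹-sound : ∀ m p → all𝔹 m p ≡ true → Holds m p
all𝔹-sound zero    p e = e
all𝔹-sound (suc m) p e true  = all𝔹-sound m (p true) (proj₁ (∧-elim e))
all𝔹-sound (suc m) p e false = all𝔹-sound m (p false) (proj₂ (∧-elim {all𝔹 m (p true)} e))

module _ {P : VSet n → Set} (P? : ∀ X → Dec (P X)) (resp : ∀ {X Y} → (∀ v → X v ≡ Y v) → P X → P Y) where
  private
    none : VSet 0
    none ()

    cons : ∀ {m} → Bool → VSet m → VSet (suc m)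
    cons b X F.zero    = b
    cons b X (F.suc i) = X i

  anyVSet : Dec (Σ[ X ∈ VSet n ] P X)
  anyVSet = go n P P? resp
    where
    go : ∀ m (P : VSet m → Set) → (∀ X → Dec (P X)) → (∀ {X Y} → (∀ v → X v ≡ Y v) → P X → P Y) → Dec (Σ[ X ∈ VSet m ] P X)
    go zero P P? r = map′ (λ p → none , p) (λ (X , p) → r {X} {none} (λ ()) p) (P? none)
    go (suc m) P P? r = map′ [ (λ (X , p) → cons true X , p) , (λ (X , p) → cons false X , p) ]′ back
        (go m (P ∘ cons true) (P? ∘ cons true) (r ∘ lift true) ⊎-dec go m (P ∘ cons false) (P? ∘ cons false) (r ∘ lift false))
      where
      lift : ∀ b {X Y : VSet m} → (∀ v → X v ≡ Y v) → ∀ v → cons b X v ≡ cons b Y v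
      lift b e F.zero    = refl
      lift b e (F.suc i) = e i
      η : ∀ (X : VSet (suc m)) {b} → X F.zero ≡ b → ∀ v → X v ≡ cons b (X ∘ F.suc) v
      η X e F.zero    = e
      η X e (F.suc i) = refl
      back : Σ (VSet (suc m)) P → (Σ (VSet m) (P ∘ cons true)) ⊎ (Σ (VSet m) (P ∘ cons false))
      back (X , p) with bool? (X F.zero)
      ... | inj₁ e = inj₁ (X ∘ F.suc , r (η X e) p)
      ... | inj₂ e = inj₂ (X ∘ F.suc , r (η X e) p)

nm : Bool → Bool → Bool → ℕ
nm true  true  true  = 0
nm false false false = 0
nm _     _     _     = 1

ineq₂ : Bool → Bool → Bool → Bool → Bool → Bool → Bool
ineq₂ a b c x y z = (nm (a ∧ x) (b ∧ y) (c ∧ z) + nm (a ∨ x) (b ∨ y) (c ∨ z) ≤ᵇ nm a b c + nm x y z)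
  ∧ (nm (a ∧ not x) (b ∧ not y) (c ∧ not z) + nm (x ∧ not a) (y ∧ not b) (z ∧ not c) ≤ᵇ nm a b c + nm x y z)

ineq₃ : (a b c x y z p q r : Bool) → Bool
ineq₃ a b c x y z p q r = nm (a ∧ x ∧ p) (b ∧ y ∧ q) (c ∧ z ∧ r) + nm (a ∧ not (x ∨ p)) (b ∧ not (y ∨ q)) (c ∧ not (z ∨ r))
  + nm (x ∧ not (a ∨ p)) (y ∧ not (b ∨ q)) (z ∧ not (c ∨ r)) + nm (p ∧ not (a ∨ x)) (q ∧ not (b ∨ y)) (r ∧ not (c ∨ z))
  ≤ᵇ nm a b c + nm x y z + nm p q r

≤ᵇ-sound : ∀ {a b} → (a ≤ᵇ b) ≡ true → a ≤ b
≤ᵇ-sound {a} {b} e = ≤ᵇ⇒≤ a b (subst T (sym e) tt)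

ineq₂-true : Holds 6 ineq₂
ineq₂-true = all𝔹-sound 6 ineq₂ refl

ineq₃-true : Holds 9 ineq₃
ineq₃-true = all𝔹-sound 9 ineq₃ refl

-- The uncrossing inequalities shared by graph cuts and cuts of hypergraphs with edges of size at most 3.
record SLike (f : VSet n → ℕ) : Set where
  field
    ext : ∀ {X Y} → (∀ v → X v ≡ Y v) → f X ≡ f Y
    com : ∀ X → f (∁ X) ≡ f X
    sub : ∀ X Y → f (X ∩ Y) + f (X ∪ Y) ≤ f X + f Y
    pos : ∀ X Y → f (X ∖ Y) + f (Y ∖ X) ≤ f X + f Y
    thr : ∀ X Y W → f (X ∩ Y ∩ W) + f (X ∖ (Y ∪ W)) + f (Y ∖ (X ∪ W)) + f (W ∖ (X ∪ Y)) ≤ f X + f Y + f W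

nmSet : Fin n → Fin n → Fin n → VSet n → ℕ
nmSet a b c X = nm (X a) (X b) (X c)

nm-not : ∀ a b c → nm (not a) (not b) (not c) ≡ nm a b c
nm-not true  true  true  = refl
nm-not true  true  false = refl
nm-not true  false true  = refl
nm-not true  false false = refl
nm-not false true  true  = refl
nm-not false true  false = refl
nm-not false false true  = refl
nm-not false false false = refl

nmSet-SLike : (a b c : Fin n) → SLike (nmSet a b c)
nmSet-SLike a b c = record
  { ext = λ e → cong₃ (e a) (e b) (e c)
  ; com = λ X → nm-not (X a) (X b) (X c)
  ; sub = λ X Y → ≤ᵇ-sound (proj₁ (∧-elim (ineq₂-true (X a) (X b) (X c) (Y a) (Y b) (Y c))))
  ; pos = λ X Y → ≤ᵇ-sound (proj₂ (∧-elim {nm (X a ∧ Y a) (X b ∧ Y b) (X c ∧ Y c) + nm (X a ∨ Y a) (X b ∨ Y b) (X c ∨ Y c) ≤ᵇ nm (X a) (X b) (X c) + nm (Y a) (Y b) (Y c)} (ineq₂-true (X a) (X b) (X c) (Y a) (Y b) (Y c))))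
  ; thr = λ X Y W → ≤ᵇ-sound (ineq₃-true (X a) (X b) (X c) (Y a) (Y b) (Y c) (W a) (W b) (W c)) }
  where
  cong₃ : ∀ {a a' b b' c c'} → a ≡ a' → b ≡ b' → c ≡ c' → nm a b c ≡ nm a' b' c'
  cong₃ refl refl refl = refl

slike-0 : SLike {n} (λ _ → 0)
slike-0 = record { ext = λ _ → refl ; com = λ _ → refl ; sub = λ _ _ → z≤n ; pos = λ _ _ → z≤n ; thr = λ _ _ _ → z≤n }

slike-+ : ∀ {f g : VSet n → ℕ} → SLike f → SLike g → SLike (λ X → f X + g X)
slike-+ {f = f} {g} F G = record
  { ext = λ e → cong₂ _+_ (Φ.ext e) (Γ.ext e)
  ; com = λ X → cong₂ _+_ (Φ.com X) (Γ.com X)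
  ; sub = λ X Y → two (f (X ∩ Y)) (f (X ∪ Y)) (f X) (f Y) (g (X ∩ Y)) (g (X ∪ Y)) (g X) (g Y) (Φ.sub X Y) (Γ.sub X Y)
  ; pos = λ X Y → two (f (X ∖ Y)) (f (Y ∖ X)) (f X) (f Y) (g (X ∖ Y)) (g (Y ∖ X)) (g X) (g Y) (Φ.pos X Y) (Γ.pos X Y)
  ; thr = λ X Y W → three (f (X ∩ Y ∩ W)) (f (X ∖ (Y ∪ W))) (f (Y ∖ (X ∪ W))) (f (W ∖ (X ∪ Y))) (f X) (f Y) (f W)
      (g (X ∩ Y ∩ W)) (g (X ∖ (Y ∪ W))) (g (Y ∖ (X ∪ W))) (g (W ∖ (X ∪ Y))) (g X) (g Y) (g W) (Φ.thr X Y W) (Γ.thr X Y W) }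
  where
  module Φ = SLike F
  module Γ = SLike G
  two : ∀ a b c d a' b' c' d' → a + b ≤ c + d → a' + b' ≤ c' + d' → (a + a') + (b + b') ≤ (c + c') + (d + d')
  two a b c d a' b' c' d' p q = subst₂ _≤_ (swap₄ a b a' b') (swap₄ c d c' d') (+-mono-≤ p q)
  re₄ : ∀ a b c d a' b' c' d' → (a + b + c + d) + (a' + b' + c' + d') ≡ (a + a') + (b + b') + (c + c') + (d + d')
  re₄ = solve-∀
  re₃ : ∀ a b c a' b' c' → (a + b + c) + (a' + b' + c') ≡ (a + a') + (b + b') + (c + c')
  re₃ = solve-∀
  three : ∀ a b c d x y z a' b' c' d' x' y' z' → a + b + c + d ≤ x + y + z → a' + b' + c' + d' ≤ x' + y' + z' →
    (a + a') + (b + b') + (c + c') + (d + d') ≤ (x + x') + (y + y') + (z + z')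
  three a b c d x y z a' b' c' d' x' y' z' p q = subst₂ _≤_ (re₄ a b c d a' b' c' d') (re₃ x y z x' y' z') (+-mono-≤ p q)

slike-sum : (g : A → VSet n → ℕ) → (∀ x → SLike (g x)) → ∀ xs → SLike (λ X → sumOf (λ x → g x X) xs)
slike-sum g h []       = slike-0
slike-sum g h (x ∷ xs) = slike-+ (h x) (slike-sum g h xs)

Edge : ℕ → Set
Edge n = Fin n × Fin n

cross : VSet n → Edge n → ℕ
cross X (u , w) = nm (X u) (X w) (X w)

d : List (Edge n) → VSet n → ℕ
d E X = sumOf (cross X) E

d-SLike : (E : List (Edge n)) → SLike (d E)
d-SLike = slike-sum (λ e X → cross X e) (λ (u , w) → nmSet-SLike u w w)

d-ext : ∀ (E : List (Edge n)) {X Y} → (∀ v → X v ≡ Y v) → d E X ≡ d E Y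
d-ext E = SLike.ext (d-SLike E)

cross-≡ : ∀ (X : VSet n) {u w} → X u ≡ X w → cross X (u , w) ≡ 0
cross-≡ X {u} {w} e with X u | X w
cross-≡ X refl | true  | true  = refl
cross-≡ X refl | false | false = refl

cross-≢ : ∀ (X : VSet n) {u w} → X u ≢ X w → cross X (u , w) ≡ 1
cross-≢ X {u} {w} h with X u | X w
... | true  | true  = contradiction refl h
... | true  | false = refl
... | false | true  = refl
... | false | false = contradiction refl h

cross-tf : ∀ (X : VSet n) {u w} → X u ≡ true → X w ≡ false → cross X (u , w) ≡ 1
cross-tf X p q = cross-≢ X (λ e → true≢false (trans (sym e) p) q)

cross-ft : ∀ (X : VSet n) {u w} → X u ≡ false → X w ≡ true → cross X (u , w) ≡ 1
cross-ft X p q = cross-≢ X (λ e → true≢false q (trans (sym e) p))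

cross≤1 : ∀ (X : VSet n) e → cross X e ≤ 1
cross≤1 X (u , w) with X u | X w
... | true  | true  = z≤n
... | true  | false = ≤-refl
... | false | true  = ≤-refl
... | false | false = z≤n

cross-0 : ∀ (X : VSet n) {u w} → cross X (u , w) ≡ 0 → X u ≡ X w
cross-0 X {u} {w} e with X u | X w
... | true  | true  = refl
... | false | false = refl

cross-flip : ∀ (X : VSet n) u w → cross X (u , w) ≡ cross X (w , u)
cross-flip X u w with X u | X w
... | true  | true  = refl
... | true  | false = refl
... | false | true  = refl
... | false | false = refl

cross-tri : ∀ (X : VSet n) u v w → cross X (u , w) ≤ cross X (u , v) + cross X (v , w)
cross-tri X u v w with X u | X v | X w
... | true  | true  | true  = z≤n
... | true  | true  | false = ≤-refl
... | true  | false | true  = z≤n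
... | true  | false | false = ≤-refl
... | false | true  | true  = ≤-refl
... | false | true  | false = z≤n
... | false | false | true  = ≤-refl
... | false | false | false = z≤n

sieve : (A → Bool) → List A → List A
sieve p []       = []
sieve p (x ∷ xs) = if p x then x ∷ sieve p xs else sieve p xs

sieve-↭ : (p : A → Bool) → ∀ {xs ys} → xs ↭ ys → sieve p xs ↭ sieve p ys
sieve-↭ p P.refl = ↭-refl
sieve-↭ p (P.prep x q) with p x
... | true  = P.prep x (sieve-↭ p q)
... | false = sieve-↭ p q
sieve-↭ p (P.swap x y q) with p x | p y
... | true  | true  = P.swap x y (sieve-↭ p q)
... | true  | false = P.prep x (sieve-↭ p q)
... | false | true  = P.prep y (sieve-↭ p q)
... | false | false = sieve-↭ p q
sieve-↭ p (P.trans q r) = ↭-trans (sieve-↭ p q) (sieve-↭ p r)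

sieve-∈ : (p : A → Bool) → ∀ {x} xs → x ∈ₗ sieve p xs → x ∈ₗ xs × p x ≡ true
sieve-∈ p (y ∷ xs) i with p y in eq
sieve-∈ p (y ∷ xs) (here refl) | true = here refl , eq
sieve-∈ p (y ∷ xs) (there i)   | true = let j , e = sieve-∈ p xs i in there j , e
sieve-∈ p (y ∷ xs) i | false = let j , e = sieve-∈ p xs i in there j , e

∈-sieve : (p : A → Bool) → ∀ {x xs} → x ∈ₗ xs → p x ≡ true → x ∈ₗ sieve p xs
∈-sieve p (here {xs = xs} refl) e rewrite e = here refl
∈-sieve p {xs = y ∷ _} (there i) e with p y
... | true  = there (∈-sieve p i e)
... | false = ∈-sieve p i e

sieve-halves : (p : A → Bool) → ∀ xs → xs ↭ sieve p xs ++ sieve (not ∘ p) xs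
sieve-halves p [] = ↭-refl
sieve-halves p (x ∷ xs) with p x
... | true  = P.prep x (sieve-halves p xs)
... | false = ↭-trans (P.prep x (sieve-halves p xs)) (↭-sym (PP.shift x (sieve p xs) _))

extract : ∀ {x : A} {xs} → x ∈ₗ xs → Σ[ ys ∈ List A ] xs ↭ x ∷ ys
extract {x = x} i with ys , zs , refl ← ∈-∃++ i = ys ++ zs , PP.shift x ys zs

findᵇ : (p : A → Bool) (xs : List A) → (Σ[ x ∈ A ] x ∈ₗ xs × p x ≡ true) ⊎ (∀ {x} → x ∈ₗ xs → p x ≡ false)
findᵇ p [] = inj₂ λ ()
findᵇ p (x ∷ xs) with bool? (p x)
... | inj₁ e = inj₁ (x , here refl , e)
... | inj₂ e with findᵇ p xs
...   | inj₁ (y , i , e') = inj₁ (y , there i , e')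
...   | inj₂ h = inj₂ λ { (here refl) → e ; (there i) → h i }

-- E immerses E' by a sequence of deletions and splittings at vertices satisfying Q.
data Imm {n} (Q : Fin n → Set) : List (Edge n) → List (Edge n) → Set where
  perm  : ∀ {E E'} → E ↭ E' → Imm Q E E'
  _⨾_   : ∀ {E E' E''} → Imm Q E E' → Imm Q E' E'' → Imm Q E E''
  del   : ∀ {e E} → Imm Q (e ∷ E) E
  flip  : ∀ {u v E} → Imm Q ((u , v) ∷ E) ((v , u) ∷ E)
  split : ∀ {u v w E} → Q v → Imm Q ((u , v) ∷ (v , w) ∷ E) ((u , w) ∷ E)

infixr 5 _⨾_

private variable
  Q Q' : Fin n → Set
  E E' H H' : List (Edge n)

Any-v : Fin n → Set
Any-v _ = ⊤

idI : Imm Q E E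
idI = perm ↭-refl

weaken : (∀ v → Q v → Q' v) → Imm Q E E' → Imm Q' E E'
weaken h (perm p)  = perm p
weaken h (i ⨾ j)   = weaken h i ⨾ weaken h j
weaken h del       = del
weaken h flip      = flip
weaken h (split q) = split (h _ q)

consI : ∀ {e} → Imm Q E E' → Imm Q (e ∷ E) (e ∷ E')
consI (perm p)  = perm (P.prep _ p)
consI (i ⨾ j)   = consI i ⨾ consI j
consI del       = perm (P.swap _ _ ↭-refl) ⨾ del
consI flip      = perm (P.swap _ _ ↭-refl) ⨾ flip ⨾ perm (P.swap _ _ ↭-refl)
consI {e = e} (split {u} {v} {w} {E} q) = perm (↭-sym (PP.shift e ((u , v) ∷ (v , w) ∷ []) E)) ⨾ split q ⨾ perm (P.swap _ _ ↭-refl)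

prefixI : ∀ D → Imm Q E E' → Imm Q (D ++ E) (D ++ E')
prefixI []      i = i
prefixI (e ∷ D) i = consI (prefixI D i)

suffixI : Imm Q E E' → Imm Q (E ++ H) (E' ++ H)
suffixI {E = E} {E'} {H} i = perm (PP.++-comm E H) ⨾ prefixI H i ⨾ perm (PP.++-comm H E')

_⊕_ : Imm Q E E' → Imm Q H H' → Imm Q (E ++ H) (E' ++ H')
_⊕_ {E' = E'} i j = suffixI i ⨾ prefixI E' j

dropI : ∀ D → Imm Q (D ++ E) E
dropI []      = idI
dropI (e ∷ D) = del ⨾ dropI D

≡I : E ≡ E' → Imm Q E E'
≡I refl = idI

clearI : ∀ E → Imm Q E []
clearI E = ≡I (sym (++-identityʳ E)) ⨾ dropI E

filterI : (p : Edge n → Bool) → ∀ E → Imm Q E (sieve p E)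
filterI p [] = idI
filterI p (e ∷ E) with p e
... | true  = consI (filterI p E)
... | false = del ⨾ filterI p E

d-↭ : ∀ {E E' : List (Edge n)} X → E ↭ E' → d E X ≡ d E' X
d-↭ X = sumOf-↭ (cross X)

d-Imm : Imm Q E E' → ∀ X → d E' X ≤ d E X
d-Imm (perm p) X = ≤-reflexive (sym (d-↭ X p))
d-Imm (i ⨾ j)  X = ≤-trans (d-Imm j X) (d-Imm i X)
d-Imm del      X = m≤n+m _ _
d-Imm (flip {u} {v} {E}) X = ≤-reflexive (cong (_+ d E X) (cross-flip X v u))
d-Imm (split {u} {v} {w} {E} q) X = ≤-trans (+-monoˡ-≤ (d E X) (cross-tri X u v w)) (≤-reflexive (+-assoc (cross X (u , v)) _ _))

mapE : (Fin n → Fin n) → List (Edge n) → List (Edge n)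
mapE ρ = map λ (u , w) → ρ u , ρ w

d-mapE : (ρ : Fin n → Fin n) → ∀ E X → d (mapE ρ E) X ≡ d E (X ∘ ρ)
d-mapE ρ E X = sumOf-map (cross X) _ E

liftI : (ρ : Fin n → Fin n) → (∀ u v → ρ u ≡ ρ v → Q (ρ u) → u ≡ v) → Imm Q E E' → ∀ D → mapE ρ D ≡ E →
  Σ[ D' ∈ List (Edge n) ] Imm (Q ∘ ρ) D D' × mapE ρ D' ≡ E'
liftI ρ inj (perm p) D refl = let D' , e , q = PP.↭-map-inv _ p in D' , perm q , sym e
liftI ρ inj (i ⨾ j) D e = let D₁ , i₁ , e₁ = liftI ρ inj i D e ; D₂ , i₂ , e₂ = liftI ρ inj j D₁ e₁ in D₂ , (i₁ ⨾ i₂) , e₂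
liftI ρ inj del (_ ∷ D) refl = D , del , refl
liftI ρ inj flip ((u , v) ∷ D) refl = (v , u) ∷ D , flip , refl
liftI {Q = Q} ρ inj (split {v = x} q) ((u , v) ∷ (v' , w) ∷ D) e with split-parts e
  where
  split-parts : ∀ {a b c e' x u₀ w₀ : A} {L E₀ : List (A × A)} → _≡_ {A = List (A × A)} ((a , b) ∷ (c , e') ∷ L) ((u₀ , x) ∷ (x , w₀) ∷ E₀) →
    b ≡ x × c ≡ x × _≡_ {A = List (A × A)} ((a , e') ∷ L) ((u₀ , w₀) ∷ E₀)
  split-parts refl = refl , refl , refl
... | ρv , ρv' , rest with refl ← inj v v' (trans ρv (sym ρv')) (subst Q (sym ρv) q) = (u , w) ∷ D , split (subst Q (sym ρv) q) , rest

pick : VSet n → Fin n → List (Fin n)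
pick P u = if P u then [ u ] else []

endsIn : VSet n → List (Edge n) → List (Fin n)
endsIn P []            = []
endsIn P ((u , w) ∷ E) = pick P u ++ pick P w ++ endsIn P E

endsIn-↭ : ∀ (P : VSet n) {E E'} → E ↭ E' → endsIn P E ↭ endsIn P E'
endsIn-↭ P P.refl = ↭-refl
endsIn-↭ P (P.prep (u , w) p) = PP.++⁺ˡ (pick P u) (PP.++⁺ˡ (pick P w) (endsIn-↭ P p))
endsIn-↭ P (P.trans p q) = ↭-trans (endsIn-↭ P p) (endsIn-↭ P q)
endsIn-↭ P {_ ∷ _ ∷ E} {_ ∷ _ ∷ E'} (P.swap (u , w) (u' , w') p) =
  ↭-trans (↭-reflexive (sym (++-assoc (pick P u) (pick P w) _)))
  (↭-trans (↭-reflexive (cong ((pick P u ++ pick P w) ++_) (sym (++-assoc (pick P u') (pick P w') _))))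
  (↭-trans (PP.shifts (pick P u ++ pick P w) (pick P u' ++ pick P w'))
  (↭-trans (PP.++⁺ˡ (pick P u' ++ pick P w') (↭-trans (PP.++⁺ˡ (pick P u ++ pick P w) (endsIn-↭ P p)) (↭-reflexive (++-assoc (pick P u) (pick P w) _))))
    (↭-reflexive (++-assoc (pick P u') (pick P w') _)))))

endsIn-Imm : ∀ (P : VSet n) → (∀ v → Q v → P v ≡ false) → Imm Q E E' → Σ[ zs ∈ List (Fin n) ] endsIn P E ↭ endsIn P E' ++ zs
endsIn-Imm P h (perm p) = [] , ↭-trans (endsIn-↭ P p) (↭-reflexive (sym (++-identityʳ _)))
endsIn-Imm {E' = E'} P h (_⨾_ i j) =
  let zs , p = endsIn-Imm P h i ; zs' , p' = endsIn-Imm P h j in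
  zs' ++ zs , ↭-trans p (↭-trans (PP.++⁺ʳ zs p') (↭-reflexive (++-assoc (endsIn P E') zs' zs)))
endsIn-Imm {E' = E} P h (del {u , w}) = pick P u ++ pick P w ,
  ↭-trans (↭-reflexive (sym (++-assoc (pick P u) (pick P w) _))) (PP.++-comm (pick P u ++ pick P w) (endsIn P E))
endsIn-Imm P h (flip {u} {v} {E}) = [] , ↭-trans (PP.shifts (pick P u) (pick P v)) (↭-reflexive (sym (++-identityʳ _)))
endsIn-Imm P h (split {u} {v} {w} {E} q) rewrite h v q = [] , ↭-reflexive (sym (++-identityʳ _))

nonloop : Edge n → Bool
nonloop (u , w) = not (u == w)

nl : List (Edge n) → List (Edge n)
nl = sieve nonloop

loop-0 : ∀ (X : VSet n) {u w} → nonloop (u , w) ≡ false → cross X (u , w) ≡ 0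
loop-0 X {u} {w} e = cross-≡ X (cong X (==⇒≡ (unnot e)))

d-nl : ∀ E (X : VSet n) → d (nl E) X ≡ d E X
d-nl [] X = refl
d-nl ((u , w) ∷ E) X with nonloop (u , w) in eq
... | true  = cong (cross X (u , w) +_) (d-nl E X)
... | false = trans (d-nl E X) (cong (_+ d E X) (sym (loop-0 X {u} {w} eq)))

nl-mapE : (ρ : Fin n → Fin n) → ∀ E → nl (mapE ρ (nl E)) ≡ nl (mapE ρ E)
nl-mapE ρ [] = refl
nl-mapE ρ ((u , w) ∷ E) with u F.≟ w
... | yes refl rewrite ==-refl (ρ u) = nl-mapE ρ E
... | no _ with ρ u F.≟ ρ w
...   | yes _ = nl-mapE ρ E
...   | no  _ = cong (_ ∷_) (nl-mapE ρ E)

NonLoop : List (Edge n) → Set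
NonLoop E = ∀ {u w} → (u , w) ∈ₗ E → u ≢ w

nl-NonLoop : (E : List (Edge n)) → NonLoop (nl E)
nl-NonLoop E i refl = true≢false (proj₂ (sieve-∈ nonloop E i)) (cong not (==-refl _))

nl-id : (E : List (Edge n)) → NonLoop E → nl E ≡ E
nl-id [] h = refl
nl-id ((u , w) ∷ E) h rewrite ≢⇒== (h (here refl)) = cong (_ ∷_) (nl-id E (h ∘ there))

con : VSet n → Fin n → Fin n → Fin n
con X s v = if X v then s else v

con-in : ∀ {X : VSet n} {s v} → X v ≡ true → con X s v ≡ s
con-in e rewrite e = refl

con-out : ∀ {X : VSet n} {s v} → X v ≡ false → con X s v ≡ v
con-out e rewrite e = refl

inner : VSet n → Edge n → ℕ
inner X (u , w) = b2n (X u ∧ X w)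

inside : List (Edge n) → VSet n → ℕ
inside E X = sumOf (inner X) E

T[_,_] : VSet n → Fin n → List (Edge n) → List (Edge n)
T[ X , s ] E = nl (mapE (con X s) E)

T-↭ : ∀ (X : VSet n) s {E E'} → E ↭ E' → T[ X , s ] E ↭ T[ X , s ] E'
T-↭ X s p = sieve-↭ nonloop (PP.map⁺ _ p)

⊆-dec : (X Y : VSet n) → Dec (X ⊆ Y)
⊆-dec X Y = FP.all? λ v → dec (X v) (Y v)
  where
  dec : ∀ a b → Dec (a ≡ true → b ≡ true)
  dec true  true  = yes λ _ → refl
  dec true  false = no λ h → true≢false (h refl) refl
  dec false b     = yes λ ()

nl-≤ : (f : Edge n → ℕ) → ∀ E → sumOf f (nl E) ≤ sumOf f E
nl-≤ f [] = z≤n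
nl-≤ f (e ∷ E) with nonloop e
... | true  = +-monoʳ-≤ (f e) (nl-≤ f E)
... | false = ≤-trans (nl-≤ f E) (m≤n+m _ (f e))

NonLoop-↭ : ∀ {E E' : List (Edge n)} → E ↭ E' → NonLoop E → NonLoop E'
NonLoop-↭ p h i = h (PP.∈-resp-↭ (↭-sym p) i)

module _ {n} (s : Fin n) where
  private
    Q[_] : VSet n → Fin n → Set
    Q[ X ] v = X v ≡ true × v ≢ s

    Rooted : List (Edge n) → VSet n → Set
    Rooted E X = ∀ Z → Z s ≡ true → Z ⊆ X → d E X ≤ d E Z

    at-s : ∀ E Z → NonLoop E → Z s ≡ true → (∀ {e} → e ∈ₗ E → inner Z e ≡ 0) → d E Z ≤ d E (sg s) →
      ∀ {e} → e ∈ₗ E → cross (sg s) e ≡ cross Z e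
    at-s E Z nlE Zs none = sumOf-≡ E λ {e} i → le e i
      where
      le : ∀ e → e ∈ₗ E → cross (sg s) e ≤ cross Z e
      le (u , w) i with u F.≟ s | w F.≟ s | bool? (Z u) | bool? (Z w)
      ... | yes refl | yes refl | _ | _ = contradiction refl (nlE i)
      ... | no _     | no _     | _ | _ = z≤n
      ... | yes refl | no _     | _ | inj₁ zw = contradiction (none i) (inn Zs zw)
        where inn : ∀ {a b} → a ≡ true → b ≡ true → b2n (a ∧ b) ≢ 0
              inn refl refl ()
      ... | yes refl | no _     | _ | inj₂ zw = ≤-reflexive (sym (cross-tf Z Zs zw))
      ... | no _     | yes refl | inj₁ zu | _ = contradiction (none i) (inn zu Zs)
        where inn : ∀ {a b} → a ≡ true → b ≡ true → b2n (a ∧ b) ≢ 0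
              inn refl refl ()
      ... | no _     | yes refl | inj₂ zu | _ = ≤-reflexive (sym (cross-ft Z zu Zs))

    inn? : VSet n → Edge n → Bool
    inn? X (u , w) = X u ∧ X w

    b2n-0 : ∀ {b} → b ≡ false → b2n b ≡ 0
    b2n-0 refl = refl

    b2n-1 : ∀ {b} → b ≡ true → b2n b ≡ 1
    b2n-1 refl = refl

    con-out-s : ∀ {X : VSet n} {v} → (X v ≡ true → v ≡ s) → con X s v ≡ v
    con-out-s {X} {v} h with bool? (X v)
    ... | inj₁ e = trans (con-in {X = X} e) (sym (h e))
    ... | inj₂ e = con-out {X = X} e

    base : ∀ E X → NonLoop E → X s ≡ true → Rooted E X → (∀ {e} → e ∈ₗ E → inn? X e ≡ false) → T[ X , s ] E ≡ E
    base E X nlE Xs R none = trans (cong nl (go E λ i → i)) (nl-id E nlE)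
      where
      at : ∀ {e} → e ∈ₗ E → cross (sg s) e ≡ cross X e
      at = at-s E X nlE Xs (λ i → b2n-0 (none i)) (R (sg s) (==-refl s) λ v e → subst (λ z → X z ≡ true) (sym (==⇒≡ e)) Xs)
      fixˡ : ∀ {u w} → (u , w) ∈ₗ E → X u ≡ true → u ≡ s
      fixˡ {u} {w} i e with u F.≟ s
      ... | yes p = p
      ... | no h = contradiction (trans (sym (at i)) (cross-≡ (sg s) (trans (≢⇒== h) (sym (≢⇒== w≢))))) (λ z → true≢false (trans (sym (cross-0 X z)) e) xw)
        where xw : X w ≡ false
              xw = ¬true λ e' → true≢false (∧-intro e e') (none i)
              w≢ : w ≢ s
              w≢ refl = true≢false Xs xw
      fixʳ : ∀ {u w} → (u , w) ∈ₗ E → X w ≡ true → w ≡ s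
      fixʳ {u} {w} i e with w F.≟ s
      ... | yes p = p
      ... | no h = contradiction (trans (sym (at i)) (cross-≡ (sg s) (trans (≢⇒== u≢) (sym (≢⇒== h))))) (λ z → true≢false (trans (cross-0 X z) e) xu)
        where xu : X u ≡ false
              xu = ¬true λ e' → true≢false (∧-intro e' e) (none i)
              u≢ : u ≢ s
              u≢ refl = true≢false Xs xu
      go : ∀ D → (∀ {e} → e ∈ₗ D → e ∈ₗ E) → mapE (con X s) D ≡ D
      go [] h = refl
      go ((u , w) ∷ D) h = cong₂ _∷_ (cong₂ _,_ (con-out-s {X} (fixˡ (h (here refl)))) (con-out-s {X} (fixʳ (h (here refl))))) (go D (h ∘ there))

    Tight : List (Edge n) → VSet n → Edge n → VSet n → Set
    Tight E X e Z = Z s ≡ true × Z ⊆ X × cross Z e ≡ 1 × d E Z ≡ d E X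

    tight? : ∀ E X e → Dec (Σ (VSet n) (Tight E X e))
    tight? E X (u , w) = anyVSet (λ Z → (Z s 𝔹.≟ true) ×-dec (⊆-dec Z X ×-dec ((cross Z (u , w) ≟ℕ 1) ×-dec (d E Z ≟ℕ d E X))))
      λ e (a , b , c , f) → trans (sym (e s)) a , (λ v h → b v (trans (e v) h)) , trans (sym (SLike.ext (nmSet-SLike u w w) e)) c , trans (sym (d-ext E e)) f
      where open import Data.Nat.Properties using () renaming (_≟_ to _≟ℕ_)

    Goal : ℕ → Set
    Goal m = ∀ E X → NonLoop E → X s ≡ true → Rooted E X → inside E X ≤ m → Imm Q[ X ] E (T[ X , s ] E)

    Rooted-↭ : ∀ {E E'} X → E ↭ E' → Rooted E X → Rooted E' X
    Rooted-↭ X p R Z a b = subst₂ _≤_ (d-↭ X p) (d-↭ Z p) (R Z a b)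

    delete : ∀ {m} → Goal m → ∀ e E X → NonLoop (e ∷ E) → X s ≡ true → Rooted (e ∷ E) X → inside (e ∷ E) X ≤ suc m → inn? X e ≡ true →
      ¬ Σ (VSet n) (Tight (e ∷ E) X e) → Imm Q[ X ] (e ∷ E) (T[ X , s ] (e ∷ E))
    delete rec e@(u , w) E X nlE Xs R le ine no-t = del ⨾ rec E X (nlE ∘ there) Xs R' (≤-pred (subst (λ z → z + inside E X ≤ _) (b2n-1 ine) le)) ⨾ ≡I same
      where
      Xu = proj₁ (∧-elim ine)
      Xw = proj₂ (∧-elim {X u} ine)
      same : T[ X , s ] E ≡ T[ X , s ] (e ∷ E)
      same rewrite con-in {X = X} {s} Xu | con-in {X = X} {s} Xw | ==-refl s = refl
      R' : Rooted E X
      R' Z a b with m≤n⇒m<n∨m≡n (cross≤1 Z e) | m≤n⇒m<n∨m≡n (R Z a b)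
      ... | inj₁ c0 | _ = subst₂ _≤_ (cong (_+ d E X) (cross-≡ X (trans Xu (sym Xw)))) (cong (_+ d E Z) (n≤0⇒n≡0 (≤-pred c0))) (R Z a b)
      ... | inj₂ c1 | inj₂ eq = contradiction (Z , a , b , c1 , sym eq) no-t
      ... | inj₂ c1 | inj₁ lt = ≤-pred (subst₂ (λ x y → suc (x + d E X) ≤ y + d E Z) (cross-≡ X (trans Xu (sym Xw))) c1 lt)

    con-con : ∀ {X Z : VSet n} → Z ⊆ X → X s ≡ true → ∀ v → con X s (con Z s v) ≡ con X s v
    con-con {X} {Z} h Xs v with bool? (Z v)
    ... | inj₁ e = trans (cong (con X s) (con-in {X = Z} e)) (trans (con-in {X = X} Xs) (sym (con-in {X = X} (h v e))))
    ... | inj₂ e = cong (con X s) (con-out {X = Z} e)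

    con-∈ : ∀ {X Z : VSet n} → Z ⊆ X → X s ≡ true → ∀ v → X (con Z s v) ≡ X v
    con-∈ {X} {Z} h Xs v with bool? (Z v)
    ... | inj₁ e = trans (cong X (con-in {X = Z} e)) (trans Xs (sym (h v e)))
    ... | inj₂ e = cong X (con-out {X = Z} e)

    contract : ∀ {m} → Goal m → ∀ E X Z → NonLoop E → X s ≡ true → Rooted E X → inside E X ≤ suc m → Z s ≡ true → Z ⊆ X → d E Z ≡ d E X →
      inside E Z < inside E X → ∀ f → f ∈ₗ E → inn? Z f ≡ true → Imm Q[ X ] E (T[ X , s ] E)
    contract {m} rec E X Z nlE Xs R le Zs Z⊆X dZ lt f f∈ inf =
      weaken (λ v (a , b) → Z⊆X v a , b) (rec E Z nlE Zs RZ (≤-pred (≤-trans lt le)))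
      ⨾ rec E₁ X (nl-NonLoop (mapE (con Z s) E)) Xs R₁ (≤-pred (≤-trans in₁ le)) ⨾ ≡I same
      where
      E₁ = T[ Z , s ] E
      RZ : Rooted E Z
      RZ Y a b = ≤-trans (≤-reflexive dZ) (R Y a (λ v → Z⊆X v ∘ b v))
      dE₁ : ∀ Y → d E₁ Y ≡ d E (Y ∘ con Z s)
      dE₁ Y = trans (d-nl (mapE (con Z s) E) Y) (d-mapE _ E Y)
      R₁ : Rooted E₁ X
      R₁ Y Ys Y⊆X = subst₂ _≤_ (sym (trans (dE₁ X) (d-ext E (con-∈ Z⊆X Xs)))) (sym (dE₁ Y))
        (R (Y ∘ con Z s) (trans (cong Y (con-in {X = Z} Zs)) Ys) λ v e → trans (sym (con-∈ Z⊆X Xs v)) (Y⊆X _ e))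
      same : T[ X , s ] E₁ ≡ T[ X , s ] E
      same = trans (nl-mapE (con X s) (mapE (con Z s) E)) (cong nl (trans (sym (map-∘ E)) (map-cong (λ (u , w) → cong₂ _,_ (con-con Z⊆X Xs u) (con-con Z⊆X Xs w)) E)))
      in₁ : inside E₁ X < inside E X
      in₁ with E₀ , p ← extract f∈ = subst₂ (λ a b → suc a ≤ b) (sumOf-↭ (inner X) (T-↭ Z s (↭-sym p))) (sym (sumOf-↭ (inner X) p))
          (subst₂ (λ a b → suc (inside a X) ≤ b + inside E₀ X) (sym drop-f) (sym (b2n-1 (∧-intro (Z⊆X _ Zu) (Z⊆X _ Zw)))) (s≤s
            (≤-trans (nl-≤ (inner X) (mapE (con Z s) E₀)) (≤-reflexive (trans (sumOf-map (inner X) _ E₀) (sumOf-cong E₀ λ (u , w) → cong₂ (λ a b → b2n (a ∧ b)) (con-∈ Z⊆X Xs u) (con-∈ Z⊆X Xs w)))))))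
        where
        Zu = proj₁ (∧-elim inf)
        Zw = proj₂ (∧-elim {Z (proj₁ f)} inf)
        drop-f : T[ Z , s ] (f ∷ E₀) ≡ T[ Z , s ] E₀
        drop-f rewrite con-in {X = Z} {s} Zu | con-in {X = Z} {s} Zw | ==-refl s = refl

    sg-⊆ : ∀ {X : VSet n} → X s ≡ true → sg s ⊆ X
    sg-⊆ {X} Xs v e = subst (λ z → X z ≡ true) (sym (==⇒≡ e)) Xs

    inside-< : ∀ E X Z e → Z ⊆ X → e ∈ₗ E → inn? X e ≡ true → cross Z e ≡ 1 → inside E Z < inside E X
    inside-< E X Z e@(u , w) Z⊆X i t c = sumOf-< E (λ {e} _ → le e) i (subst₂ _<_ (sym (b2n-0 (¬true no-in))) (sym (b2n-1 t)) ≤-refl)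
      where
      mono : ∀ {a b a' b'} → (a ≡ true → a' ≡ true) → (b ≡ true → b' ≡ true) → b2n (a ∧ b) ≤ b2n (a' ∧ b')
      mono {true} {true} h k rewrite h refl | k refl = ≤-refl
      mono {true} {false} h k = z≤n
      mono {false} h k = z≤n
      le : ∀ e → inner Z e ≤ inner X e
      le (u , w) = mono (Z⊆X u) (Z⊆X w)
      no-in : ¬ (inn? Z e ≡ true)
      no-in t with a , b ← ∧-elim {Z u} t = contradiction (trans (sym c) (cross-≡ Z (trans a (sym b)))) λ ()

    split-out : ∀ {m} → Goal m → ∀ y o E X → NonLoop ((s , y) ∷ (y , o) ∷ E) → X s ≡ true → Rooted ((s , y) ∷ (y , o) ∷ E) X →
      inside ((s , y) ∷ (y , o) ∷ E) X ≤ suc m → X y ≡ true → X o ≡ false →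
      Imm Q[ X ] ((s , y) ∷ (y , o) ∷ E) (T[ X , s ] ((s , y) ∷ (y , o) ∷ E))
    split-out {m} rec y o E X nlE Xs R le Xy Xo = split (Xy , λ e → nlE (here refl) (sym e)) ⨾ rec E₂ X nl₂ Xs R₂ le₂ ⨾ ≡I same
      where
      E₂ = (s , o) ∷ E
      s≢o : s ≢ o
      s≢o refl = true≢false Xs Xo
      nl₂ : NonLoop E₂
      nl₂ (here refl) = s≢o
      nl₂ (there i)   = nlE (there (there i))
      dd : ∀ Z → Z s ≡ true → Z ⊆ X → d ((s , y) ∷ (y , o) ∷ E) Z ≡ d E₂ Z
      dd Z Zs Z⊆X with Zo ← ¬true {Z o} (λ e → true≢false (Z⊆X o e) Xo) | bool? (Z y)
      ... | inj₁ Zy rewrite cross-≡ Z (trans Zs (sym Zy)) | cross-tf Z Zy Zo | cross-tf Z Zs Zo = refl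
      ... | inj₂ Zy rewrite cross-tf Z Zs Zy | cross-≡ Z (trans Zy (sym Zo)) | cross-tf Z Zs Zo = refl
      R₂ : Rooted E₂ X
      R₂ Z Zs Z⊆X = subst₂ _≤_ (dd X Xs (λ _ e → e)) (dd Z Zs Z⊆X) (R Z Zs Z⊆X)
      le₂ : inside E₂ X ≤ m
      le₂ = ≤-pred (subst₂ (λ a b → suc a + inside E X ≤ b) (sym (b2n-0 (so Xs Xo))) refl (≤-trans (s≤s (m≤n+m _ (inner X (y , o)))) (subst (λ z → z + _ ≤ suc m) (b2n-1 (∧-intro Xs Xy)) le)))
        where so : ∀ {a b} → a ≡ true → b ≡ false → a ∧ b ≡ false
              so refl refl = refl
      same : T[ X , s ] E₂ ≡ T[ X , s ] ((s , y) ∷ (y , o) ∷ E)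
      same rewrite con-in {X = X} {s} Xs | con-in {X = X} {s} Xy | con-out {X = X} {s} Xo | ==-refl s = refl

    at? : Fin n → Edge n → Bool
    at? y (u , w) = (u == y) ∨ (w == y)

    go : ∀ m → Goal m

    resp : ∀ {E E'} X → E ↭ E' → Imm Q[ X ] E' (T[ X , s ] E') → Imm Q[ X ] E (T[ X , s ] E)
    resp X p i = perm p ⨾ i ⨾ perm (T-↭ X s (↭-sym p))

    flipped : ∀ {X u w E} → Imm Q[ X ] ((u , w) ∷ E) (T[ X , s ] ((u , w) ∷ E)) → Imm Q[ X ] ((w , u) ∷ E) (T[ X , s ] ((w , u) ∷ E))
    flipped {X} {u} {w} {E} i = flip ⨾ i ⨾ lem
      where
      lem : Imm Q[ X ] (T[ X , s ] ((u , w) ∷ E)) (T[ X , s ] ((w , u) ∷ E))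
      lem rewrite ==-sym (con X s w) (con X s u) with con X s u == con X s w
      ... | true  = idI
      ... | false = flip

    star : ∀ m y E X → NonLoop ((s , y) ∷ E) → X s ≡ true → Rooted ((s , y) ∷ E) X → inside ((s , y) ∷ E) X ≤ suc m → X y ≡ true →
      (∀ {e} → e ∈ₗ E → inn? X e ≡ true → at? s e ≡ true) → d ((s , y) ∷ E) (sg s) ≤ d ((s , y) ∷ E) X →
      Imm Q[ X ] ((s , y) ∷ E) (T[ X , s ] ((s , y) ∷ E))
    star m y E X nlE Xs R le Xy ats ds with findᵇ (λ (u , w) → (u == y) ∧ not (X w)) E
    ... | inj₁ ((u , o) , i , e) with E₁ , p ← extract i with refl ← ==⇒≡ {u = u} (proj₁ (∧-elim e)) =
      resp X (P.prep _ p) (split-out (go m) u o E₁ X (NonLoop-↭ (P.prep _ p) nlE) Xs (Rooted-↭ X (P.prep _ p) R)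
        (subst (_≤ suc m) (sumOf-↭ (inner X) (P.prep (s , u) p)) le) Xy (not-f (proj₂ (∧-elim {u == u} e))))
    ... | inj₂ none with findᵇ (λ (u , w) → (w == y) ∧ not (X u)) E
    ...   | inj₁ ((o , u) , i , e) with E₁ , p ← extract i with refl ← ==⇒≡ {u = u} (proj₁ (∧-elim e)) =
      resp X (↭-trans (P.prep _ p) (P.swap _ _ ↭-refl)) (flipped (resp X (P.swap _ _ ↭-refl) (split-out (go m) u o E₁ X nl' Xs R' le' Xy Xo)))
      where
      Xo = not-f (proj₂ (∧-elim {u == u} e))
      nl' : NonLoop ((s , u) ∷ (u , o) ∷ E₁)
      nl' (here refl) = nlE (here refl)
      nl' (there (here refl)) = λ e → nlE (there i) (sym e)
      nl' (there (there j)) = NonLoop-↭ (P.prep _ p) nlE (there (there j))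
      dd : ∀ Z → d ((s , u) ∷ E) Z ≡ d ((s , u) ∷ (u , o) ∷ E₁) Z
      dd Z = cong (cross Z (s , u) +_) (trans (d-↭ Z p) (cong (_+ d E₁ Z) (cross-flip Z o u)))
      R' : Rooted ((s , u) ∷ (u , o) ∷ E₁) X
      R' Z a b = subst₂ _≤_ (dd X) (dd Z) (R Z a b)
      le' : inside ((s , u) ∷ (u , o) ∷ E₁) X ≤ suc m
      le' = subst (_≤ suc m) (cong (inner X (s , u) +_) (trans (sumOf-↭ (inner X) p) (cong (λ z → b2n z + inside E₁ X) (𝔹.∧-comm (X o) (X u))))) le
    ...   | inj₂ none' = contradiction (≤-trans (s≤s (sumOf-≤ {f = cross Y} {cross (sg s)} E λ {e} → le' e)) (≤-trans (≤-reflexive (sym eqS)) (≤-trans ds (≤-trans (R Y Ys Y⊆X) (≤-reflexive eqY))))) 1+n≰n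
      where
      s≢y = nlE (here refl)
      Y : VSet n
      Y = sg s ∪ sg y
      Ys : Y s ≡ true
      Ys = ∨-introˡ (==-refl s)
      Yy : Y y ≡ true
      Yy = ∨-introʳ {y == s} (==-refl y)
      Y⊆X : Y ⊆ X
      Y⊆X v e with v F.≟ s | v F.≟ y
      ... | yes refl | _ = Xs
      ... | no _ | yes refl = Xy
      eqS : d ((s , y) ∷ E) (sg s) ≡ suc (d E (sg s))
      eqS = cong (_+ d E (sg s)) (cross-tf (sg s) (==-refl s) (≢⇒== (s≢y ∘ sym)))
      eqY : d ((s , y) ∷ E) Y ≡ d E Y
      eqY = cong (_+ d E Y) (cross-≡ Y {s} {y} (trans Ys (sym Yy)))
      out : ∀ {v} → v ≢ s → v ≢ y → Y v ≡ false
      out a b = ∨-false (≢⇒== a) (≢⇒== b)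
      at-other : ∀ {v} → v ≢ y → Y v ≡ sg s v
      at-other {v} h = trans (cong ((v == s) ∨_) (≢⇒== h)) (𝔹.∨-identityʳ (v == s))
      at-y : ∀ {w} → Dec (w ≡ s) → y ≢ w → (X w ≡ true → w ≢ s → ⊥) → (X w ≡ false → ⊥) → Y w ≡ true
      at-y (yes refl) _ _ _ = Ys
      at-y {w} (no c) _ h k with bool? (X w)
      ... | inj₁ t = ⊥-elim (h t c)
      ... | inj₂ f = ⊥-elim (k f)
      le″ : ∀ u w → (u , w) ∈ₗ E → Dec (u ≡ y) → Dec (w ≡ y) → cross Y (u , w) ≤ cross (sg s) (u , w)
      le″ u w i (no a) (no b) = ≤-reflexive (cong₂ (λ p q → nm p q q) (at-other a) (at-other b))
      le″ u w i (yes refl) (yes refl) = contradiction refl (nlE (there i))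
      le″ u w i (yes refl) (no b) = ≤-trans (≤-reflexive (cross-≡ Y {u} {w} (trans Yy (sym (at-y (w F.≟ s) (b ∘ sym)
        (λ t c → true≢false (ats i (∧-intro Xy t)) (∨-false (≢⇒== (s≢y ∘ sym)) (≢⇒== c))) λ f → true≢false (∧-intro (==-refl u) (not-t f)) (none i)))))) z≤n
      le″ u w i (no a) (yes refl) = ≤-trans (≤-reflexive (cross-≡ Y {u} {w} (trans (at-y (u F.≟ s) (a ∘ sym)
        (λ t c → true≢false (ats i (∧-intro t Xy)) (∨-false (≢⇒== c) (≢⇒== (s≢y ∘ sym)))) λ f → true≢false (∧-intro (==-refl w) (not-t f)) (none' i)) (sym Yy)))) z≤n
      le' : ∀ e → e ∈ₗ E → cross Y e ≤ cross (sg s) e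
      le' (u , w) i = le″ u w i (u F.≟ y) (w F.≟ y)

    go zero E X nlE Xs R le = ≡I (sym (base E X nlE Xs R none))
      where
      none : ∀ {e} → e ∈ₗ E → inn? X e ≡ false
      none {e} i = ¬true λ t → n≮0 (≤-trans (≤-reflexive (sym (b2n-1 t))) (≤-trans (sumOf-∈ (inner X) i) le))
    go (suc m) E X nlE Xs R le with findᵇ (λ e → inn? X e ∧ not (at? s e)) E
    ... | inj₁ (e@(x , y) , i , t) with E₀ , p ← extract i | tight? E X e
    ...   | no no-t = resp X p (delete (go m) e E₀ X (NonLoop-↭ p nlE) Xs (Rooted-↭ X p R) (subst (_≤ suc m) (sumOf-↭ (inner X) p) le) (proj₁ (∧-elim t))
        λ (Z , a , b , c , f) → no-t (Z , a , b , c , trans (d-↭ Z p) (trans f (sym (d-↭ X p)))))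
    ...   | yes (Z , Zs , Z⊆X , c , dZ) with findᵇ (inn? Z) E
    ...     | inj₁ (f , j , t') = contract (go m) E X Z nlE Xs R le Zs Z⊆X dZ (inside-< E X Z e Z⊆X i (proj₁ (∧-elim t)) c) f j t'
    ...     | inj₂ none = contradiction (trans (sym c) (trans (sym (at-s E Z nlE Zs (λ j → b2n-0 (none j)) (≤-trans (≤-reflexive dZ) (R (sg s) (==-refl s) (sg-⊆ Xs))) i)) (cross-≡ (sg s) (trans (proj₁ off) (sym (proj₂ off)))))) λ ()
      where
      not-∨ : ∀ a {b} → not (a ∨ b) ≡ true → a ≡ false × b ≡ false
      not-∨ false {false} _ = refl , refl
      off : (x == s) ≡ false × (y == s) ≡ false
      off = not-∨ (x == s) (proj₂ (∧-elim {inn? X e} t))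
    go (suc m) E X nlE Xs R le | inj₂ none with findᵇ (inn? X) E
    ... | inj₂ none' = ≡I (sym (base E X nlE Xs R none'))
    ... | inj₁ (e@(x , y) , i , t) with E₀ , p ← extract i | tight? E X e
    ...   | no no-t = resp X p (delete (go m) e E₀ X (NonLoop-↭ p nlE) Xs (Rooted-↭ X p R) (subst (_≤ suc m) (sumOf-↭ (inner X) p) le) t
        λ (Z , a , b , c , f) → no-t (Z , a , b , c , trans (d-↭ Z p) (trans f (sym (d-↭ X p)))))
    ...   | yes (Z , Zs , Z⊆X , c , dZ) with findᵇ (inn? Z) E
    ...     | inj₁ (f , j , t') = contract (go m) E X Z nlE Xs R le Zs Z⊆X dZ (inside-< E X Z e Z⊆X i t c) f j t'
    ...     | inj₂ noneZ = orient (x F.≟ s) (y F.≟ s)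
      where
      ats : ∀ {e} → e ∈ₗ E → inn? X e ≡ true → at? s e ≡ true
      ats {e} j ie with bool? (at? s e)
      ... | inj₁ r = r
      ... | inj₂ r = ⊥-elim (true≢false (∧-intro ie (not-t r)) (none j))
      ds : d E (sg s) ≤ d E X
      ds = ≤-trans (sumOf-≤ {f = cross (sg s)} {cross Z} E λ {e} j → ≤-reflexive (at-s E Z nlE Zs (λ {e} j → b2n-0 (noneZ {e} j)) (≤-trans (≤-reflexive dZ) (R (sg s) (==-refl s) (sg-⊆ Xs))) {e} j)) (≤-reflexive dZ)
      orient : Dec (x ≡ s) → Dec (y ≡ s) → Imm Q[ X ] E (T[ X , s ] E)
      orient (yes refl) _ = resp X p (star m y E₀ X (NonLoop-↭ p nlE) Xs (Rooted-↭ X p R) (subst (_≤ suc m) (sumOf-↭ (inner X) p) le) (proj₂ (∧-elim {X x} t))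
        (λ j → ats (PP.∈-resp-↭ (↭-sym p) (there j))) (subst₂ _≤_ (d-↭ (sg s) p) (d-↭ X p) ds))
      orient (no h) (yes refl) = resp X p (flipped (star m x E₀ X nl' Xs (λ Z a b → subst₂ _≤_ (dd X) (dd Z) (R Z a b))
          (subst (_≤ suc m) (trans (sumOf-↭ (inner X) p) (cong (λ z → b2n z + inside E₀ X) (𝔹.∧-comm (X x) (X y)))) le) (proj₁ (∧-elim t))
          (λ j → ats (PP.∈-resp-↭ (↭-sym p) (there j))) (subst₂ _≤_ (dd (sg s)) (dd X) ds)))
        where
        dd : ∀ Z → d E Z ≡ d ((y , x) ∷ E₀) Z
        dd Z = trans (d-↭ Z p) (cong (_+ d E₀ Z) (cross-flip Z x y))
        nl' : NonLoop ((y , x) ∷ E₀)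
        nl' (here refl) = h ∘ sym
        nl' (there j)   = NonLoop-↭ p nlE (there j)
      orient (no h) (no h') = ⊥-elim (true≢false (ats i t) (∨-false (≢⇒== h) (≢⇒== h')))

  -- Menger's theorem.
  contraction : ∀ E X → X s ≡ true → Rooted E X → Imm Q[ X ] E (T[ X , s ] E)
  contraction E X Xs R = filterI nonloop E ⨾ go _ (nl E) X (nl-NonLoop E) Xs (λ Z a b → subst₂ _≤_ (sym (d-nl E X)) (sym (d-nl E Z)) (R Z a b)) ≤-refl ⨾ ≡I (nl-mapE (con X s) E)

Sep : VSet n → VSet n → Set
Sep S X = (∃[ u ] S u ≡ true × X u ≡ true) × (∃[ w ] S w ≡ true × X w ≡ false)

Conn : ℕ → VSet n → List (Edge n) → Set
Conn k S E = ∀ X → Sep S X → k ≤ d E X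

Tight : ℕ → VSet n → List (Edge n) → VSet n → Set
Tight k S E X = Sep S X × d E X ≤ k

AllTight : ℕ → VSet n → List (Edge n) → Set
AllTight k S E = ∀ {u w} → (u , w) ∈ₗ E → u ≢ w → Σ[ X ∈ VSet _ ] Tight k S E X × cross X (u , w) ≡ 1

Indep : VSet n → List (Edge n) → Set
Indep S E = ∀ {u w} → (u , w) ∈ₗ E → u ≢ w → (S u ≡ true) ⊎ (S w ≡ true)

Sep-ext : ∀ {S X Y : VSet n} → (∀ v → X v ≡ Y v) → Sep S X → Sep S Y
Sep-ext e ((u , a , b) , (w , c , f)) = (u , a , trans (sym (e u)) b) , (w , c , trans (sym (e w)) f)

Sep-∁ : ∀ {S X : VSet n} → Sep S X → Sep S (∁ X)
Sep-∁ ((u , a , b) , (w , c , f)) = (w , c , not-t f) , (u , a , cong not b)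

Sep? : (S X : VSet n) → Dec (Sep S X)
Sep? S X = FP.any? (λ u → (S u 𝔹.≟ true) ×-dec (X u 𝔹.≟ true)) ×-dec FP.any? (λ u → (S u 𝔹.≟ true) ×-dec (X u 𝔹.≟ false))

splitAll : ∀ {P : A → Set} → (∀ x → Dec (P x)) → ∀ xs → (Σ[ x ∈ A ] x ∈ₗ xs × ¬ P x) ⊎ (∀ {x} → x ∈ₗ xs → P x)
splitAll P? [] = inj₂ λ ()
splitAll P? (x ∷ xs) with P? x | splitAll P? xs
... | no h  | _ = inj₁ (x , here refl , h)
... | yes _ | inj₁ (y , i , h) = inj₁ (y , there i , h)
... | yes p | inj₂ h = inj₂ λ { (here refl) → p ; (there i) → h i }

minimise : ∀ {k} {S : VSet n} {Q} m E → length E ≤ m → Conn k S E → Σ[ E' ∈ List (Edge n) ] Imm Q E E' × Conn k S E' × AllTight k S E'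
minimise {k = k} {S} m E le c with splitAll tight? E
  where
  tight? : ∀ e → Dec ((proj₁ e ≢ proj₂ e) → Σ[ X ∈ VSet _ ] Tight k S E X × cross X e ≡ 1)
  tight? (u , w) with u F.≟ w
  ... | yes p = yes λ h → contradiction p h
  ... | no h = map′ (λ r _ → r) (λ f → f h) (anyVSet (λ X → (Sep? S X ×-dec (d E X ≤? k)) ×-dec (cross X (u , w) ≟ℕ 1))
    λ e ((a , b) , c) → (Sep-ext e a , ≤-trans (≤-reflexive (sym (d-ext E e))) b) , trans (sym (SLike.ext (nmSet-SLike u w w) e)) c)
    where open import Data.Nat.Properties using () renaming (_≟_ to _≟ℕ_)
... | inj₂ h = E , idI , c , λ i ne → h i ne
minimise {k = k} {S} zero    []      le c | inj₁ (e , () , h)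
minimise {k = k} {S} (suc m) E le c | inj₁ (e , i , h) with E₀ , p ← extract i =
  let E' , j , r = minimise m E₀ (≤-pred (≤-trans (≤-reflexive (sym (PP.↭-length p))) le)) c₀ in E' , (perm p ⨾ del ⨾ j) , r
  where
  c₀ : Conn k S E₀
  c₀ X s with m≤n⇒m<n∨m≡n (cross≤1 X e)
  ... | inj₁ c0 = subst (k ≤_) (trans (d-↭ X p) (cong (_+ d E₀ X) (n≤0⇒n≡0 (≤-pred c0)))) (c X s)
  ... | inj₂ c1 with k ≤? d E₀ X
  ...   | yes q = q
  ...   | no q  = ⊥-elim (h λ _ → X , (s , ≤-trans (≤-reflexive (trans (d-↭ X p) (cong (_+ d E₀ X) c1))) (≰⇒> q)) , c1)

keep : VSet n → Fin n → VSet n → VSet n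
keep X s S v = S v ∧ (not (X v) ∨ (v == s))

bad : VSet n → Edge n → ℕ
bad S (u , w) = b2n (not (S u) ∧ not (S w))

module _ {n} {k} {S : VSet n} {E : List (Edge n)} (c : Conn k S E) (at : AllTight k S E) {X : VSet n} (tX : Tight k S E X)
         {s : Fin n} (Ss : S s ≡ true) (Xs : X s ≡ true) where
  private
    E₁ = T[ X , s ] E
    S₁ = keep X s S

    S₁s : S₁ s ≡ true
    S₁s = ∧-intro Ss (∨-introʳ {not (X s)} (==-refl s))

    S₁out : ∀ {v} → S v ≡ true → X v ≡ false → S₁ v ≡ true
    S₁out a b = ∧-intro a (∨-introˡ (not-t b))

    S₁⊆ : ∀ {v} → S₁ v ≡ true → S v ≡ true × con X s v ≡ v
    S₁⊆ {v} e with a , b ← ∧-elim {S v} e with bool? (X v)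
    ... | inj₂ f = a , con-out {X = X} f
    ... | inj₁ t = a , trans (con-in {X = X} t) (sym (==⇒≡ (subst (λ z → not z ∨ (v == s) ≡ true) t b)))

    dE₁ : ∀ Y → d E₁ Y ≡ d E (Y ∘ con X s)
    dE₁ Y = trans (d-nl (mapE (con X s) E) Y) (d-mapE _ E Y)

    E₁∈ : ∀ {u w} → (u , w) ∈ₗ E₁ → Σ[ u₀ ∈ Fin n ] Σ[ w₀ ∈ Fin n ] (u₀ , w₀) ∈ₗ E × u ≡ con X s u₀ × w ≡ con X s w₀ × u₀ ≢ w₀
    E₁∈ i with j , ne ← sieve-∈ nonloop (mapE (con X s) E) i with (u₀ , w₀) , l , refl ← ∈-map⁻ _ j =
      u₀ , w₀ , l , refl , refl , λ e → true≢false ne (cong not (trans (cong (con X s u₀ ==_) (cong (con X s) (sym e))) (==-refl _)))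

  contract-Imm : ∀ {Q : Fin n → Set} → (∀ v → X v ≡ true → v ≢ s → Q v) → Imm Q E E₁
  contract-Imm q = weaken (λ v (a , b) → q v a b) (contraction s E X Xs λ Z Zs Z⊆X → ≤-trans (proj₂ tX) (c Z ((s , Ss , Zs) , out Z Z⊆X (proj₂ (proj₁ tX)))))
    where
    out : ∀ Z → Z ⊆ X → (∃[ w ] S w ≡ true × X w ≡ false) → ∃[ w ] S w ≡ true × Z w ≡ false
    out Z Z⊆X (w , a , b) = w , a , ¬true λ e → true≢false (Z⊆X w e) b

  contract-Conn : Conn k S₁ E₁
  contract-Conn Y ((u , a , b) , (w , a' , b')) with p , q ← S₁⊆ a | p' , q' ← S₁⊆ a' =
    subst (k ≤_) (sym (dE₁ Y)) (c (Y ∘ con X s) ((u , p , trans (cong Y q) b) , (w , p' , trans (cong Y q') b')))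

  private
    tight₁ : ∀ Y → Y s ≡ true × (∀ v → X v ≡ true → Y v ≡ true) ⊎ Y s ≡ false × (∀ v → X v ≡ true → Y v ≡ false) → d E Y ≤ k → d E₁ Y ≤ k
    tight₁ Y h le = ≤-trans (≤-reflexive (trans (dE₁ Y) (d-ext E (same h)))) le
      where
      same : Y s ≡ true × (∀ v → X v ≡ true → Y v ≡ true) ⊎ Y s ≡ false × (∀ v → X v ≡ true → Y v ≡ false) → ∀ v → Y (con X s v) ≡ Y v
      same h v with bool? (X v)
      ... | inj₂ f = cong Y (con-out {X = X} f)
      same (inj₁ (a , b)) v | inj₁ t = trans (cong Y (con-in {X = X} t)) (trans a (sym (b v t)))
      same (inj₂ (a , b)) v | inj₁ t = trans (cong Y (con-in {X = X} t)) (trans a (sym (b v t)))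

    uncross : ∀ Z → Tight k S E Z → Tight k S₁ E₁ (X ∪ Z) ⊎ Tight k S₁ E₁ (Z ∖ X)
    uncross Z (((z , Sz , Zz) , (z' , Sz' , Zz')) , dZ) = pickCase
        (FP.any? (λ v → (S v 𝔹.≟ true) ×-dec ((X v 𝔹.≟ false) ×-dec (Z v 𝔹.≟ false))))
        (FP.any? (λ v → (S v 𝔹.≟ true) ×-dec ((X v 𝔹.≟ true) ×-dec (Z v 𝔹.≟ true))))
      where
      lem : ∀ z → z ∧ not (X s) ≡ false
      lem z = trans (cong (λ x → z ∧ not x) Xs) (𝔹.∧-zeroʳ z)
      diff : ∀ {a b} → S a ≡ true → X a ≡ true → Z a ≡ false → S b ≡ true → X b ≡ false → Z b ≡ true → Tight k S₁ E₁ (Z ∖ X)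
      diff {a} {b} Sa Xa Za Sb Xb Zb = ((b , S₁out Sb Xb , ∧-intro Zb (not-t Xb)) , (s , S₁s , lem (Z s))) ,
        tight₁ (Z ∖ X) (inj₂ (lem (Z s) , λ v t → trans (cong (λ z → Z v ∧ not z) t) (𝔹.∧-zeroʳ (Z v))))
          (+-cancelˡ-≤ k _ _ (≤-trans (+-monoˡ-≤ _ (c (X ∖ Z) ((a , Sa , ∧-intro Xa (not-t Za)) , (b , Sb , cong (_∧ not (Z b)) Xb))))
            (≤-trans (SLike.pos (d-SLike E) X Z) (+-mono-≤ (proj₂ tX) dZ))))
      pickCase : Dec _ → Dec _ → Tight k S₁ E₁ (X ∪ Z) ⊎ Tight k S₁ E₁ (Z ∖ X)
      pickCase (yes (o , So , Xo , Zo)) (yes (m , Sm , Xm , Zm)) = inj₁ (((s , S₁s , ∨-introˡ Xs) , (o , S₁out So Xo , ∨-false Xo Zo)) ,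
          tight₁ (X ∪ Z) (inj₁ (∨-introˡ Xs , λ v t → ∨-introˡ t))
            (+-cancelˡ-≤ k _ _ (≤-trans (+-monoˡ-≤ _ (c (X ∩ Z) ((m , Sm , ∧-intro Xm Zm) , (o , So , cong (_∧ Z o) Xo))))
              (≤-trans (SLike.sub (d-SLike E) X Z) (+-mono-≤ (proj₂ tX) dZ)))))
      pickCase _ (no q) = inj₂ (diff Ss Xs (¬true λ e → q (s , Ss , Xs , e)) Sz (¬true λ e → q (z , Sz , e , Zz)) Zz)
      pickCase (no p) _ with w , Sw , Xw ← proj₂ (proj₁ tX) with bool? (X z') | bool? (Z w)
      ... | inj₁ xz' | inj₁ zw = inj₂ (diff Sz' xz' Zz' Sw Xw zw)
      ... | inj₂ xz' | _       = ⊥-elim (p (z' , Sz' , xz' , Zz'))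
      ... | _        | inj₂ zw = ⊥-elim (p (w , Sw , Xw , zw))

    tightX : Tight k S₁ E₁ X
    tightX = ((s , S₁s , Xs) , (let w , a , b = proj₂ (proj₁ tX) in w , S₁out a b , b)) , tight₁ X (inj₁ (Xs , λ v t → t)) (proj₂ tX)

  contract-AllTight : AllTight k S₁ E₁
  contract-AllTight i ne with u , w , j , refl , refl , ne₀ ← E₁∈ i with bool? (X u) | bool? (X w)
  ... | inj₁ a | inj₁ b = contradiction (trans (con-in {X = X} a) (sym (con-in {X = X} b))) ne
  ... | inj₁ a | inj₂ b = X , tightX , cross-tf X (trans (cong X (con-in {X = X} a)) Xs) (trans (cong X (con-out {X = X} b)) b)
  ... | inj₂ a | inj₁ b = X , tightX , cross-ft X (trans (cong X (con-out {X = X} a)) a) (trans (cong X (con-in {X = X} b)) Xs)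
  ... | inj₂ a | inj₂ b with Z , tZ , cr ← at j ne₀ with uncross Z tZ
  ...   | inj₁ t = X ∪ Z , t , trans (cong₂ (λ p q → nm p q q) (eq a) (eq b)) cr
    where eq : ∀ {v} → X v ≡ false → (X ∪ Z) (con X s v) ≡ Z v
          eq {v} f = trans (cong (X ∪ Z) (con-out {X = X} f)) (cong (_∨ Z v) f)
  ...   | inj₂ t = Z ∖ X , t , trans (cong₂ (λ p q → nm p q q) (eq a) (eq b)) cr
    where eq : ∀ {v} → X v ≡ false → (Z ∖ X) (con X s v) ≡ Z v
          eq {v} f = trans (cong (Z ∖ X) (con-out {X = X} f)) (trans (cong (λ x → Z v ∧ not x) f) (𝔹.∧-identityʳ (Z v)))

  private
    S₁con : ∀ v → not (S₁ (con X s v)) ≡ true → not (S v) ≡ true × X v ≡ false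
    S₁con v e with bool? (X v)
    ... | inj₁ t = ⊥-elim (true≢false e (cong not (trans (cong S₁ (con-in {X = X} t)) S₁s)))
    ... | inj₂ f = not-t (¬true λ Sv → true≢false e (cong not (trans (cong S₁ (con-out {X = X} f)) (S₁out Sv f)))) , f

  contract-bad : ∀ {e} → e ∈ₗ E → bad S e ≡ 1 → cross X e ≡ 1 → sumOf (bad S₁) E₁ < sumOf (bad S) E
  contract-bad {u , w} i b cr = ≤-trans (s≤s (≤-trans (nl-≤ (bad S₁) (mapE (con X s) E)) (≤-reflexive (sumOf-map (bad S₁) _ E))))
    (sumOf-< E (λ {e} _ → le e) i (subst₂ _<_ (sym (cong b2n zero')) (sym b) ≤-refl))
    where
    le : ∀ e → bad S₁ (con X s (proj₁ e) , con X s (proj₂ e)) ≤ bad S e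
    le (u , w) = b2n-mono λ t → let p , q = ∧-elim {not (S₁ (con X s u))} t in ∧-intro (proj₁ (S₁con u p)) (proj₁ (S₁con w q))
    zero' : not (S₁ (con X s u)) ∧ not (S₁ (con X s w)) ≡ false
    zero' = ¬true λ t → let p , q = ∧-elim {not (S₁ (con X s u))} t in
      contradiction (trans (sym cr) (cross-≡ X (trans (proj₂ (S₁con u p)) (sym (proj₂ (S₁con w q)))))) λ ()

record State (k : ℕ) (Inv : List (Edge n) → VSet n → Set) (S : VSet n) (E : List (Edge n)) : Set where
  constructor state
  field
    conn  : Conn k S E
    tight : AllTight k S E
    inv   : Inv E S

-- The choice of a side of a tight set and of a terminal to which it is contracted.
record Move {n} (k : ℕ) (Q : Fin n → Set) (Inv : List (Edge n) → VSet n → Set) (E : List (Edge n)) (S X : VSet n) : Set where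
  field
    {X'}   : VSet n
    {s}    : Fin n
    tight' : Tight k S E X'
    same   : ∀ e → cross X' e ≡ cross X e
    Ss     : S s ≡ true
    X's    : X' s ≡ true
    split' : ∀ v → X' v ≡ true → v ≢ s → Q v
    inv'   : Inv (T[ X' , s ] E) (keep X' s S)

-- Contracting tight sets until no edge joins two non-terminals.
torso : ∀ {k} {Q : Fin n → Set} {Inv : List (Edge n) → VSet n → Set} →
  (∀ E S X → State k Inv S E → Tight k S E X → Move k Q Inv E S X) →
  ∀ m E S → sumOf (bad S) E ≤ m → State k Inv S E →
  Σ[ E' ∈ List (Edge n) ] Σ[ S' ∈ VSet n ] Imm Q E E' × State k Inv S' E' × Indep S' E'
torso {n} mv m E S le st with splitAll ok? E
  where
  ok? : ∀ e → Dec (proj₁ e ≢ proj₂ e → (S (proj₁ e) ≡ true) ⊎ (S (proj₂ e) ≡ true))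
  ok? (u , w) with u F.≟ w | bool? (S u) | bool? (S w)
  ... | yes p | _ | _ = yes λ h → contradiction p h
  ... | no h | inj₁ a | _ = yes λ _ → inj₁ a
  ... | no h | inj₂ a | inj₁ b = yes λ _ → inj₂ b
  ... | no h | inj₂ a | inj₂ b = no λ f → [ (λ c → true≢false c a) , (λ c → true≢false c b) ]′ (f h)
... | inj₂ ok = E , S , idI , st , ok
... | inj₁ ((u , w) , i , h) = advance m le
  where
  ne : u ≢ w
  ne p = h λ q → contradiction p q
  Su : S u ≡ false
  Su = ¬true λ t → h λ _ → inj₁ t
  Sw : S w ≡ false
  Sw = ¬true λ t → h λ _ → inj₂ t
  bad1 : bad S (u , w) ≡ 1
  bad1 = cong₂ (λ a b → b2n (not a ∧ not b)) Su Sw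
  tX = State.tight st i ne
  module M = Move (mv E S (proj₁ tX) st (proj₁ (proj₂ tX)))
  advance : ∀ m → sumOf (bad S) E ≤ m → _
  advance zero    le = contradiction (≤-trans (≤-reflexive (sym bad1)) (≤-trans (sumOf-∈ (bad S) i) le)) 1+n≰n
  advance (suc m) le =
    let E' , S' , j , r = torso mv m (T[ M.X' , M.s ] E) (keep M.X' M.s S)
          (≤-pred (≤-trans (contract-bad (State.conn st) (State.tight st) M.tight' M.Ss M.X's i bad1 (trans (M.same (u , w)) (proj₂ (proj₂ tX)))) le))
          (state (contract-Conn (State.conn st) (State.tight st) M.tight' M.Ss M.X's) (contract-AllTight (State.conn st) (State.tight st) M.tight' M.Ss M.X's) M.inv')
    in E' , S' , (contract-Imm (State.conn st) (State.tight st) M.tight' M.Ss M.X's M.split' ⨾ j) , r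

sum-single : ∀ {A : Set} (p : A → Bool) (f : A → ℕ) {v xs} → (∀ {u} → p u ≡ true → u ≡ v) → p v ≡ true → Unique xs → v ∈ₗ xs →
  sumOf (λ u → b2n (p u) * f u) xs ≡ f v
sum-single p f {v} {_ ∷ xs} only pv (nv ∷ _) (here refl) rewrite pv = trans (cong (f v + 0 +_) (sumOf-0 xs λ {u} i → lem u i (bool? (p u)))) (trans (+-identityʳ _) (+-identityʳ _))
  where
  lem : ∀ u → u ∈ₗ xs → (p u ≡ true) ⊎ (p u ≡ false) → b2n (p u) * f u ≡ 0
  lem u i (inj₁ e) = contradiction (sym (only e)) (All.lookup nv i)
  lem u i (inj₂ e) rewrite e = refl
sum-single p f {v} {u ∷ xs} only pv (nu ∷ un) (there i) with bool? (p u)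
... | inj₁ e = contradiction (only e) (All.lookup nu i)
... | inj₂ e rewrite e = sum-single p f only pv un i

sum-at : (f : Fin n → ℕ) → ∀ v → sumOf (λ u → b2n (u == v) * f u) (allFin n) ≡ f v
sum-at {n} f v = sum-single (_== v) f (λ e → ==⇒≡ e) (==-refl v) (allFin⁺ n) (∈-allFin v)

keep-fix : ∀ {X S : VSet n} {s v} → keep X s S v ≡ true → S v ≡ true × con X s v ≡ v
keep-fix {X = X} {S} {s} {v} e with a , b ← ∧-elim {S v} e with bool? (X v)
... | inj₂ f = a , con-out {X = X} f
... | inj₁ t = a , trans (con-in {X = X} t) (sym (==⇒≡ (subst (λ z → not z ∨ (v == s) ≡ true) t b)))

d-T : ∀ (X : VSet n) s E Y → d (T[ X , s ] E) Y ≡ d E (Y ∘ con X s)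
d-T X s E Y = trans (d-nl (mapE (con X s) E) Y) (d-mapE _ E Y)

weight : (Fin n → ℕ) → VSet n → ℕ
weight w Y = sumOf (λ v → b2n (Y v) * w v) (allFin _)

push : (Fin n → Fin n) → (Fin n → ℕ) → Fin n → ℕ
push c w v = sumOf (λ u → b2n (c u == v) * w u) (allFin _)

weight-push : ∀ (c : Fin n → Fin n) w Y → weight (push c w) Y ≡ weight w (Y ∘ c)
weight-push {n} c w Y = begin
  sumOf (λ v → b2n (Y v) * push c w v) L                                  ≡⟨ sumOf-cong L (λ v → sym (sumOf-* (b2n (Y v)) _ L)) ⟩
  sumOf (λ v → sumOf (λ u → b2n (Y v) * (b2n (c u == v) * w u)) L) L      ≡⟨ sumOf-swap _ L L ⟩
  sumOf (λ u → sumOf (λ v → b2n (Y v) * (b2n (c u == v) * w u)) L) L      ≡⟨ sumOf-cong L (λ u → trans (sumOf-cong L (λ v → re (b2n (Y v)) (b2n (c u == v)) (w u)))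
      (sum-single (c u ==_) (λ v → b2n (Y v) * w u) (λ e → sym (==⇒≡ e)) (==-refl (c u)) (allFin⁺ n) (∈-allFin (c u)))) ⟩
  sumOf (λ u → b2n (Y (c u)) * w u) L ∎
  where
  open ≡-Reasoning
  L = allFin n
  re : ∀ a b c → a * (b * c) ≡ b * (a * c)
  re = solve-∀

b2n-≤ : ∀ {a b c} → (a ≡ true → c ≤ b) → b2n a * c ≤ b
b2n-≤ {false} h = z≤n
b2n-≤ {true} {c = c} h = ≤-trans (≤-reflexive (+-identityʳ c)) (h refl)

b2n-*-mono : ∀ {a b c} → (a ≡ true → b ≡ true) → b2n a * c ≤ b2n b * c
b2n-*-mono {false} h = z≤n
b2n-*-mono {true} {b} h rewrite h refl = ≤-refl

Star : ∀ {n} → ℕ → ℕ → VSet n → List (Edge n) → Set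
Star {n} M k S E = Σ[ E' ∈ List (Edge n) ] Σ[ S' ∈ VSet n ] Imm Any-v E E' × Conn k S' E' × Indep S' E' × M ≤ size S' × S' ⊆ S

threshold : ℕ → ℕ → ℕ
threshold M zero    = M * 1
threshold M (suc j) = M * suc (threshold M j)

module Dichotomy {n : ℕ} (k M : ℕ) where

  Outside : VSet n → Fin n → VSet n → Set
  Outside S a Y = Y a ≡ false × (∃[ s ] S s ≡ true × Y s ≡ false × s ≢ a)

  outside? : ∀ S a Y → Dec (Outside S a Y)
  outside? S a Y = (Y a 𝔹.≟ false) ×-dec FP.any? (λ s → (S s 𝔹.≟ true) ×-dec ((Y s 𝔹.≟ false) ×-dec ¬? (s F.≟ a)))

  module _ (S₀ : VSet n) (a : Fin n) (N : ℕ) where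
    -- w v counts the original terminals that have been contracted to v.
    record Inv (E : List (Edge n)) (S : VSet n) : Set where
      field
        w     : Fin n → ℕ
        total : weight w (λ _ → true) ≡ size S₀
        small : ∀ v → w v ≤ suc N
        supp  : ∀ v → S v ≡ false → w v ≡ 0
        light : ∀ Y → Tight k S E Y → Outside S a Y → weight w Y ≤ suc N
        Sa    : S a ≡ true
        ⊆S₀   : S ⊆ S₀

    contract-Inv : ∀ {E S X s} → Inv E S → S s ≡ true → X s ≡ true → (X a ≡ true → s ≡ a) → (∀ w → (∀ v → S v ≡ false → w v ≡ 0) → (∀ v → w v ≤ suc N) →
      (∀ Y → Tight k S E Y → Outside S a Y → weight w Y ≤ suc N) → weight w X ≤ suc N) → Inv (T[ X , s ] E) (keep X s S)
    contract-Inv {E} {S} {X} {s} I Ss Xs Xa wX = record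
      { w = push c I.w
      ; total = trans (weight-push c I.w (λ _ → true)) I.total
      ; small = small
      ; supp = supp
      ; light = λ Y ((sep-t , sep-f) , le) (Ya , (o , So , Yo , o≢a)) → ≤-trans (≤-reflexive (weight-push c I.w Y))
          (I.light (Y ∘ c) ((back sep-t , back sep-f) , ≤-trans (≤-reflexive (sym (d-T X s E Y))) le)
            (trans (cong Y (proj₂ (keep-fix {X = X} {S} Ka))) Ya , (o , proj₁ (keep-fix {X = X} {S} So) , trans (cong Y (proj₂ (keep-fix {X = X} {S} So))) Yo , o≢a)))
      ; Sa = Ka
      ; ⊆S₀ = λ v e → I.⊆S₀ v (proj₁ (keep-fix {X = X} {S} {s} e)) }
      where
      module I = Inv I
      c = con X s
      Ka : keep X s S a ≡ true
      Ka = ∧-intro I.Sa (lem (bool? (X a)))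
        where lem : (X a ≡ true) ⊎ (X a ≡ false) → not (X a) ∨ (a == s) ≡ true
              lem (inj₂ f) = ∨-introˡ (not-t f)
              lem (inj₁ t) = ∨-introʳ {not (X a)} (trans (cong (a ==_) (Xa t)) (==-refl a))
      back : ∀ {Y b} → (∃[ u ] keep X s S u ≡ true × Y u ≡ b) → ∃[ u ] S u ≡ true × Y (c u) ≡ b
      back {Y} (u , p , q) = u , proj₁ (keep-fix {X = X} {S} p) , trans (cong Y (proj₂ (keep-fix {X = X} {S} p))) q
      small : ∀ v → push c I.w v ≤ suc N
      small v with v F.≟ s
      ... | yes refl = ≤-trans (sumOf-≤ (allFin n) (λ {u} _ → b2n-*-mono {c u == v} {X u} λ e → inX u (==⇒≡ e))) (wX I.w I.supp I.small I.light)
        where inX : ∀ u → c u ≡ v → X u ≡ true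
              inX u e with bool? (X u)
              ... | inj₁ t = t
              ... | inj₂ f = trans (cong X (trans (sym (con-out {X = X} f)) e)) Xs
      ... | no h = ≤-trans (sumOf-≤ (allFin n) (λ {u} _ → b2n-*-mono {c u == v} {u == v} λ e → fix u (==⇒≡ e))) (≤-trans (≤-reflexive (sum-at I.w v)) (I.small v))
        where fix : ∀ u → c u ≡ v → (u == v) ≡ true
              fix u e with bool? (X u)
              ... | inj₁ t = contradiction (trans (sym e) (con-in {X = X} t)) h
              ... | inj₂ f = trans (cong (_== v) (trans (sym (con-out {X = X} f)) e)) (==-refl v)
      supp : ∀ v → keep X s S v ≡ false → push c I.w v ≡ 0
      supp v Kv = sumOf-0 (allFin n) λ {u} _ → n≤0⇒n≡0 (b2n-≤ {c u == v} λ e → ≤-reflexive (zero' u (==⇒≡ e)))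
        where
        zero' : ∀ u → c u ≡ v → I.w u ≡ 0
        zero' u e with bool? (X u)
        ... | inj₁ t with refl ← trans (sym e) (con-in {X = X} t) = ⊥-elim (true≢false (∧-intro Ss (∨-introʳ {not (X v)} (==-refl v))) Kv)
        ... | inj₂ f with refl ← trans (sym (con-out {X = X} {s} f)) e = I.supp u (¬true λ t → true≢false (∧-intro t (∨-introˡ (not-t f))) Kv)

    merge : ∀ E S X → State k Inv S E → Tight k S E X → Move k Any-v Inv E S X
    merge E S X (state c at I) tX = choose (bool? (X a))
      where
      module I = Inv I
      finish : ∀ Y → Y a ≡ false → Tight k S E Y → (∀ e → cross Y e ≡ cross X e) → Move k Any-v Inv E S X
      finish Y Ya tY sm with outside? S a Y
      ... | yes o with (s , Ss , Ys) , _ ← proj₁ tY = record { X' = Y ; s = s ; tight' = tY ; same = sm ; Ss = Ss ; X's = Ys ; split' = λ _ _ _ → tt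
          ; inv' = contract-Inv I Ss Ys (λ t → ⊥-elim (true≢false t Ya)) λ w _ _ li → li Y tY o }
      ... | no h = record { X' = ∁ Y ; s = a ; tight' = Sep-∁ (proj₁ tY) , ≤-trans (≤-reflexive (SLike.com (d-SLike E) Y)) (proj₂ tY)
          ; same = λ e → trans (SLike.com (nmSet-SLike (proj₁ e) (proj₂ e) (proj₂ e)) Y) (sm e)
          ; Ss = I.Sa ; X's = not-t Ya ; split' = λ _ _ _ → tt
          ; inv' = contract-Inv I I.Sa (not-t Ya) (λ _ → refl) λ w su sl _ → ≤-trans (sumOf-≤ (allFin n) λ {v} _ → le w su v) (≤-trans (≤-reflexive (sum-at w a)) (sl a)) }
        where
        le : ∀ w → (∀ v → S v ≡ false → w v ≡ 0) → ∀ v → b2n (not (Y v)) * w v ≤ b2n (v == a) * w v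
        le w su v with v F.≟ a | bool? (S v) | bool? (Y v)
        ... | yes refl | _ | _ = *-monoˡ-≤ (w v) (b2n≤1 (not (Y v)))
        ... | no q | inj₂ f | _ = ≤-trans (≤-reflexive (trans (cong (b2n (not (Y v)) *_) (su v f)) (*-zeroʳ (b2n (not (Y v)))))) z≤n
        ... | no q | inj₁ t | inj₁ y rewrite y = z≤n
        ... | no q | inj₁ t | inj₂ y = ⊥-elim (h (Ya , (v , t , y , q)))
      choose : (X a ≡ true) ⊎ (X a ≡ false) → Move k Any-v Inv E S X
      choose (inj₂ f) = finish X f tX λ _ → refl
      choose (inj₁ t) = finish (∁ X) (cong not t) (Sep-∁ (proj₁ tX) , ≤-trans (≤-reflexive (SLike.com (d-SLike E) X)) (proj₂ tX))
        λ (u , w) → SLike.com (nmSet-SLike u w w) X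

  dichotomy : ∀ E S a N → Conn k S E → AllTight k S E → S a ≡ true → M * suc N ≤ size S →
    Star M k S E ⊎ (Σ[ Y ∈ VSet n ] Tight k S E Y × Outside S a Y × N < size (Y ∩ S))
  dichotomy E S a N c at Sa le = decide found?
    where
    b2n-∧ : ∀ x y → b2n x * b2n y ≡ b2n (x ∧ y)
    b2n-∧ true y = +-identityʳ _
    b2n-∧ false y = refl
    P : VSet n → Set
    P Y = Tight k S E Y × Outside S a Y × N < size (Y ∩ S)
    found? : Dec (Σ (VSet n) P)
    found? = anyVSet (λ Y → (Sep? S Y ×-dec (d E Y ≤? k)) ×-dec (outside? S a Y ×-dec (N <? size (Y ∩ S))))
      λ e ((s , le) , ((Ya , o) , lt)) → (Sep-ext e s , ≤-trans (≤-reflexive (sym (d-ext E e))) le) ,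
        ((trans (sym (e a)) Ya , (let (v , p , q , r) = o in v , p , trans (sym (e v)) q , r)) , ≤-trans lt (≤-reflexive (sumOf-cong (allFin n) λ v → cong (λ z → b2n (z ∧ S v)) (e v))))
    initial : (¬ Σ (VSet n) P) → Inv S a N E S
    initial none = record
      { w = b2n ∘ S ; total = sumOf-cong (allFin n) (λ v → +-identityʳ _) ; small = λ v → ≤-trans (b2n≤1 (S v)) (s≤s z≤n) ; supp = λ v e → cong b2n e
      ; light = λ Y t o → ≤-trans (≤-reflexive (sumOf-cong (allFin n) λ v → b2n-∧ (Y v) (S v))) (≤-trans (≮⇒≥ λ lt → none (Y , t , o , lt)) (n≤1+n N))
      ; Sa = Sa ; ⊆S₀ = λ _ e → e }
    *-cancelʳ-≤' : ∀ {x y} → x * suc N ≤ y * suc N → x ≤ y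
    *-cancelʳ-≤' {x} {y} = *-cancelʳ-≤ x y (suc N)
      where open import Data.Nat.Properties using (*-cancelʳ-≤)
    decide : Dec (Σ (VSet n) P) → Star M k S E ⊎ Σ (VSet n) P
    decide (yes r) = inj₂ r
    decide (no none) with E' , S' , j , state c' at' I , ind ← torso (merge S a N) _ E S ≤-refl (state c at (initial none)) =
      inj₁ (E' , S' , j , c' , ind , *-cancelʳ-≤' (≤-trans le count) , Inv.⊆S₀ I)
      where
      count : size S ≤ size S' * suc N
      count = ≤-trans (≤-reflexive (trans (sym (Inv.total I)) (sumOf-cong (allFin n) λ v → +-identityʳ _)))
        (≤-trans (sumOf-≤ (allFin n) λ {v} _ → le' v) (≤-reflexive (trans (sumOf-* (suc N) (b2n ∘ S') (allFin n)) (*-comm (suc N) _))))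
        where
        le' : ∀ v → Inv.w I v ≤ suc N * b2n (S' v)
        le' v with bool? (S' v)
        ... | inj₁ t rewrite t = ≤-trans (Inv.small I v) (≤-reflexive (sym (*-identityʳ (suc N))))
        ... | inj₂ f rewrite Inv.supp I v f = z≤n

  data Chain (E : List (Edge n)) (S Y : VSet n) : ℕ → Set where
    end  : ∀ {b} → S b ≡ true → Y b ≡ true → Chain E S Y 0
    link : ∀ {s Y' j} → S s ≡ true → Y s ≡ true → Y' s ≡ false → Y' ⊆ Y → d E Y' ≤ k → Chain E S Y' j → Chain E S Y (suc j)

  record Chained (E : List (Edge n)) (S : VSet n) (a : Fin n) (j : ℕ) : Set where
    constructor chained
    field
      {Y}     : VSet n
      outside : Outside S a Y
      tightY  : d E Y ≤ k
      chain   : Chain E S Y j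

  star-or-chain : ∀ j E S a → Conn k S E → AllTight k S E → S a ≡ true → threshold M j ≤ size S → Star M k S E ⊎ Chained E S a j
  star-or-chain zero E S a c at Sa le with dichotomy E S a 0 c at Sa le
  ... | inj₁ st = inj₁ st
  ... | inj₂ (Y , (((b , Sb , Yb) , _) , le') , o , _) = inj₂ (chained o le' (end Sb Yb))
  star-or-chain (suc j) E S a c at Sa le with dichotomy E S a (threshold M j) c at Sa le
  ... | inj₁ st = inj₁ st
  ... | inj₂ (Y , tY , o@(Ya , _) , lt) = finish (star-or-chain j E₂ S₂ a (contract-Conn c at tX Sa (not-t Ya)) (contract-AllTight c at tX Sa (not-t Ya)) S₂a big)
    where
    X = ∁ Y
    tX : Tight k S E X
    tX = Sep-∁ (proj₁ tY) , ≤-trans (≤-reflexive (SLike.com (d-SLike E) Y)) (proj₂ tY)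
    E₂ = T[ X , a ] E
    S₂ = keep X a S
    cc = con X a
    S₂a : S₂ a ≡ true
    S₂a = ∧-intro Sa (∨-introʳ {not (not (Y a))} (==-refl a))
    big : threshold M j ≤ size S₂
    big = ≤-trans (<⇒≤ lt) (sumOf-≤ (allFin n) λ {v} _ → le-b (Y v) (S v) (v == a))
      where le-b : ∀ y s e → b2n (y ∧ s) ≤ b2n (s ∧ (not (not y) ∨ e))
            le-b true  true  _ = ≤-refl
            le-b true  false _ = z≤n
            le-b false _     _ = z≤n
    fix : ∀ {s} → S₂ s ≡ true → S s ≡ true × cc s ≡ s
    fix = keep-fix {X = X} {S} {a}
    back : ∀ {Z j} → Chain E₂ S₂ Z j → Chain E S (Z ∘ cc) j
    back {Z} (end b z) = end (proj₁ (fix b)) (trans (cong Z (proj₂ (fix b))) z)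
    back {Z} (link {Y' = Z'} s z z' sub le ch) = link (proj₁ (fix s)) (trans (cong Z (proj₂ (fix s))) z) (trans (cong Z' (proj₂ (fix s))) z') (λ v → sub (cc v))
      (≤-trans (≤-reflexive (sym (d-T X a E Z'))) le) (back ch)
    finish : Star M k S₂ E₂ ⊎ Chained E₂ S₂ a j → Star M k S E ⊎ Chained E S a (suc j)
    finish (inj₁ (E' , S' , i , c' , ind , m , sub)) = inj₁ (E' , S' , (contract-Imm c at tX Sa (not-t Ya) (λ _ _ _ → tt) ⨾ i) , c' , ind , m , λ v e → proj₁ (fix (sub v e)))
    finish (inj₂ (chained {Z} (Za , (s , Ss , Zs , s≢a)) le' ch)) = inj₂ (chained o (proj₂ tY)
      (link (proj₁ (fix Ss)) sY (trans (cong Z (proj₂ (fix Ss))) Zs) sub (≤-trans (≤-reflexive (sym (d-T X a E Z))) le') (back ch)))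
      where
      sY : Y s ≡ true
      sY with bool? (Y s)
      ... | inj₁ t = t
      ... | inj₂ f = contradiction (trans (sym (proj₂ (fix Ss))) (con-in {X = X} (not-t f))) s≢a
      sub : (Z ∘ cc) ⊆ Y
      sub v e with bool? (Y v)
      ... | inj₁ t = t
      ... | inj₂ f = ⊥-elim (true≢false e (trans (cong Z (con-in {X = X} (not-t f))) Za))

bit-sub : ∀ x y → b2n (x ∧ y) + b2n (x ∨ y) ≡ b2n x + b2n y
bit-sub true  true  = refl
bit-sub true  false = refl
bit-sub false y     = refl

bit-pos : ∀ x y → b2n (x ∧ not y) + b2n (y ∧ not x) + (b2n (x ∧ y) + b2n (x ∧ y)) ≡ b2n x + b2n y
bit-pos true  true  = refl
bit-pos true  false = refl
bit-pos false true  = refl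
bit-pos false false = refl

bit-thr : ∀ x y w → b2n (x ∧ y ∧ w) + b2n (x ∧ not (y ∨ w)) + b2n (y ∧ not (x ∨ w)) + b2n (w ∧ not (x ∨ y)) + (b2n (x ∧ y ∧ w) + b2n (x ∧ y ∧ w)) ≤ b2n x + b2n y + b2n w
bit-thr true  true  true  = ≤-refl
bit-thr true  true  false = z≤n
bit-thr true  false true  = z≤n
bit-thr true  false false = ≤-refl
bit-thr false true  true  = z≤n
bit-thr false true  false = ≤-refl
bit-thr false false true  = ≤-refl
bit-thr false false false = z≤n

-- The vertex to be split off has the list N of neighbours; f counts the edges not at that vertex.
module Splitting {n} (k : ℕ) (2≤k : 2 ≤ k) (S : VSet n) where

  cnt : List (Fin n) → VSet n → ℕ
  cnt N X = sumOf (b2n ∘ X) N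

  Cut : List (Fin n) → (VSet n → ℕ) → Set
  Cut N f = ∀ X → Sep S X → k ≤ cnt N X + f X

  Dang : List (Fin n) → (VSet n → ℕ) → Fin n → Fin n → Set
  Dang N f u w = Σ[ X ∈ VSet n ] Sep S X × X u ≡ true × X w ≡ true × cnt N X + f X ≤ suc k

  cnt-∈ : ∀ {X : VSet n} {v N} → v ∈ₗ N → X v ≡ true → 1 ≤ cnt N X
  cnt-∈ {X} i e = ≤-trans (≤-reflexive (sym (cong b2n e))) (sumOf-∈ (b2n ∘ X) i)

  cnt-all : ∀ {X : VSet n} N → (∀ {v} → v ∈ₗ N → X v ≡ true) → cnt N X ≡ length N
  cnt-all [] h = refl
  cnt-all (v ∷ N) h = cong₂ _+_ (cong b2n (h (here refl))) (cnt-all N (h ∘ there))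

  cnt-∁ : ∀ (X : VSet n) N → cnt N (∁ X) + cnt N X ≡ length N
  cnt-∁ X [] = refl
  cnt-∁ X (v ∷ N) = trans (swap₄ (b2n (not (X v))) (cnt N (∁ X)) (b2n (X v)) (cnt N X)) (cong₂ _+_ (one (X v)) (cnt-∁ X N))
    where one : ∀ b → b2n (not b) + b2n b ≡ 1
          one true  = refl
          one false = refl

  cnt-2 : ∀ {X : VSet n} {u v N} → u ∈ₗ N → v ∈ₗ N → u ≢ v → X u ≡ true → X v ≡ true → 2 ≤ cnt N X
  cnt-2 {X} i j ne a b with N₀ , p ← extract i with PP.∈-resp-↭ p j
  ... | here refl = contradiction refl ne
  ... | there j' = ≤-trans (+-mono-≤ (≤-reflexive (sym (cong b2n a))) (cnt-∈ {X} j' b)) (≤-reflexive (sym (sumOf-↭ (b2n ∘ X) p)))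

  module Contra (f : VSet n → ℕ) (sl : SLike f) (N : List (Fin n)) (cut : Cut N f) (N⊆S : ∀ {v} → v ∈ₗ N → S v ≡ true) where
    open SLike sl
    D = length N

    α G : VSet n → ℕ
    α = cnt N
    G X = α X + f X

    α-sub : ∀ X Y → α (X ∩ Y) + α (X ∪ Y) ≡ α X + α Y
    α-sub X Y = trans (sym (sumOf-+ _ _ N)) (trans (sumOf-cong N λ v → bit-sub (X v) (Y v)) (sumOf-+ _ _ N))

    α-pos : ∀ X Y → α (X ∖ Y) + α (Y ∖ X) + (α (X ∩ Y) + α (X ∩ Y)) ≡ α X + α Y
    α-pos X Y = trans (cong₂ _+_ (sym (sumOf-+ _ _ N)) (sym (sumOf-+ _ _ N))) (trans (sym (sumOf-+ _ _ N)) (trans (sumOf-cong N λ v → bit-pos (X v) (Y v)) (sumOf-+ _ _ N)))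

    α-thr : ∀ X Y W → α (X ∩ Y ∩ W) + α (X ∖ (Y ∪ W)) + α (Y ∖ (X ∪ W)) + α (W ∖ (X ∪ Y)) + (α (X ∩ Y ∩ W) + α (X ∩ Y ∩ W)) ≤ α X + α Y + α W
    α-thr X Y W = subst₂ _≤_
      (trans (sumOf-+ _ _ N) (cong₂ _+_ (trans (sumOf-+ _ _ N) (cong (_+ α (W ∖ (X ∪ Y))) (trans (sumOf-+ _ _ N) (cong (_+ α (Y ∖ (X ∪ W))) (sumOf-+ _ _ N))))) (sumOf-+ _ _ N)))
      (trans (sumOf-+ _ _ N) (cong (_+ _) (sumOf-+ _ _ N)))
      (sumOf-≤ N λ {v} _ → bit-thr (X v) (Y v) (W v))

    G-sub : ∀ X Y → G (X ∩ Y) + G (X ∪ Y) ≤ G X + G Y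
    G-sub X Y = subst₂ _≤_ (swap₄ (α (X ∩ Y)) (α (X ∪ Y)) _ _) (swap₄ (α X) (α Y) _ _) (+-mono-≤ (≤-reflexive (α-sub X Y)) (sub X Y))

    G-pos : ∀ X Y → G (X ∖ Y) + G (Y ∖ X) + (α (X ∩ Y) + α (X ∩ Y)) ≤ G X + G Y
    G-pos X Y = subst₂ _≤_ (re (α (X ∖ Y)) (α (Y ∖ X)) (α (X ∩ Y) + α (X ∩ Y)) _ _) (swap₄ (α X) (α Y) _ _) (+-mono-≤ (≤-reflexive (α-pos X Y)) (pos X Y))
      where re : ∀ a b c x y → (a + b + c) + (x + y) ≡ (a + x) + (b + y) + c
            re = solve-∀

    G-thr : ∀ X Y W → G (X ∩ Y ∩ W) + G (X ∖ (Y ∪ W)) + G (Y ∖ (X ∪ W)) + G (W ∖ (X ∪ Y)) + (α (X ∩ Y ∩ W) + α (X ∩ Y ∩ W)) ≤ G X + G Y + G W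
    G-thr X Y W = subst₂ _≤_ (re (α (X ∩ Y ∩ W)) (α (X ∖ (Y ∪ W))) (α (Y ∖ (X ∪ W))) (α (W ∖ (X ∪ Y))) (α (X ∩ Y ∩ W) + α (X ∩ Y ∩ W)) _ _ _ _)
        (re₃ (α X) (α Y) (α W) _ _ _) (+-mono-≤ (α-thr X Y W) (thr X Y W))
      where re : ∀ a b c e g x y z w → (a + b + c + e + g) + (x + y + z + w) ≡ (a + x) + (b + y) + (c + z) + (e + w) + g
            re = solve-∀
            re₃ : ∀ a b c x y z → (a + b + c) + (x + y + z) ≡ (a + x) + (b + y) + (c + z)
            re₃ = solve-∀

    cut' : ∀ X → Sep S X → k + (α X + α X) ≤ G X + D
    cut' X s = lin 0 (+-mono-≤ (cut (∁ X) (Sep-∁ s)) (≤-reflexive (trans (+-comm (α X) _) (cnt-∁ X N)))) (trans (cong (λ z → k + (α X + α X) + (α (∁ X) + z + D) + 0) (com X)) (re k (α X) (α (∁ X)) (f X) D))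
      where re : ∀ k a b f d → k + (a + a) + (b + f + d) + 0 ≡ (a + f) + d + (k + (a + b))
            re = solve-∀

    half : ∀ X → Sep S X → G X ≤ suc k → α X + α X ≤ suc D
    half X s le = +-cancelˡ-≤ k _ _ (≤-trans (cut' X s) (≤-trans (+-monoˡ-≤ D le) (≤-reflexive (sym (+-suc k D)))))

    no-cover : 2 ≤ D → ∀ X → Sep S X → G X ≤ suc k → (∀ {v} → v ∈ₗ N → X v ≡ true) → ⊥
    no-cover le X s g all = lin⊥ 0 (+-mono-≤ le (subst (λ z → z + z ≤ suc D) (cnt-all N all) (half X s g))) (re D)
      where re : ∀ d → 2 + (d + d) ≡ suc (d + suc d + 0)
            re = solve-∀

    module Base {h} (h∈ : h ∈ₗ N) (dang : ∀ {u w} → u ∈ₗ N → w ∈ₗ N → u ≢ w → Dang N f u w) (4≤D : 4 ≤ D) where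
      private
        Sh : S h ≡ true
        Sh = N⊆S h∈

      sepᵢ : ∀ {X : VSet n} {a b} → S a ≡ true → X a ≡ true → S b ≡ true → X b ≡ false → Sep S X
      sepᵢ p q r s = (_ , p , q) , (_ , r , s)

      three-private : ∀ {X Y W x y w} → Sep S X → X h ≡ true → G X ≤ suc k → Y h ≡ true → G Y ≤ suc k → W h ≡ true → G W ≤ suc k →
        x ∈ₗ N → (X ∖ (Y ∪ W)) x ≡ true → y ∈ₗ N → (Y ∖ (X ∪ W)) y ≡ true → w ∈ₗ N → (W ∖ (X ∪ Y)) w ≡ true → ⊥
      three-private {X} {Y} {W} sX Xh gX Yh gY Wh gW x∈ px y∈ py w∈ pw =
        lin⊥ 0 (+-mono-≤ (G-thr X Y W) (+-mono-≤ gX (+-mono-≤ gY (+-mono-≤ gW (+-mono-≤ (cut I sI) (+-mono-≤ (cut Aₓ sA) (+-mono-≤ (cut Bₓ sB) (+-mono-≤ (cut Cₓ sC) (+-mono-≤ αI (+-mono-≤ αI 2≤k))))))))))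
          (re (G I) (G Aₓ) (G Bₓ) (G Cₓ) (α I) (G X) (G Y) (G W) k)
        where
        I = X ∩ Y ∩ W
        Aₓ = X ∖ (Y ∪ W)
        Bₓ = Y ∖ (X ∪ W)
        Cₓ = W ∖ (X ∪ Y)
        Ih : I h ≡ true
        Ih = ∧-intro Xh (∧-intro Yh Wh)
        sI : Sep S I
        sI = (h , Sh , Ih) , (let o , p , q = proj₂ sX in o , p , cong (_∧ (Y o ∧ W o)) q)
        not-h : ∀ {X Y : VSet n} → Y h ≡ true → X h ∧ not (Y h) ≡ false
        not-h {X} e = trans (cong (λ z → X h ∧ not z) e) (𝔹.∧-zeroʳ (X h))
        sA : Sep S Aₓ
        sA = sepᵢ {Aₓ} (N⊆S x∈) px Sh (not-h {X} {Y ∪ W} (∨-introˡ Yh))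
        sB : Sep S Bₓ
        sB = sepᵢ {Bₓ} (N⊆S y∈) py Sh (not-h {Y} {X ∪ W} (∨-introˡ Xh))
        sC : Sep S Cₓ
        sC = sepᵢ {Cₓ} (N⊆S w∈) pw Sh (not-h {W} {X ∪ Y} (∨-introˡ Xh))
        αI : 1 ≤ α I
        αI = cnt-∈ {I} h∈ Ih
        re : ∀ gI gA gB gC a gX gY gW k → (gI + gA + gB + gC + (a + a)) + (gX + (gY + (gW + (k + (k + (k + (k + (1 + (1 + 2)))))))))
          ≡ suc ((gX + gY + gW) + (suc k + (suc k + (suc k + (gI + (gA + (gB + (gC + (a + (a + k))))))))) + 0)
        re = solve-∀

      uncrossed : ∀ {Aₓ W u₂} → Sep S Aₓ → Aₓ h ≡ false → G Aₓ ≤ k → Sep S W → G W ≤ suc k → u₂ ∈ₗ N → Aₓ u₂ ≡ true → W u₂ ≡ true →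
        Sep S (Aₓ ∪ W) × G (Aₓ ∪ W) ≤ suc k
      uncrossed {Aₓ} {W} {u₂} sA Ah gA sW gW u∈ Au Wu with FP.any? (λ o → (S o 𝔹.≟ true) ×-dec ((Aₓ o 𝔹.≟ false) ×-dec (W o 𝔹.≟ false)))
      ... | yes (o , So , Ao , Wo) = sepᵢ {Aₓ ∪ W} (N⊆S u∈) (∨-introˡ Au) So (∨-false Ao Wo) ,
        (+-cancelˡ-≤ k _ _ (≤-trans (+-monoˡ-≤ _ (cut (Aₓ ∩ W) (sepᵢ {Aₓ ∩ W} (N⊆S u∈) (∧-intro Au Wu) Sh (cong (_∧ W h) Ah)))) (≤-trans (G-sub Aₓ W) (+-mono-≤ gA gW))))
      ... | no none = ⊥-elim (lin⊥ 0 (+-mono-≤ (G-pos Aₓ W) (+-mono-≤ gA (+-mono-≤ gW (+-mono-≤ (cut (Aₓ ∖ W) s₁) (+-mono-≤ (cut (W ∖ Aₓ) s₂) (+-mono-≤ α1 α1))))))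
          (re (G (Aₓ ∖ W)) (G (W ∖ Aₓ)) (α (Aₓ ∩ W)) (G Aₓ) (G W) k))
        where
        covered : ∀ {o} → S o ≡ true → W o ≡ false → Aₓ o ≡ true
        covered {o} So Wo with bool? (Aₓ o)
        ... | inj₁ t = t
        ... | inj₂ f = ⊥-elim (none (o , So , f , Wo))
        Wh : W h ≡ true
        Wh with bool? (W h)
        ... | inj₁ t = t
        ... | inj₂ f = ⊥-elim (none (h , Sh , Ah , f))
        s₁ : Sep S (Aₓ ∖ W)
        s₁ = (let o , p , q = proj₂ sW in o , p , ∧-intro (covered p q) (not-t q)) , (h , Sh , cong (_∧ not (W h)) Ah)
        s₂ : Sep S (W ∖ Aₓ)
        s₂ = (h , Sh , ∧-intro Wh (not-t Ah)) , (u₂ , N⊆S u∈ , trans (cong (λ z → W u₂ ∧ not z) Au) (𝔹.∧-zeroʳ (W u₂)))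
        α1 : 1 ≤ α (Aₓ ∩ W)
        α1 = cnt-∈ {Aₓ ∩ W} u∈ (∧-intro Au Wu)
        re : ∀ x y a gA gW k → (x + y + (a + a)) + (gA + (gW + (k + (k + (1 + 1))))) ≡ suc ((gA + gW) + (k + (suc k + (x + (y + (a + a))))) + 0)
        re = solve-∀

      private
        cnt-find : ∀ {X : VSet n} → 1 ≤ α X → Σ[ v ∈ Fin n ] v ∈ₗ N × X v ≡ true
        cnt-find {X} le with findᵇ X N
        ... | inj₁ r = r
        ... | inj₂ none = contradiction le (<⇒≱ (s≤s (≤-reflexive (sumOf-0 N λ i → cong b2n (none i)))))

      two-cover : ∀ {X Y} → Sep S X → X h ≡ true → G X ≤ suc k → Sep S Y → Y h ≡ true → G Y ≤ suc k → (∀ {v} → v ∈ₗ N → (X ∪ Y) v ≡ true) → ⊥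
      two-cover {X} {Y} sX Xh gX sY Yh gY cov with FP.any? (λ o → (S o 𝔹.≟ true) ×-dec ((X o 𝔹.≟ false) ×-dec (Y o 𝔹.≟ false)))
      ... | yes (o , So , Xo , Yo) = lin⊥ 1 (+-mono-≤ (G-sub X Y) (+-mono-≤ gX (+-mono-≤ gY (+-mono-≤ (cut (X ∩ Y) (sepᵢ {X ∩ Y} Sh (∧-intro Xh Yh) So (cong (_∧ Y o) Xo)))
            (+-mono-≤ (subst (λ z → k + (z + z) ≤ G (X ∪ Y) + D) (cnt-all N cov) (cut' (X ∪ Y) (sepᵢ {X ∪ Y} Sh (∨-introˡ Xh) So (∨-false Xo Yo)))) 4≤D)))))
            (re (G (X ∩ Y)) (G (X ∪ Y)) (G X) (G Y) D k)
        where re : ∀ x y gX gY d k → (x + y) + (gX + (gY + (k + (k + (d + d) + 4)))) ≡ suc ((gX + gY) + (suc k + (suc k + (x + (y + d + d)))) + 1)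
              re = solve-∀
      ... | no none = final (cnt-find {Aₓ} α≥Aₓ) (cnt-find {Bₓ} α≥Bₓ)
        where
        Aₓ = X ∖ Y
        Bₓ = Y ∖ X
        M = X ∩ Y
        hX = half X sX gX
        hY = half Y sY gY
        αM≥ : 1 ≤ α M
        αM≥ = cnt-∈ {M} h∈ (∧-intro Xh Yh)
        sumXY : α M + D ≡ α X + α Y
        sumXY = trans (cong (α M +_) (sym (cnt-all N cov))) (α-sub X Y)
        αM≤ : α M ≤ 1
        αM≤ with α M ≤? 1
        ... | yes p = p
        ... | no p = ⊥-elim (lin⊥ 1 (+-mono-≤ hX (+-mono-≤ hY (+-mono-≤ (≤-reflexive sumXY) (+-mono-≤ (≤-reflexive sumXY) (+-mono-≤ (≰⇒> p) (≰⇒> p)))))) (re (α X) (α Y) (α M) D))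
          where re : ∀ x y m d → (x + x) + ((y + y) + ((m + d) + ((m + d) + (2 + 2)))) ≡ suc (suc d + (suc d + ((x + y) + ((x + y) + (m + m)))) + 1)
                re = solve-∀
        αM : α M ≡ 1
        αM = ≤-antisym αM≤ αM≥
        sXY : suc D ≡ α X + α Y
        sXY = trans (cong (_+ D) (sym αM)) sumXY
        αX : α X + α X ≡ suc D
        αX = ≤-antisym hX (lin 0 (+-mono-≤ hY (+-mono-≤ (≤-reflexive sXY) (≤-reflexive sXY))) (re (α X) (α Y) D))
          where re : ∀ x y d → suc d + (suc d + ((x + y) + (x + y))) + 0 ≡ (x + x) + ((y + y) + (suc d + suc d))
                re = solve-∀
        sumAB : α Aₓ + α Bₓ + 2 ≡ suc D
        sumAB = trans (cong (λ z → α Aₓ + α Bₓ + (z + z)) (sym αM)) (trans (α-pos X Y) (sym sXY))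
        sA : Sep S Aₓ
        sA = (let o , p , q = proj₂ sY in o , p , ∧-intro (cov' p q) (not-t q)) , (h , Sh , trans (cong (λ z → X h ∧ not z) Yh) (𝔹.∧-zeroʳ (X h)))
          where cov' : ∀ {o} → S o ≡ true → Y o ≡ false → X o ≡ true
                cov' {o} p q with bool? (X o)
                ... | inj₁ t = t
                ... | inj₂ f = ⊥-elim (none (o , p , f , q))
        sB : Sep S Bₓ
        sB = (let o , p , q = proj₂ sX in o , p , ∧-intro (cov' p q) (not-t q)) , (h , Sh , trans (cong (λ z → Y h ∧ not z) Xh) (𝔹.∧-zeroʳ (Y h)))
          where cov' : ∀ {o} → S o ≡ true → X o ≡ false → Y o ≡ true
                cov' {o} p q with bool? (Y o)
                ... | inj₁ t = t
                ... | inj₂ f = ⊥-elim (none (o , p , q , f))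
        Ah : Aₓ h ≡ false
        Ah = proj₂ (proj₂ (proj₂ sA))
        Bh : Bₓ h ≡ false
        Bh = proj₂ (proj₂ (proj₂ sB))
        GAB : G Aₓ + G Bₓ ≤ k + k
        GAB = lin 0 (+-mono-≤ (G-pos X Y) (+-mono-≤ gX (+-mono-≤ gY (+-mono-≤ αM≥ αM≥)))) (re (G Aₓ) (G Bₓ) (α M) (G X) (G Y) k)
          where re : ∀ a b m x y k → (a + b) + ((x + y) + (suc k + (suc k + (m + m)))) + 0 ≡ (k + k) + ((a + b + (m + m)) + (x + (y + (1 + 1))))
                re = solve-∀
        gA : G Aₓ ≤ k
        gA = +-cancelʳ-≤ k _ _ (≤-trans (+-monoʳ-≤ (G Aₓ) (cut Bₓ sB)) GAB)
        gB : G Bₓ ≤ k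
        gB = +-cancelˡ-≤ k _ _ (≤-trans (+-monoˡ-≤ (G Bₓ) (cut Aₓ sA)) GAB)
        αA' : α Aₓ + α M ≡ α X
        αA' = trans (sym (sumOf-+ _ _ N)) (sumOf-cong N λ v → bit (X v) (Y v))
          where bit : ∀ x y → b2n (x ∧ not y) + b2n (x ∧ y) ≡ b2n x
                bit true true = refl
                bit true false = refl
                bit false _ = refl
        α≥Aₓ : 1 ≤ α Aₓ
        α≥Aₓ with 1 ≤? α Aₓ
        ... | yes p = p
        ... | no p = ⊥-elim (lin⊥ 2 (+-mono-≤ (≤-reflexive (sym αX)) (+-mono-≤ (≤-reflexive (sym αA')) (+-mono-≤ (≤-reflexive (sym αA')) (+-mono-≤ (≰⇒> p) (+-mono-≤ (≰⇒> p) (+-mono-≤ αM≤ (+-mono-≤ αM≤ 4≤D)))))))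
            (re (α X) (α Aₓ) (α M) D))
          where re : ∀ x a m d → suc d + (x + (x + (suc a + (suc a + (m + (m + 4)))))) ≡ suc ((x + x) + ((a + m) + ((a + m) + (1 + (1 + (1 + (1 + d)))))) + 2)
                re = solve-∀
        α≥Bₓ : 1 ≤ α Bₓ
        α≥Bₓ with 1 ≤? α Bₓ
        ... | yes p = p
        ... | no p = ⊥-elim (lin⊥ 2 (+-mono-≤ (≤-reflexive (sym sumAB)) (+-mono-≤ (≤-reflexive (sym sumAB)) (+-mono-≤ (≤-reflexive αX) (+-mono-≤ (≤-reflexive αA') (+-mono-≤ (≤-reflexive αA') (+-mono-≤ (≰⇒> p) (+-mono-≤ (≰⇒> p) (+-mono-≤ αM≥ (+-mono-≤ αM≥ 4≤D)))))))))
            (re (α X) (α Aₓ) (α Bₓ) (α M) D))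
          where re : ∀ x a b m d → suc d + (suc d + ((x + x) + ((a + m) + ((a + m) + (suc b + (suc b + (1 + (1 + 4)))))))) ≡ suc ((a + b + 2) + ((a + b + 2) + (suc d + (x + (x + (1 + (1 + (m + (m + d)))))))) + 2)
                re = solve-∀
        final : (Σ[ v ∈ Fin n ] v ∈ₗ N × Aₓ v ≡ true) → (Σ[ v ∈ Fin n ] v ∈ₗ N × Bₓ v ≡ true) → ⊥
        final (u₂ , u₂∈ , Au) (u₃ , u₃∈ , Bu) = withW (dang u₂∈ u₃∈ u₂≢u₃)
          where
          u₂≢u₃ : u₂ ≢ u₃
          u₂≢u₃ refl = true≢false (proj₁ (∧-elim {Y u₂} Bu)) (not-f (proj₂ (∧-elim {X u₂} Au)))
          withW : Dang N f u₂ u₃ → ⊥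
          withW (W , sW , Wu₂ , Wu₃ , gW) = odd (≤-antisym D≤4 4≤D)
            where
            W₁ = Aₓ ∪ W
            W₂ = Bₓ ∪ W
            Z  = W₁ ∪ W₂
            s₁ = uncrossed sA Ah gA sW gW u₂∈ Au Wu₂
            s₂ = uncrossed sB Bh gB sW gW u₃∈ Bu Wu₃
            two : 2 ≤ α (W₁ ∩ W₂)
            two = cnt-2 {W₁ ∩ W₂} u₂∈ u₃∈ u₂≢u₃ (∧-intro (∨-introˡ Au) (∨-introʳ {Bₓ u₂} Wu₂)) (∧-intro (∨-introʳ {Aₓ u₃} Wu₃) (∨-introˡ Bu))
            αZ< : D ≤ α Z → ⊥
            αZ< le = lin⊥ 1 (+-mono-≤ (half W₁ (proj₁ s₁) (proj₂ s₁)) (+-mono-≤ (half W₂ (proj₁ s₂) (proj₂ s₂)) (+-mono-≤ (≤-reflexive (α-sub W₁ W₂)) (+-mono-≤ (≤-reflexive (α-sub W₁ W₂))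
                (+-mono-≤ two (+-mono-≤ two (+-mono-≤ le le))))))) (re (α W₁) (α W₂) (α (W₁ ∩ W₂)) (α Z) D)
              where re : ∀ x y m z d → (x + x) + ((y + y) + ((m + z) + ((m + z) + (2 + (2 + (d + d)))))) ≡ suc ((suc d + (suc d + ((x + y) + ((x + y) + (m + (m + (z + z))))))) + 1)
                    re = solve-∀
            part : ∀ {v} → v ∈ₗ N → (v ≡ h) ⊎ (Z v ≡ true)
            part {v} i with bool? (X v) | bool? (Y v)
            ... | inj₁ x | inj₂ y = inj₂ (∨-introˡ (∨-introˡ (∧-intro x (not-t y))))
            ... | inj₂ x | inj₁ y = inj₂ (∨-introʳ {W₁ v} (∨-introˡ (∧-intro y (not-t x))))
            ... | inj₂ x | inj₂ y = ⊥-elim (true≢false (cov i) (∨-false x y))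
            ... | inj₁ x | inj₁ y with v F.≟ h
            ...   | yes e = inj₁ e
            ...   | no ne = contradiction (cnt-2 {M} i h∈ ne (∧-intro x y) (∧-intro Xh Yh)) (<⇒≱ (s≤s αM≤))
            Zh : Z h ≡ false
            Zh = ¬true λ t → αZ< (≤-reflexive (sym (cnt-all N λ i → [ (λ { refl → t }) , id ]′ (part i))))
            sZ : Sep S Z
            sZ = sepᵢ {Z} (N⊆S u₂∈) (∨-introˡ (∨-introˡ Au)) Sh Zh
            s₁₂ : Sep S (W₁ ∩ W₂)
            s₁₂ = sepᵢ {W₁ ∩ W₂} (N⊆S u₂∈) (∧-intro (∨-introˡ Au) (∨-introʳ {Bₓ u₂} Wu₂)) Sh (cong (_∧ W₂ h) (¬true λ t → true≢false (∨-introˡ t) Zh))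
            αZ≥ : D ≤ α Z + 1
            αZ≥ = ≤-trans (≤-reflexive (sym (trans (sumOf-const 1 N) (*-identityʳ D)))) (≤-trans (sumOf-≤ N λ {v} i → one i (part i)) (≤-reflexive (trans (sumOf-+ _ _ N) (cong (α Z +_) αM))))
              where one : ∀ {v} → v ∈ₗ N → (v ≡ h) ⊎ (Z v ≡ true) → 1 ≤ b2n (Z v) + b2n (M v)
                    one {v} i (inj₁ refl) = ≤-trans (≤-reflexive (sym (cong b2n (∧-intro Xh Yh)))) (m≤n+m _ _)
                    one {v} i (inj₂ t) = ≤-trans (≤-reflexive (sym (cong b2n t))) (m≤m+n _ _)
            D≤4 : D ≤ 4
            D≤4 = lin 0 (+-mono-≤ (G-sub W₁ W₂) (+-mono-≤ (proj₂ s₁) (+-mono-≤ (proj₂ s₂) (+-mono-≤ (cut (W₁ ∩ W₂) s₁₂) (+-mono-≤ (cut' Z sZ) (+-mono-≤ αZ≥ αZ≥))))))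
                (re (G (W₁ ∩ W₂)) (G Z) (G W₁) (G W₂) (α Z) D k)
              where re : ∀ i z x y a d k → d + ((x + y) + (suc k + (suc k + (i + (z + d + ((a + 1) + (a + 1))))))) + 0 ≡ 4 + ((i + z) + (x + (y + (k + (k + (a + a) + (d + d))))))
                    re = solve-∀
            odd : D ≡ 4 → ⊥
            odd e = odd5 (α X) (trans αX (cong suc e))
              where odd5 : ∀ a → a + a ≡ 5 → ⊥
                    odd5 0 ()
                    odd5 1 ()
                    odd5 2 ()
                    odd5 (suc (suc (suc a))) e = contradiction (≤-trans (+-mono-≤ {3} {suc (suc (suc a))} (s≤s (s≤s (s≤s z≤n))) (s≤s (s≤s (s≤s z≤n)))) (≤-reflexive e)) 1+n≰n

      -- Two dangerous sets through h, covering as many neighbours as possible.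
      grow : ∀ m X Y → Sep S X → X h ≡ true → G X ≤ suc k → Sep S Y → Y h ≡ true → G Y ≤ suc k → D ≤ m + α (X ∪ Y) → ⊥
      grow m X Y sX Xh gX sY Yh gY le with findᵇ (∁ (X ∪ Y)) N
      ... | inj₂ none = two-cover sX Xh gX sY Yh gY λ {v} i → unnot (none i)
      ... | inj₁ (z , z∈ , nz) with dang h∈ z∈ (λ { refl → true≢false (∨-introˡ Xh) (not-f nz) })
      ...   | W , sW , Wh , Wz , gW with findᵇ (Y ∖ (X ∪ W)) N | findᵇ (X ∖ (Y ∪ W)) N
      ...     | inj₁ (y , y∈ , py) | inj₁ (x , x∈ , px) = three-private sX Xh gX Yh gY Wh gW x∈ px y∈ py z∈ (∧-intro Wz nz)
      ...     | inj₂ none | _ = again m le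
        where
        bit : ∀ x y w → y ∧ not (x ∨ w) ≡ false → x ∨ y ≡ true → x ∨ w ≡ true
        bit true  _     _ _ _ = refl
        bit false true  true  _ _ = refl
        less : α (X ∪ Y) < α (X ∪ W)
        less = sumOf-< N (λ {v} i → b2n-mono (bit (X v) (Y v) (W v) (none i))) z∈ (subst₂ _<_ (sym (cong b2n (not-f nz))) (sym (cong b2n (∨-introʳ {X z} Wz))) ≤-refl)
        again : ∀ m → D ≤ m + α (X ∪ Y) → ⊥
        again zero le = contradiction (≤-trans less (≤-trans (≤-trans (m≤n+m _ _) (≤-reflexive (cnt-∁ (X ∪ W) N))) le)) 1+n≰n
        again (suc m) le = grow m X W sX Xh gX sW Wh gW (≤-trans le (≤-trans (≤-reflexive (sym (+-suc m _))) (+-monoʳ-≤ m less)))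
      ...     | inj₁ _ | inj₂ none = again m le
        where
        bit : ∀ x y w → x ∧ not (y ∨ w) ≡ false → x ∨ y ≡ true → w ∨ y ≡ true
        bit _     y     true  _ _ = refl
        bit true  true  false _ _ = refl
        bit false true  false _ _ = refl
        less : α (X ∪ Y) < α (W ∪ Y)
        less = sumOf-< N (λ {v} i → b2n-mono (bit (X v) (Y v) (W v) (none i))) z∈ (subst₂ _<_ (sym (cong b2n (not-f nz))) (sym (cong b2n (∨-introˡ Wz))) ≤-refl)
        again : ∀ m → D ≤ m + α (X ∪ Y) → ⊥
        again zero le = contradiction (≤-trans less (≤-trans (≤-trans (m≤n+m _ _) (≤-reflexive (cnt-∁ (W ∪ Y) N))) le)) 1+n≰n
        again (suc m) le = grow m W Y sW Wh gW sY Yh gY (≤-trans le (≤-trans (≤-reflexive (sym (+-suc m _))) (+-monoʳ-≤ m less)))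

  star : Fin n → List (Fin n) → List (Edge n)
  star v = map (v ,_)

  dang? : ∀ N f → SLike f → ∀ u w → Dec (Dang N f u w)
  dang? N f sl u w = anyVSet (λ X → Sep? S X ×-dec ((X u 𝔹.≟ true) ×-dec ((X w 𝔹.≟ true) ×-dec (cnt N X + f X ≤? suc k))))
    λ e (a , b , c , g) → Sep-ext e a , trans (sym (e u)) b , trans (sym (e w)) c , ≤-trans (≤-reflexive (sym (cong₂ _+_ (sumOf-cong N (cong b2n ∘ e)) (SLike.ext sl e)))) g

  module SplitVertex (v : Fin n) (g : VSet n → ℕ) (sg' : SLike g) where

    rest : List (Edge n) → VSet n → ℕ
    rest R X = g X + d R X

    Shape : List (Fin n) → Set
    Shape N = (N ≡ []) ⊎ (Σ[ a ∈ Fin n ] Σ[ b ∈ Fin n ] Σ[ c ∈ Fin n ] N ≡ a ∷ b ∷ c ∷ [] × a ≢ b × a ≢ c × b ≢ c)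

    _⊑_ : List (Fin n) → VSet n → Set
    N ⊑ X = ∀ {u} → u ∈ₗ N → X u ≡ true

    record Result (N : List (Fin n)) (R : List (Edge n)) : Set where
      field
        {N'}  : List (Fin n)
        {R'}  : List (Edge n)
        imm   : Imm (_≡ v) (star v N ++ R) (star v N' ++ R')
        cut   : Cut N' (rest R')
        shape : Shape N'
        N'⊑S  : N' ⊑ S
        new   : ∀ {u w} → (u , w) ∈ₗ R' → (u , w) ∈ₗ R ⊎ (S u ≡ true × S w ≡ true)

    split-Cut : ∀ {u w N N' R} → Cut N (rest R) → N ↭ u ∷ w ∷ N' → ¬ Dang N (rest R) u w → Cut N' (rest ((u , w) ∷ R))
    split-Cut {u} {w} {N} {N'} {R} cut p nd X s = go (bool? (X u)) (bool? (X w))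
      where
      old : k ≤ (b2n (X u) + (b2n (X w) + cnt N' X)) + (g X + d R X)
      old = ≤-trans (cut X s) (≤-reflexive (cong (_+ (g X + d R X)) (sumOf-↭ (b2n ∘ X) p)))
      re : ∀ c y x z → c + (y + (x + z)) ≡ x + (c + (y + z))
      re = solve-∀
      go : (X u ≡ true) ⊎ (X u ≡ false) → (X w ≡ true) ⊎ (X w ≡ false) → k ≤ cnt N' X + (g X + (cross X (u , w) + d R X))
      go (inj₁ a) (inj₁ b) with cnt N X + rest R X ≤? suc k
      ... | yes le = contradiction (X , s , a , b , le) nd
      ... | no gt = subst (λ z → k ≤ cnt N' X + (g X + (z + d R X))) (sym (cross-≡ X (trans a (sym b))))
          (≤-pred (≤-pred (subst₂ (λ x y → 2 + k ≤ (x + (y + cnt N' X)) + (g X + d R X)) (cong b2n a) (cong b2n b)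
            (≤-trans (≰⇒> gt) (≤-reflexive (cong (_+ (g X + d R X)) (sumOf-↭ (b2n ∘ X) p)))))))
      go (inj₁ a) (inj₂ b) = subst (k ≤_) (sym (trans (cong (λ z → cnt N' X + (g X + (z + d R X))) (cross-tf X a b)) (re (cnt N' X) (g X) 1 (d R X))))
          (subst₂ (λ x y → k ≤ (x + (y + cnt N' X)) + (g X + d R X)) (cong b2n a) (cong b2n b) old)
      go (inj₂ a) (inj₁ b) = subst (k ≤_) (sym (trans (cong (λ z → cnt N' X + (g X + (z + d R X))) (cross-ft X a b)) (re (cnt N' X) (g X) 1 (d R X))))
          (subst₂ (λ x y → k ≤ (x + (y + cnt N' X)) + (g X + d R X)) (cong b2n a) (cong b2n b) old)
      go (inj₂ a) (inj₂ b) = subst (λ z → k ≤ cnt N' X + (g X + (z + d R X))) (sym (cross-≡ X (trans a (sym b))))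
          (subst₂ (λ x y → k ≤ (x + (y + cnt N' X)) + (g X + d R X)) (cong b2n a) (cong b2n b) old)

    split-Imm : ∀ {u w N N'} R → N ↭ u ∷ w ∷ N' → Imm (_≡ v) (star v N ++ R) (star v N' ++ (u , w) ∷ R)
    split-Imm {u} {w} {N} {N'} R p = perm (PP.++⁺ʳ R (PP.map⁺ (v ,_) p)) ⨾ flip ⨾ split refl ⨾ perm (↭-sym (PP.shift (u , w) (star v N') R))

    reduce : ∀ m N R → length N ≤ m → Cut N (rest R) → N ⊑ S → Result N R

    splitting : ∀ m {u w} N N' R → length N ≤ suc m → Cut N (rest R) → N ⊑ S → N ↭ u ∷ w ∷ N' → ¬ Dang N (rest R) u w → Result N R
    splitting m {u} {w} N N' R le cut sub p nd = record
      { imm = split-Imm R p ⨾ imm ; cut = cut' ; shape = shape ; N'⊑S = N'⊑S ; new = λ i → old (new i) }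
      where
      open Result (reduce m N' ((u , w) ∷ R) (≤-trans (n≤1+n _) (≤-pred (≤-trans (≤-reflexive (sym (PP.↭-length p))) le))) (split-Cut {u} {w} {N} {N'} {R} cut p nd)
        (λ i → sub (PP.∈-resp-↭ (↭-sym p) (there (there i))))) renaming (cut to cut')
      old : ∀ {x y} → (x , y) ∈ₗ ((u , w) ∷ R) ⊎ (S x ≡ true × S y ≡ true) → (x , y) ∈ₗ R ⊎ (S x ≡ true × S y ≡ true)
      old (inj₁ (here refl)) = inj₂ (sub (PP.∈-resp-↭ (↭-sym p) (here refl)) , sub (PP.∈-resp-↭ (↭-sym p) (there (here refl))))
      old (inj₁ (there i))   = inj₁ i
      old (inj₂ h)           = inj₂ h

    done : ∀ N R → Cut N (rest R) → N ⊑ S → Shape N → Result N R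
    done N R cut sub sh = record { imm = idI ; cut = cut ; shape = sh ; N'⊑S = sub ; new = inj₁ }

    reduce m [] R le cut sub = done [] R cut sub (inj₁ refl)
    reduce m (a ∷ []) R le cut sub = record
      { imm = del ; cut = cut₀ ; shape = inj₁ refl ; N'⊑S = λ () ; new = inj₁ }
      where
      cut₀ : Cut [] (rest R)
      cut₀ X s with bool? (X a)
      ... | inj₂ f = subst (λ z → k ≤ (b2n z + 0) + rest R X) f (cut X s)
      ... | inj₁ t = subst₂ (λ z y → k ≤ (b2n z + 0) + y) (cong not t) (SLike.com (slike-+ sg' (d-SLike R)) X) (cut (∁ X) (Sep-∁ s))
    reduce zero (a ∷ b ∷ T) R () cut sub
    reduce (suc m) N@(a ∷ b ∷ T) R le cut sub with splitAll (dang? N (rest R) (slike-+ sg' (d-SLike R)) a) (b ∷ T)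
    ... | inj₁ (w , i , nd) with N' , p ← extract i = splitting m N N' R le cut sub (P.prep a p) nd
    ... | inj₂ da = byLength T refl
      where
      sl = slike-+ sg' (d-SLike R)
      module K = Contra (rest R) sl N cut sub
      clash : ∀ {w} → Dang N (rest R) a w → (∀ X → X a ≡ true → X w ≡ true → ∀ {v} → v ∈ₗ N → X v ≡ true) → ⊥
      clash {w} (X , s , p , q , le) cov = K.no-cover (s≤s (s≤s z≤n)) X s le (cov X p q)
      byLength : ∀ T' → T ≡ T' → Result N R
      byLength [] refl = ⊥-elim (clash (da (here refl)) λ { X p q (here refl) → p ; X p q (there (here refl)) → q })
      byLength (c ∷ []) refl with a F.≟ b | a F.≟ c | b F.≟ c
      ... | yes refl | _ | _ = ⊥-elim (clash (da (there (here refl))) λ { X p q (here refl) → p ; X p q (there (here refl)) → p ; X p q (there (there (here refl))) → q })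
      ... | no _ | yes refl | _ = ⊥-elim (clash (da (here refl)) λ { X p q (here refl) → p ; X p q (there (here refl)) → q ; X p q (there (there (here refl))) → p })
      ... | no _ | no _ | yes refl = ⊥-elim (clash (da (here refl)) λ { X p q (here refl) → p ; X p q (there (here refl)) → q ; X p q (there (there (here refl))) → q })
      ... | no x | no y | no z = done N R cut sub (inj₂ (a , b , c , refl , x , y , z))
      byLength (c ∷ e ∷ T') refl with splitAll ok? (pairs N)
        where
        pairs : List (Fin n) → List (Fin n × Fin n)
        pairs L = cartesianProduct L L
        ok? : ∀ p → Dec (proj₁ p ≢ proj₂ p → Dang N (rest R) (proj₁ p) (proj₂ p))
        ok? (u , w) with u F.≟ w | dang? N (rest R) sl u w
        ... | yes q | _ = yes λ h → contradiction q h
        ... | no q | yes r = yes λ _ → r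
        ... | no q | no r = no λ h → r (h q)
      ... | inj₁ ((u , w) , i , nd) with iu , iw ← ∈-cartesianProduct⁻ N N i with N₁ , p ← extract iu = second (PP.∈-resp-↭ p iw)
        where
        second : w ∈ₗ u ∷ N₁ → Result N R
        second (here refl) = ⊥-elim (nd λ h → contradiction refl h)
        second (there j) with N₂ , q ← extract j = splitting m N N₂ R le cut sub (↭-trans p (P.prep u q)) λ r → nd λ _ → r
      ... | inj₂ ok with X , s , Xa , Xb , gX ← da (here refl) =
        ⊥-elim (K.Base.grow (here refl) (λ iu iw → ok (∈-cartesianProduct⁺ iu iw)) (s≤s (s≤s (s≤s (s≤s z≤n)))) (length N) X X s Xa gX s Xa gX (m≤m+n _ _))

-- Edges between terminals, and non-terminals y of degree three.
data El (n : ℕ) : Set where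
  pr : (u w : Fin n) → El n
  tr : (y u v w : Fin n) → El n

flat : List (El n) → List (Edge n)
flat []                = []
flat (pr u w ∷ L)     = (u , w) ∷ flat L
flat (tr y u v w ∷ L) = (y , u) ∷ (y , v) ∷ (y , w) ∷ flat L

elnm : VSet n → El n → ℕ
elnm X (pr u w)     = nm (X u) (X w) (X w)
elnm X (tr _ u v w) = nm (X u) (X v) (X w)

elcut : List (El n) → VSet n → ℕ
elcut L X = sumOf (elnm X) L

elcut-SLike : (L : List (El n)) → SLike (elcut L)
elcut-SLike = slike-sum (λ e X → elnm X e) λ { (pr u w) → nmSet-SLike u w w ; (tr _ u v w) → nmSet-SLike u v w }

GoodEl : VSet n → El n → Set
GoodEl S (pr u w)     = S u ≡ true × S w ≡ true × u ≢ w
GoodEl S (tr y u v w) = S y ≡ false × S u ≡ true × S v ≡ true × S w ≡ true × u ≢ v × u ≢ w × v ≢ w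

flat-++ : (L M : List (El n)) → flat (L ++ M) ≡ flat L ++ flat M
flat-++ [] M = refl
flat-++ (pr u w ∷ L) M = cong (_ ∷_) (flat-++ L M)
flat-++ (tr y u v w ∷ L) M = cong (λ z → _ ∷ _ ∷ _ ∷ z) (flat-++ L M)

module Engine {n} (k : ℕ) (2≤k : 2 ≤ k) (S : VSet n) where
  open Splitting k 2≤k S

  NonS : Fin n → Set
  NonS v = S v ≡ false

  Ends : List (Fin n) → Edge n → Set
  Ends vs (u , w) = (S u ≡ true × S w ≡ true) ⊎ (S u ≡ true × S w ≡ false × w ∈ₗ vs) ⊎ (S u ≡ false × S w ≡ true × u ∈ₗ vs)

  record Gathered (v : Fin n) (vs : List (Fin n)) (R : List (Edge n)) : Set where
    constructor gathered
    field
      {N}  : List (Fin n)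
      {R₀} : List (Edge n)
      imm  : Imm NonS R (star v N ++ R₀)
      cut= : ∀ X → d R X ≡ d (star v N ++ R₀) X
      N⊑S  : ∀ {u} → u ∈ₗ N → S u ≡ true
      incident : ∀ {e} → e ∈ₗ R₀ → Ends vs e × proj₁ e ≢ v × proj₂ e ≢ v

  gather : ∀ v vs R → S v ≡ false → (∀ {e} → e ∈ₗ R → Ends (v ∷ vs) e) → Gathered v vs R
  gather v vs [] Sv h = gathered {N = []} {[]} idI (λ _ → refl) (λ ()) (λ ())
  gather v vs ((u , w) ∷ R) Sv h with gather v vs R Sv (h ∘ there) | h (here refl) | u F.≟ v | w F.≟ v
  ... | gathered {N} {R₀} i c s e | hh | no a | no b = gathered {N = N} {(u , w) ∷ R₀} (consI i ⨾ perm (↭-sym (PP.shift (u , w) (star v N) R₀)))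
      (λ X → trans (cong (cross X (u , w) +_) (c X)) (d-↭ X (↭-sym (PP.shift (u , w) (star v N) R₀)))) s
      λ { (here refl) → weak hh , a , b ; (there j) → e j }
    where
    weak : Ends (v ∷ vs) (u , w) → Ends vs (u , w)
    weak (inj₁ p) = inj₁ p
    weak (inj₂ (inj₁ (p , q , here r)))  = contradiction r b
    weak (inj₂ (inj₁ (p , q , there r))) = inj₂ (inj₁ (p , q , r))
    weak (inj₂ (inj₂ (p , q , here r)))  = contradiction r a
    weak (inj₂ (inj₂ (p , q , there r))) = inj₂ (inj₂ (p , q , r))
  ... | gathered {N} {R₀} i c s e | inj₁ (p , _) | yes refl | _ = ⊥-elim (true≢false p Sv)
  ... | gathered {N} {R₀} i c s e | inj₂ (inj₁ (p , _)) | yes refl | _ = ⊥-elim (true≢false p Sv)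
  ... | gathered {N} {R₀} i c s e | inj₂ (inj₂ (_ , q , _)) | yes refl | _ = gathered {N = w ∷ N} {R₀} (consI i) (λ X → cong (cross X (u , w) +_) (c X))
      (λ { (here refl) → q ; (there j) → s j }) e
  ... | gathered {N} {R₀} i c s e | inj₁ (_ , p) | no _ | yes refl = ⊥-elim (true≢false p Sv)
  ... | gathered {N} {R₀} i c s e | inj₂ (inj₂ (_ , p , _)) | no _ | yes refl = ⊥-elim (true≢false p Sv)
  ... | gathered {N} {R₀} i c s e | inj₂ (inj₁ (q , _ , _)) | no _ | yes refl = gathered {N = u ∷ N} {R₀} (flip ⨾ consI i) (λ X → cong₂ _+_ (cross-flip X u w) (c X))
      (λ { (here refl) → q ; (there j) → s j }) e

  record Els (E : List (Edge n)) : Set where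
    field
      {els} : List (El n)
      imm   : Imm NonS E (flat els)
      good  : ∀ {e} → e ∈ₗ els → GoodEl S e
      cut   : ∀ X → Sep S X → k ≤ elcut els X

  nm-min : ∀ a b c {r} → k ≤ b2n a + (b2n b + (b2n c + 0)) + r → k ≤ b2n (not a) + (b2n (not b) + (b2n (not c) + 0)) + r → k ≤ nm a b c + r
  nm-min true  true  true  p q = q
  nm-min true  true  false p q = q
  nm-min true  false true  p q = q
  nm-min true  false false p q = p
  nm-min false true  true  p q = q
  nm-min false true  false p q = p
  nm-min false false true  p q = p
  nm-min false false false p q = p

  away : ∀ (X : VSet n) {u v} → u ≢ v → (X ∖ sg v) u ≡ X u
  away X {u} {v} h = trans (cong (λ z → X u ∧ not z) (≢⇒== h)) (𝔹.∧-identityʳ (X u))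

  elnm-≡ : ∀ {X Y : VSet n} → (∀ v → S v ≡ true → X v ≡ Y v) → ∀ L → (∀ {e} → e ∈ₗ L → GoodEl S e) → elcut L X ≡ elcut L Y
  elnm-≡ h [] g = refl
  elnm-≡ {X} {Y} h (pr u w ∷ L) g = cong₂ _+_ (cong₂ (λ a b → nm a b b) (h u (proj₁ (g (here refl)))) (h w (proj₁ (proj₂ (g (here refl)))))) (elnm-≡ h L (g ∘ there))
  elnm-≡ {X} {Y} h (tr y u v w ∷ L) g with _ , a , b , c , _ ← g (here refl) =
    cong₂ _+_ (trans (cong₂ (λ a b → nm a b (X w)) (h u a) (h v b)) (cong (nm (Y u) (Y v)) (h w c))) (elnm-≡ h L (g ∘ there))

  d-away : ∀ (X : VSet n) v R → (∀ {e} → e ∈ₗ R → proj₁ e ≢ v × proj₂ e ≢ v) → d R (X ∖ sg v) ≡ d R X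
  d-away X v [] h = refl
  d-away X v ((u , w) ∷ R) h = cong₂ _+_ (cong₂ (λ a b → nm a b b) (away X (proj₁ (h (here refl)))) (away X (proj₂ (h (here refl))))) (d-away X v R (h ∘ there))

  d-star : ∀ (X : VSet n) v N → X v ≡ false → d (star v N) X ≡ cnt N X
  d-star X v [] e = refl
  d-star X v (u ∷ N) e = cong₂ _+_ (lem (X v) (X u) e) (d-star X v N e)
    where lem : ∀ a b → a ≡ false → nm a b b ≡ b2n b
          lem false true  _ = refl
          lem false false _ = refl

  process : ∀ vs L R → (∀ {e} → e ∈ₗ R → Ends vs e) → (∀ {e} → e ∈ₗ L → GoodEl S e) → (∀ X → Sep S X → k ≤ elcut L X + d R X) → Els (flat L ++ R)
  process [] L R incident good cut = record
    { els = map (λ (u , w) → pr u w) (nl R) ++ L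
    ; imm = perm (PP.++-comm (flat L) R) ⨾ suffixI (filterI nonloop R) ⨾ ≡I (sym (trans (flat-++ (map _ (nl R)) L) (cong (_++ flat L) (flat-pr (nl R)))))
    ; good = λ i → [ good-pr , good ]′ (∈-++⁻ _ i)
    ; cut = λ X s → ≤-trans (cut X s) (≤-reflexive (trans (+-comm (elcut L X) (d R X)) (sym (trans (sumOf-++ (elnm X) (map _ (nl R)) L)
        (cong (_+ elcut L X) (trans (sumOf-map (elnm X) _ (nl R)) (d-nl R X))))))) }
    where
    flat-pr : ∀ R → flat (map (λ (u , w) → pr u w) R) ≡ R
    flat-pr []      = refl
    flat-pr (e ∷ R) = cong (e ∷_) (flat-pr R)
    good-pr : ∀ {e} → e ∈ₗ map (λ (u , w) → pr u w) (nl R) → GoodEl S e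
    good-pr i with (u , w) , j , refl ← ∈-map⁻ _ i with incident (proj₁ (sieve-∈ nonloop R j))
    ... | inj₁ (a , b) = a , b , nl-NonLoop R j
    ... | inj₂ (inj₁ (_ , _ , ()))
    ... | inj₂ (inj₂ (_ , _ , ()))
  process (v ∷ vs) L R incident good cut with bool? (S v)
  ... | inj₁ Sv = process vs L R (λ i → weak (incident i)) good cut
    where
    weak : ∀ {e} → Ends (v ∷ vs) e → Ends vs e
    weak (inj₁ p) = inj₁ p
    weak (inj₂ (inj₁ (p , q , here refl))) = ⊥-elim (true≢false Sv q)
    weak (inj₂ (inj₁ (p , q , there r))) = inj₂ (inj₁ (p , q , r))
    weak (inj₂ (inj₂ (p , q , here refl))) = ⊥-elim (true≢false Sv p)
    weak (inj₂ (inj₂ (p , q , there r))) = inj₂ (inj₂ (p , q , r))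
  ... | inj₂ Sv with gather v vs R Sv incident
  ...   | gathered {N} {R₀} gi gc N⊑S ge = finish (Result.shape res)
    where
    module SV = SplitVertex v (elcut L) (elcut-SLike L)
    open SV using (module Result)
    S≢v : ∀ {u} → S u ≡ true → u ≢ v
    S≢v a refl = true≢false a Sv
    cut₀ : Cut N (SV.rest R₀)
    cut₀ X ((a , Sa , Xa) , (b , Sb , Xb)) = ≤-trans (cut X' ((a , Sa , trans (away X (S≢v Sa)) Xa) , (b , Sb , trans (away X (S≢v Sb)) Xb)))
        (≤-reflexive (trans (cong₂ _+_ (elnm-≡ {X'} {X} (λ u Su → away X (S≢v Su)) L good)
          (trans (gc X') (trans (sumOf-++ (cross X') (star v N) R₀) (cong₂ _+_ (trans (d-star X' v N X'v) (cnt-away N N⊑S)) (d-away X v R₀ (proj₂ ∘ ge))))))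
          (re (elcut L X) (cnt N X) (d R₀ X))))
      where
      X' = X ∖ sg v
      X'v : X' v ≡ false
      X'v = trans (cong (λ z → X v ∧ not z) (==-refl v)) (𝔹.∧-zeroʳ (X v))
      cnt-away : ∀ N → (∀ {u} → u ∈ₗ N → S u ≡ true) → cnt N X' ≡ cnt N X
      cnt-away [] h = refl
      cnt-away (u ∷ N) h = cong₂ _+_ (cong b2n (away X (S≢v (h (here refl))))) (cnt-away N (h ∘ there))
      re : ∀ a b c → a + (b + c) ≡ b + (a + c)
      re = solve-∀
    res = SV.reduce (length N) N R₀ ≤-refl cut₀ N⊑S
    module R = Result res
    incident' : ∀ {e} → e ∈ₗ R.R' → Ends vs e
    incident' i = [ proj₁ ∘ ge , inj₁ ]′ (R.new i)
    toNonS : ∀ u → u ≡ v → NonS u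
    toNonS u refl = Sv
    imm₁ : Imm NonS (flat L ++ R) (flat L ++ star v R.N' ++ R.R')
    imm₁ = prefixI (flat L) (gi ⨾ weaken toNonS R.imm)
    finish : SV.Shape R.N' → Els (flat L ++ R)
    finish (inj₁ e) = record { imm = (imm₁ ⨾ ≡I (cong (λ z → flat L ++ star v z ++ R.R') e)) ⨾ Els.imm rec ; good = Els.good rec ; cut = Els.cut rec }
      where rec = process vs L R.R' incident' good λ X s → subst (λ z → k ≤ cnt z X + SV.rest R.R' X) e (R.cut X s)
    finish (inj₂ (a , b , c , e , a≢b , a≢c , b≢c)) = record
        { imm = (imm₁ ⨾ ≡I (cong (λ z → flat L ++ star v z ++ R.R') e) ⨾ perm (PP.shifts (flat L) (star v (a ∷ b ∷ c ∷ [])))) ⨾ Els.imm rec ; good = Els.good rec ; cut = Els.cut rec }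
      where
      mem : ∀ {u} → u ∈ₗ a ∷ b ∷ c ∷ [] → S u ≡ true
      mem i = R.N'⊑S (subst (_ ∈ₗ_) (sym e) i)
      cutT : ∀ X → Sep S X → k ≤ elcut (tr v a b c ∷ L) X + d R.R' X
      cutT X s = ≤-trans (nm-min (X a) (X b) (X c) (subst (λ z → k ≤ cnt z X + SV.rest R.R' X) e (R.cut X s))
          (subst₂ (λ z y → k ≤ cnt z (∁ X) + y) e (SLike.com (slike-+ (elcut-SLike L) (d-SLike R.R')) X) (R.cut (∁ X) (Sep-∁ s))))
        (≤-reflexive (sym (+-assoc (nm (X a) (X b) (X c)) (elcut L X) (d R.R' X))))
      rec = process vs (tr v a b c ∷ L) R.R' incident' (λ { (here refl) → Sv , mem (here refl) , mem (there (here refl)) , mem (there (there (here refl))) , a≢b , a≢c , b≢c ; (there i) → good i }) cutT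

  engine : ∀ E → NonLoop E → Indep S E → Conn k S E → Els E
  engine E nlE ind c = process (allFin n) [] E incident (λ ()) c
    where
    incident : ∀ {e} → e ∈ₗ E → Ends (allFin n) e
    incident {u , w} i with bool? (S u) | bool? (S w) | ind i (nlE i)
    ... | inj₁ a | inj₁ b | _ = inj₁ (a , b)
    ... | inj₁ a | inj₂ b | _ = inj₂ (inj₁ (a , b , ∈-allFin w))
    ... | inj₂ a | inj₁ b | _ = inj₂ (inj₂ (a , b , ∈-allFin u))
    ... | inj₂ a | inj₂ b | inj₁ t = ⊥-elim (true≢false t a)
    ... | inj₂ a | inj₂ b | inj₂ t = ⊥-elim (true≢false t b)

join : (Fin n → Fin n) → Edge n → Fin n → Fin n
join κ (x , y) v = if κ v == κ x then κ y else κ v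

-- Component labels of a graph on the classes of κ.
joins : (Fin n → Fin n) → List (Edge n) → Fin n → Fin n
joins κ []      = κ
joins κ (e ∷ E) = join (joins κ E) e

Respects : (Fin n → Fin n) → (Fin n → Fin n) → Set
Respects f κ = ∀ u v → κ u ≡ κ v → f u ≡ f v

join-keeps : (κ : Fin n → Fin n) → ∀ e → Respects (join κ e) κ
join-keeps κ (x , y) u v e rewrite e = refl

join-edge : (κ : Fin n → Fin n) → ∀ x y → join κ (x , y) x ≡ join κ (x , y) y
join-edge κ x y rewrite ==-refl (κ x) with κ y == κ x
... | true  = refl
... | false = refl

join-univ : (κ f : Fin n → Fin n) → ∀ {x y} → Respects f κ → f x ≡ f y → Respects f (join κ (x , y))
join-univ κ f {x} {y} r e u v h with κ u F.≟ κ x | κ v F.≟ κ x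
... | yes p | yes q = r u v (trans p (sym q))
... | yes p | no _  = trans (r u x p) (trans e (r y v h))
... | no _  | yes q = trans (r u y h) (trans (sym e) (r x v (sym q)))
... | no _  | no _  = r u v h

joins-edge : (κ : Fin n → Fin n) → ∀ {E x y} → (x , y) ∈ₗ E → joins κ E x ≡ joins κ E y
joins-edge κ {(x , y) ∷ E} (here refl) = join-edge (joins κ E) x y
joins-edge κ {e ∷ E} {x} {y} (there i) = join-keeps (joins κ E) e x y (joins-edge κ i)

joins-univ : (κ f : Fin n → Fin n) → ∀ E → Respects f κ → (∀ {x y} → (x , y) ∈ₗ E → f x ≡ f y) → Respects f (joins κ E)
joins-univ κ f [] r h = r
joins-univ κ f ((x , y) ∷ E) r h = join-univ (joins κ E) f (joins-univ κ f E r (h ∘ there)) (h (here refl))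

record Labels (S : VSet n) (κ : Fin n → Fin n) : Set where
  constructor labels
  field
    idem : ∀ v → κ (κ v) ≡ κ v
    stay : ∀ v → S v ≡ true → S (κ v) ≡ true

join-Labels : ∀ {S : VSet n} {κ} → Labels S κ → ∀ {x y} → S x ≡ true → S y ≡ true → Labels S (join κ (x , y))
join-Labels {S = S} {κ} (labels idem stay) {x} {y} Sx Sy = labels id' st
  where
  id' : ∀ v → join κ (x , y) (join κ (x , y) v) ≡ join κ (x , y) v
  id' v with κ v == κ x in eq
  ... | true rewrite idem y with κ y == κ x
  ...   | true  = refl
  ...   | false = refl
  id' v | false rewrite idem v | eq = refl
  st : ∀ v → S v ≡ true → S (join κ (x , y) v) ≡ true
  st v Sv with κ v == κ x
  ... | true  = stay y Sy
  ... | false = stay v Sv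

joins-Labels : ∀ {S : VSet n} {κ} → Labels S κ → ∀ E → (∀ {x y} → (x , y) ∈ₗ E → S x ≡ true × S y ≡ true) → Labels S (joins κ E)
joins-Labels l [] h = l
joins-Labels l (e ∷ E) h = join-Labels (joins-Labels l E (h ∘ there)) (proj₁ (h (here refl))) (proj₂ (h (here refl)))

cls : VSet n → (Fin n → Fin n) → ℕ
cls S κ = sumOf (λ v → b2n (S v ∧ (κ v == v))) (allFin _)

cls-join : ∀ {S : VSet n} {κ} → Labels S κ → ∀ {x y} → S x ≡ true → κ x ≢ κ y → suc (cls S (join κ (x , y))) ≡ cls S κ
cls-join {n} {S} {κ} (labels idem stay) {x} {y} Sx ne = trans (+-comm 1 _) (trans (cong (cls S (join κ (x , y)) +_) (sym one)) (trans (sym (sumOf-+ _ _ (allFin n))) (sumOf-cong (allFin n) pt)))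
  where
  one : sumOf (λ v → b2n (v == κ x)) (allFin n) ≡ 1
  one = trans (sumOf-cong (allFin n) λ v → sym (*-identityʳ _)) (sum-at (λ _ → 1) (κ x))
  pt : ∀ v → b2n (S v ∧ (join κ (x , y) v == v)) + b2n (v == κ x) ≡ b2n (S v ∧ (κ v == v))
  pt v with v F.≟ κ x
  ... | yes refl rewrite idem x | ==-refl (κ x) | ≢⇒== (ne ∘ sym) | stay x Sx = refl
  ... | no h with κ v F.≟ κ x
  ...   | no _ = +-identityʳ _
  ...   | yes p with κ y F.≟ v | κ v F.≟ v
  ...     | _ | yes q = contradiction (trans (sym q) p) h
  ...     | yes q | no r = contradiction (trans (cong κ (sym q)) (trans (idem y) q)) r
  ...     | no _ | no _ = +-identityʳ _

cls-≥1 : ∀ {S : VSet n} {κ} → Labels S κ → ∀ {s} → S s ≡ true → 1 ≤ cls S κ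
cls-≥1 {S = S} {κ} (labels idem stay) {s} Ss =
  ≤-trans (≤-reflexive (sym (cong b2n (∧-intro (stay s Ss) (trans (cong (_== κ s) (idem s)) (==-refl (κ s))))))) (sumOf-∈ (λ v → b2n (S v ∧ (κ v == v))) (∈-allFin (κ s)))

sieve-length : (p : A → Bool) → ∀ xs → length (sieve p xs) ≡ sumOf (b2n ∘ p) xs
sieve-length p [] = refl
sieve-length p (x ∷ xs) with p x
... | true  = cong suc (sieve-length p xs)
... | false = sieve-length p xs

minBy : (f : A → ℕ) → ∀ x xs → Σ[ y ∈ A ] Σ[ ys ∈ List A ] (x ∷ xs) ↭ (y ∷ ys) × (∀ {z} → z ∈ₗ ys → f y ≤ f z)
minBy f x [] = x , [] , ↭-refl , λ ()
minBy f x (x' ∷ xs) with minBy f x' xs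
... | y , ys , p , h with ≤-total (f x) (f y)
...   | inj₁ le = x , x' ∷ xs , ↭-refl , λ i → below (PP.∈-resp-↭ p i)
  where below : ∀ {z} → z ∈ₗ y ∷ ys → f x ≤ f z
        below (here refl) = le
        below (there i)   = ≤-trans le (h i)
...   | inj₂ ge = y , x ∷ ys , ↭-trans (P.prep x p) (P.swap x y ↭-refl) , λ { (here refl) → ge ; (there i) → h i }

data Opt : Set where
  ab bc : Opt

verts₃ : El n → Fin n × Fin n × Fin n
verts₃ (pr u w)     = u , w , w
verts₃ (tr _ u v w) = u , v , w

option : Opt → El n → Edge n
option ab e = let a , b , c = verts₃ e in a , b
option bc e = let a , b , c = verts₃ e in b , c

mono : (Fin n → Fin n) → El n → Bool
mono κ e = let a , b , c = verts₃ e in (κ a == κ b) ∧ (κ b == κ c)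

mono-option : ∀ (κ : Fin n → Fin n) o e → mono κ e ≡ true → κ (proj₁ (option o e)) ≡ κ (proj₂ (option o e))
mono-option κ ab e m = ==⇒≡ (proj₁ (∧-elim m))
mono-option κ bc e m = let a , b , c = verts₃ e in ==⇒≡ (proj₂ (∧-elim {κ a == κ b} m))

mono-resp : ∀ {κ f : Fin n → Fin n} e → Respects f κ → mono κ e ≡ true → mono f e ≡ true
mono-resp {κ = κ} {f} e r m with a , b , c ← verts₃ e = ∧-intro (eq (r a b (==⇒≡ (proj₁ (∧-elim m))))) (eq (r b c (==⇒≡ (proj₂ (∧-elim {κ a == κ b} m)))))
  where eq : ∀ {x y : Fin _} → x ≡ y → (x == y) ≡ true
        eq refl = ==-refl _

not-mono : ∀ (κ : Fin n → Fin n) e → mono κ e ≡ false → Σ[ o ∈ Opt ] κ (proj₁ (option o e)) ≢ κ (proj₂ (option o e))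
not-mono κ e m with a , b , c ← verts₃ e in eq with κ a F.≟ κ b | κ b F.≟ κ c
... | no h | _ = ab , subst (λ t → κ (proj₁ t) ≢ κ (proj₁ (proj₂ t))) (sym eq) h
... | yes _ | no h = bc , subst (λ t → κ (proj₁ (proj₂ t)) ≢ κ (proj₂ (proj₂ t))) (sym eq) h
not-mono κ e () | yes _ | yes _

VertsIn : VSet n → El n → Set
VertsIn S e = let a , b , c = verts₃ e in S a ≡ true × S b ≡ true × S c ≡ true

option-in : ∀ {S : VSet n} o e → VertsIn S e → S (proj₁ (option o e)) ≡ true × S (proj₂ (option o e)) ≡ true
option-in ab e (p , q , r) = p , q
option-in bc e (p , q , r) = q , r

sieve-remove : (p : A → Bool) → ∀ T {t Y} → sieve p T ↭ t ∷ Y → Σ[ T₀ ∈ List A ] T ↭ t ∷ T₀ × (∀ {y} → y ∈ₗ Y → y ∈ₗ T₀)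
sieve-remove p T {t} {Y} q = Y ++ sieve (not ∘ p) T , ↭-trans (sieve-halves p T) (PP.++⁺ʳ (sieve (not ∘ p) T) q) , ∈-++⁺ˡ

-- Colourings of the elements by suc h' colours, together with the choice of a pair in each element (Kaiser's proof of the tree-packing theorem).
module Packing {n} (h' : ℕ) (S : VSet n) (s₀ : Fin n) (Ss₀ : S s₀ ≡ true) where
  h = suc h'

  record It : Set where
    constructor it
    field
      el  : El n
      col : Fin h
      opt : Opt
    pair : Edge n
    pair = option opt el
  open It public

  σ : ℕ → Fin h
  σ i = fromℕ< (m%n<n i h)
    where open import Data.Nat.DivMod using (m%n<n)

  σ-col : ∀ b (c : Fin h) → σ (toℕ c + b * h) ≡ c
  σ-col b c = FP.toℕ-injective (trans (FP.toℕ-fromℕ< _) (trans ([m+kn]%n≡m%n (toℕ c) b h) (m<n⇒m%n≡m (FP.toℕ<n c))))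
    where open import Data.Nat.DivMod using ([m+kn]%n≡m%n; m<n⇒m%n≡m)

  sel : Fin h → (Fin n → Fin n) → It → Bool
  sel c κ t = (col t == c) ∧ mono κ (el t)

  part : List It → ℕ → Fin n → Fin n
  part T zero    = λ _ → s₀
  part T (suc i) = joins id (map pair (sieve (sel (σ i) (part T i)) T))

  part-in : ∀ {T i t} → t ∈ₗ T → col t ≡ σ i → mono (part T i) (el t) ≡ true → part T (suc i) (proj₁ (pair t)) ≡ part T (suc i) (proj₂ (pair t))
  part-in {T} {i} {t} j c m = joins-edge id (∈-map⁺ pair (∈-sieve (sel (σ i) (part T i)) j (∧-intro (trans (cong (_== σ i) c) (==-refl (σ i))) m)))

  part-univ : ∀ T i (f : Fin n → Fin n) → (∀ {t} → t ∈ₗ T → col t ≡ σ i → mono (part T i) (el t) ≡ true → f (proj₁ (pair t)) ≡ f (proj₂ (pair t))) → Respects f (part T (suc i))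
  part-univ T i f hyp = joins-univ id f _ (λ u v → cong f) λ j → lem j
    where
    lem : ∀ {x y} → (x , y) ∈ₗ map pair (sieve (sel (σ i) (part T i)) T) → f x ≡ f y
    lem j with t , j' , refl ← ∈-map⁻ pair j with k , e ← sieve-∈ (sel (σ i) (part T i)) T j' = hyp k (==⇒≡ (proj₁ (∧-elim e))) (proj₂ (∧-elim {col t == σ i} e))

  refine : ∀ T i → Respects (part T i) (part T (suc i))
  refine T i = part-univ T i (part T i) λ {t} _ _ m → mono-option (part T i) (opt t) (el t) m

  refine* : ∀ T i j → Respects (part T i) (part T (j + i))
  refine* T i zero    u v e = e
  refine* T i (suc j) u v e = refine* T i j u v (refine T (j + i) u v e)

  refine≤ : ∀ T {i j} → i ≤ j → Respects (part T i) (part T j)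
  refine≤ T {i} {j} le u v e = refine* T i (j ∸ i) u v (subst (λ z → part T z u ≡ part T z v) (sym (m∸n+n≡m le)) e)

  Pairs : List (Fin n × Fin n)
  Pairs = cartesianProduct (allFin n) (allFin n)

  μ : (Fin n → Fin n) → ℕ
  μ κ = sumOf (λ (u , v) → b2n (not (κ u == κ v))) Pairs

  μ-pt : ∀ {κ f : Fin n → Fin n} → Respects f κ → ∀ e → b2n (not (f (proj₁ e) == f (proj₂ e))) ≤ b2n (not (κ (proj₁ e) == κ (proj₂ e)))
  μ-pt {κ} {f} r (u , v) with κ u F.≟ κ v | f u F.≟ f v
  ... | yes p | yes _ = z≤n
  ... | yes p | no q = contradiction (r u v p) q
  ... | no _ | yes _ = z≤n
  ... | no _ | no _ = ≤-refl

  μ-≤ : ∀ {κ f : Fin n → Fin n} → Respects f κ → μ f ≤ μ κ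
  μ-≤ r = sumOf-≤ Pairs λ {e} _ → μ-pt r e

  b2n-== : ∀ {x y : Fin n} → x ≡ y → b2n (not (x == y)) ≡ 0
  b2n-== refl = cong (b2n ∘ not) (==-refl _)

  b2n-≢ : ∀ {x y : Fin n} → x ≢ y → b2n (not (x == y)) ≡ 1
  b2n-≢ ne = cong (b2n ∘ not) (≢⇒== ne)

  μ-< : ∀ {κ f : Fin n → Fin n} → Respects f κ → ∀ u v → f u ≡ f v → κ u ≢ κ v → μ f < μ κ
  μ-< r u v e ne = sumOf-< Pairs (λ {e} _ → μ-pt r e) (∈-cartesianProduct⁺ (∈-allFin u) (∈-allFin v)) (subst₂ _<_ (sym (b2n-== e)) (sym (b2n-≢ ne)) ≤-refl)

  μ-≡ : ∀ {κ f : Fin n → Fin n} → Respects f κ → μ κ ≤ μ f → Respects κ f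
  μ-≡ {κ} {f} r le u v e with κ u F.≟ κ v
  ... | yes p = p
  ... | no p = contradiction le (<⇒≱ (μ-< r u v e p))

  M = length Pairs

  μ≤M : ∀ κ → μ κ ≤ M
  μ≤M κ = ≤-trans (sumOf-≤ Pairs λ {e} _ → b2n≤1 (not (κ (proj₁ e) == κ (proj₂ e)))) (≤-reflexive (trans (sumOf-const 1 Pairs) (*-identityʳ M)))

  record Stable (T : List It) : Set where
    field
      N     : ℕ
      small : N ≤ M * h
      fixed : ∀ c (f : Fin n → Fin n) → (∀ {t} → t ∈ₗ T → col t ≡ c → mono (part T N) (el t) ≡ true → f (proj₁ (pair t)) ≡ f (proj₂ (pair t))) → Respects f (part T N)

  stabilise : ∀ T → Stable T
  stabilise T = [ id , (λ le → contradiction (≤-trans le (μ≤M _)) 1+n≰n) ]′ (search (suc M) ≤-refl)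
    where
    m : ℕ → ℕ
    m b = μ (part T (b * h))
    search : ∀ b → b ≤ suc M → Stable T ⊎ (b ≤ m b)
    search zero    _ = inj₂ z≤n
    search (suc b) l with search b (≤-trans (n≤1+n b) l)
    ... | inj₁ s = inj₁ s
    ... | inj₂ le with m (suc b) ≤? m b
    ...   | no gt = inj₂ (≤-trans (s≤s le) (≰⇒> gt))
    ...   | yes eq = inj₁ (record { N = N ; small = *-monoˡ-≤ h (≤-pred l) ; fixed = fixed })
      where
      N = b * h
      all : Respects (part T (h + N)) (part T N)
      all = μ-≡ (refine* T N h) eq
      same : ∀ j → j ≤ h → Respects (part T (j + N)) (part T N)
      same j le u v e = refine≤ T (+-monoˡ-≤ N le) u v (all u v e)
      fixed : ∀ c (f : Fin n → Fin n) → (∀ {t} → t ∈ₗ T → col t ≡ c → mono (part T N) (el t) ≡ true → f (proj₁ (pair t)) ≡ f (proj₂ (pair t))) → Respects f (part T N)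
      fixed c f hyp u v e = part-univ T (toℕ c + N) f (λ {t} i ci mi → hyp i (trans ci (σ-col b c)) (mono-resp (el t) (refine* T N (toℕ c)) mi)) u v
        (same (suc (toℕ c)) (FP.toℕ<n c) u v e)

  pairs : List It → List (Edge n)
  pairs = map pair

  pair∈ : ∀ {X x y} → (x , y) ∈ₗ pairs X → Σ[ t ∈ It ] t ∈ₗ X × (x , y) ≡ pair t
  pair∈ = ∈-map⁻ pair

  -- The pair of the item t is already connected by other items of at least the same level.
  record Redundant (κ : Fin n → Fin n) (lev : It → ℕ) (X : List It) : Set where
    constructor redundant
    field
      {t}  : It
      {Y Z} : List It
      pull : X ↭ t ∷ Y
      Z⊆Y  : ∀ {z} → z ∈ₗ Z → z ∈ₗ Y × lev t ≤ lev z
      conn : joins κ (pairs Z) (proj₁ (pair t)) ≡ joins κ (pairs Z) (proj₂ (pair t))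

  scan : ∀ κ lev m X → length X ≤ m → Labels S κ → (∀ {t} → t ∈ₗ X → VertsIn S (el t)) → Redundant κ lev X ⊎ suc (length X) ≤ cls S κ
  scan κ lev m X le lab vin = [ inj₁ , (λ (κ' , lab' , eq) → inj₂ (≤-trans (≤-reflexive (+-comm 1 _)) (≤-trans (+-monoʳ-≤ (length X) (cls-≥1 lab' Ss₀)) (≤-reflexive eq)))) ]′ (go m X le vin)
    where
    go : ∀ m X → length X ≤ m → (∀ {t} → t ∈ₗ X → VertsIn S (el t)) →
      Redundant κ lev X ⊎ (Σ[ κ' ∈ (Fin n → Fin n) ] Labels S κ' × length X + cls S κ' ≡ cls S κ)
    go' : ∀ m X → length X ≤ m → (∀ {t} → t ∈ₗ X → VertsIn S (el t)) →
      Redundant κ lev X ⊎ (Σ[ X' ∈ List It ] X ↭ X' × length X + cls S (joins κ (pairs X')) ≡ cls S κ)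
    go m X le vin with go' m X le vin
    ... | inj₁ r = inj₁ r
    ... | inj₂ (X' , p , e) = inj₂ (joins κ (pairs X') , joins-Labels lab (pairs X') (λ i → let t , j , eq = pair∈ i in
          subst (λ e → S (proj₁ e) ≡ true × S (proj₂ e) ≡ true) (sym eq) (option-in {S = S} (opt t) (el t) (vin (PP.∈-resp-↭ (↭-sym p) j)))) , e)
    go' m [] le vin = inj₂ ([] , ↭-refl , refl)
    go' (suc m) (x ∷ X) le vin with minBy lev x X
    ... | t , Y , p , least with go' m Y (≤-pred (≤-trans (≤-reflexive (sym (PP.↭-length p))) le)) (λ i → vin (PP.∈-resp-↭ (↭-sym p) (there i)))
    ...   | inj₁ (redundant {t'} {Y'} {Z} q sub c) = inj₁ (redundant (↭-trans p (↭-trans (P.prep t q) (P.swap t t' ↭-refl))) (λ i → there (proj₁ (sub i)) , proj₂ (sub i)) c)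
    ...   | inj₂ (Y' , q , e) with joins κ (pairs Y') (proj₁ (pair t)) F.≟ joins κ (pairs Y') (proj₂ (pair t))
    ...     | yes c = inj₁ (redundant {Z = Y'} p (λ i → PP.∈-resp-↭ (↭-sym q) i , least (PP.∈-resp-↭ (↭-sym q) i)) c)
    ...     | no ne = inj₂ (t ∷ Y' , ↭-trans p (P.prep t q) , trans (cong (_+ cls S (joins κ (pairs (t ∷ Y')))) (PP.↭-length p))
          (trans (sym (+-suc (length Y) _)) (trans (cong (length Y +_) (cls-join labY (proj₁ (inS t (PP.∈-resp-↭ (↭-sym p) (here refl)))) ne)) e)))
      where
      inS : ∀ t → t ∈ₗ x ∷ X → S (proj₁ (pair t)) ≡ true × S (proj₂ (pair t)) ≡ true
      inS t i = option-in {S = S} (opt t) (el t) (vin i)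
      labY = joins-Labels lab (pairs Y') (λ i → let t' , j , eq = pair∈ i in
        subst (λ e → S (proj₁ e) ≡ true × S (proj₂ e) ≡ true) (sym eq) (inS t' (PP.∈-resp-↭ (↭-sym p) (there (PP.∈-resp-↭ (↭-sym q) j)))))

  crossing : (Fin n → Fin n) → Fin h → It → Bool
  crossing κ c t = (col t == c) ∧ not (mono κ (el t))

  class : (Fin n → Fin n) → Fin n → VSet n
  class κ v u = κ u == v

  class-≤3 : ∀ κ e → sumOf (λ v → elnm (class κ v) e) (allFin n) ≤ 3 * b2n (not (mono κ e))
  class-≤3 κ e = ≤-trans (sumOf-≤ (allFin n) λ {v} _ → pt v) (≤-trans (≤-reflexive (sumOf-* (b2n (not (mono κ e))) f (allFin n)))
      (≤-trans (*-monoʳ-≤ (b2n (not (mono κ e))) three) (≤-reflexive (*-comm (b2n (not (mono κ e))) 3))))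
    where
    a = proj₁ (verts₃ e)
    b = proj₁ (proj₂ (verts₃ e))
    c = proj₂ (proj₂ (verts₃ e))
    f : Fin n → ℕ
    f v = b2n (κ a == v) + b2n (κ b == v) + b2n (κ c == v)
    one : ∀ x → sumOf (λ v → b2n (x == v)) (allFin n) ≡ 1
    one x = trans (sumOf-cong (allFin n) λ v → trans (cong b2n (==-sym x v)) (sym (*-identityʳ _))) (sum-at (λ _ → 1) x)
    three : sumOf f (allFin n) ≤ 3
    three = ≤-reflexive (trans (sumOf-+ _ _ (allFin n)) (cong₂ _+_ (trans (sumOf-+ _ _ (allFin n)) (cong₂ _+_ (one (κ a)) (one (κ b)))) (one (κ c))))
    nm-≤ : ∀ x y z → nm x y z ≤ b2n x + b2n y + b2n z
    nm-≤ true  true  true  = z≤n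
    nm-≤ true  true  false = s≤s z≤n
    nm-≤ true  false true  = s≤s z≤n
    nm-≤ true  false false = s≤s z≤n
    nm-≤ false true  true  = s≤s z≤n
    nm-≤ false true  false = s≤s z≤n
    nm-≤ false false true  = s≤s z≤n
    nm-≤ false false false = z≤n
    nm₃ : ∀ v → elnm (class κ v) e ≡ nm (κ a == v) (κ b == v) (κ c == v)
    nm₃ v = lem e
      where lem : ∀ e → elnm (class κ v) e ≡ nm (κ (proj₁ (verts₃ e)) == v) (κ (proj₁ (proj₂ (verts₃ e))) == v) (κ (proj₂ (proj₂ (verts₃ e))) == v)
            lem (pr u w)     = refl
            lem (tr _ u v w) = refl
    nm-same : ∀ x → nm x x x ≡ 0
    nm-same true  = refl
    nm-same false = refl
    pt : ∀ v → elnm (class κ v) e ≤ b2n (not (mono κ e)) * f v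
    pt v with bool? (mono κ e)
    ... | inj₂ m = ≤-trans (≤-reflexive (nm₃ v)) (≤-trans (nm-≤ _ _ _) (≤-reflexive (sym (trans (cong (λ z → b2n (not z) * f v) m) (*-identityˡ (f v))))))
    ... | inj₁ m = ≤-trans (≤-reflexive (trans (nm₃ v) (trans (cong₂ (λ y z → nm (κ a == v) (y == v) (z == v)) (sym e₁) (sym (trans e₁ e₂))) (nm-same (κ a == v))))) z≤n
      where
      e₁ : κ a ≡ κ b
      e₁ = ==⇒≡ (proj₁ (∧-elim m))
      e₂ : κ b ≡ κ c
      e₂ = ==⇒≡ (proj₂ (∧-elim {κ a == κ b} m))

  module _ {k} (3h≤k : 3 * h ≤ k) (els : List (El n)) (cut : ∀ X → Sep S X → k ≤ elcut els X) where

    find-redundant : ∀ T → map el T ↭ els → (∀ {t} → t ∈ₗ T → VertsIn S (el t)) → ∀ κ → Labels S κ → (lev : It → ℕ) →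
      ∀ {u v} → S u ≡ true → S v ≡ true → κ u ≢ κ v → Σ[ c ∈ Fin h ] Redundant κ lev (sieve (crossing κ c) T)
    find-redundant T p vin κ lab lev {u} {v} Su Sv ne = choose (splitAll ok? (allFin h))
      where
      X : Fin h → List It
      X c = sieve (crossing κ c) T
      scanned : ∀ c → Redundant κ lev (X c) ⊎ suc (length (X c)) ≤ cls S κ
      scanned c = scan κ lev _ (X c) ≤-refl lab λ i → vin (proj₁ (sieve-∈ (crossing κ c) T i))
      ok? : ∀ c → Dec (suc (length (X c)) ≤ cls S κ)
      ok? c = suc (length (X c)) ≤? cls S κ
      q = cls S κ
      cross# = sumOf (λ t → b2n (not (mono κ (el t)))) T
      -- each class has at least k crossing elements, each of which meets at most three classes
      lower : k * q ≤ 3 * cross#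
      lower = begin
        k * q ≡⟨ sym (sumOf-* k _ (allFin n)) ⟩
        sumOf (λ v → k * b2n (S v ∧ (κ v == v))) (allFin n) ≤⟨ sumOf-≤ (allFin n) (λ {v} _ → pt v) ⟩
        sumOf (λ v → elcut els (class κ v)) (allFin n) ≡⟨ sumOf-swap (λ v e → elnm (class κ v) e) (allFin n) els ⟩
        sumOf (λ e → sumOf (λ v → elnm (class κ v) e) (allFin n)) els ≤⟨ sumOf-≤ els (λ {e} _ → class-≤3 κ e) ⟩
        sumOf (λ e → 3 * b2n (not (mono κ e))) els ≡⟨ sumOf-* 3 (λ e → b2n (not (mono κ e))) els ⟩
        3 * sumOf (λ e → b2n (not (mono κ e))) els ≡⟨ cong (3 *_) (trans (sumOf-↭ _ (↭-sym p)) (sumOf-map _ el T)) ⟩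
        3 * cross# ∎
        where
        open ≤-Reasoning
        other : ∀ w → S w ≡ true → κ w ≡ w → Sep S (class κ w)
        other w Sw e with κ u F.≟ w
        ... | yes p = (w , Sw , trans (cong (_== w) e) (==-refl w)) , (v , Sv , ≢⇒== λ r → ne (trans p (sym r)))
        ... | no r = (w , Sw , trans (cong (_== w) e) (==-refl w)) , (u , Su , ≢⇒== r)
        pt : ∀ w → k * b2n (S w ∧ (κ w == w)) ≤ elcut els (class κ w)
        pt w with bool? (S w ∧ (κ w == w))
        ... | inj₂ f rewrite f = ≤-trans (≤-reflexive (*-zeroʳ k)) z≤n
        ... | inj₁ t rewrite t = ≤-trans (≤-reflexive (*-identityʳ k)) (cut (class κ w) (other w (proj₁ (∧-elim t)) (==⇒≡ (proj₂ (∧-elim {S w} t)))))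
      colours : cross# ≡ sumOf (λ c → length (X c)) (allFin h)
      colours = trans (sumOf-cong T pt) (trans (sumOf-swap (λ t c → b2n (crossing κ c t)) T (allFin h)) (sumOf-cong (allFin h) λ c → sym (sieve-length (crossing κ c) T)))
        where
        pt : ∀ t → b2n (not (mono κ (el t))) ≡ sumOf (λ c → b2n (crossing κ c t)) (allFin h)
        pt t = sym (trans (sumOf-cong (allFin h) λ c → trans (b2n-∧ (col t == c) _) (cong (λ z → b2n z * b2n (not (mono κ (el t)))) (==-sym (col t) c))) (sum-at (λ _ → b2n (not (mono κ (el t)))) (col t)))
          where b2n-∧ : ∀ x y → b2n (x ∧ y) ≡ b2n x * b2n y
                b2n-∧ true y  = sym (+-identityʳ _)
                b2n-∧ false y = refl
      choose : (Σ[ c ∈ Fin h ] c ∈ₗ allFin h × ¬ suc (length (X c)) ≤ cls S κ) ⊎ (∀ {c} → c ∈ₗ allFin h → suc (length (X c)) ≤ cls S κ) → Σ[ c ∈ Fin h ] Redundant κ lev (X c)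
      choose (inj₁ (c , _ , bad)) = [ (λ r → c , r) , (λ le → contradiction le bad) ]′ (scanned c)
      choose (inj₂ all) = ⊥-elim (lin⊥ (3 * h' + 2) (≤-trans (*-monoʳ-≤ 3 upper) (≤-trans (≤-reflexive (sym (*-assoc 3 h q))) (≤-trans (*-monoˡ-≤ q 3h≤k) lower))) (re cross# h'))
        where
        upper : cross# + h ≤ h * q
        upper = begin
          cross# + h ≡⟨ cong₂ _+_ colours (sym (trans (sumOf-const 1 (allFin h)) (trans (*-identityʳ _) (length-allFin h)))) ⟩
          sumOf (λ c → length (X c)) (allFin h) + sumOf (λ _ → 1) (allFin h) ≡⟨ sym (sumOf-+ (λ c → length (X c)) (λ _ → 1) (allFin h)) ⟩
          sumOf (λ c → length (X c) + 1) (allFin h) ≤⟨ sumOf-≤ (allFin h) (λ {c} i → ≤-trans (≤-reflexive (+-comm _ 1)) (all i)) ⟩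
          sumOf (λ c → q) (allFin h) ≡⟨ trans (sumOf-const q (allFin h)) (cong (_* q) (length-allFin h)) ⟩
          h * q ∎
          where
          open ≤-Reasoning
          length-allFin : ∀ m → length (allFin m) ≡ m
          length-allFin m = Data.List.Properties.length-tabulate {n = m} id
            where import Data.List.Properties
        re : ∀ x h → 3 * (x + suc h) ≡ suc (3 * x + (3 * h + 2))
        re = solve-∀

    levels : List It → ℕ → It → ℕ
    levels T N t = sumOf (λ i → b2n (mono (part T i) (el t))) (upTo (suc N))

    Improved : List It → Set
    Improved T = Σ[ T' ∈ List It ] Σ[ j ∈ ℕ ] map el T' ↭ els × j < M * h × (∀ i → i ≤ j → μ (part T' i) ≡ μ (part T i)) × μ (part T' (suc j)) < μ (part T (suc j))

    Spanning : List It → Set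
    Spanning T = ∀ c {u v} → S u ≡ true → S v ≡ true → joins id (pairs (sieve (λ t → col t == c) T)) u ≡ joins id (pairs (sieve (λ t → col t == c) T)) v

    part-Labels : ∀ T → (∀ {t} → t ∈ₗ T → VertsIn S (el t)) → ∀ i → Labels S (part T i)
    part-Labels T vin zero = labels (λ _ → refl) (λ _ _ → Ss₀)
    part-Labels T vin (suc i) = joins-Labels (labels (λ _ → refl) (λ _ e → e)) _ λ j → let t , l , eq = pair∈ j in
      subst (λ e → S (proj₁ e) ≡ true × S (proj₂ e) ≡ true) (sym eq) (option-in {S = S} (opt t) (el t) (vin (proj₁ (sieve-∈ (sel (σ i) (part T i)) T l))))

    lev-mono : ∀ T N s t i → i ≤ N → levels T N s ≤ levels T N t → mono (part T i) (el s) ≡ true → mono (part T i) (el t) ≡ true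
    lev-mono T N s t i i≤N le ms with bool? (mono (part T i) (el t))
    ... | inj₁ m = m
    ... | inj₂ f = contradiction le (<⇒≱ (sumOf-< (upTo (suc N)) (λ {j} _ → pt j) (∈-upTo⁺ (s≤s i≤N)) (subst₂ _<_ (sym (cong b2n f)) (sym (cong b2n ms)) ≤-refl)))
      where
      pt : ∀ j → b2n (mono (part T j) (el t)) ≤ b2n (mono (part T j) (el s))
      pt j with bool? (mono (part T j) (el t)) | ≤-total j i
      ... | inj₂ g | _ rewrite g = z≤n
      ... | inj₁ g | inj₁ j≤i = ≤-reflexive (trans (cong b2n g) (sym (cong b2n (mono-resp (el s) (refine≤ T j≤i) ms))))
      ... | inj₁ g | inj₂ i≤j = ⊥-elim (true≢false (mono-resp (el t) (refine≤ T i≤j) g) f)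

    -- Kaiser's exchange: the redundant item of level m is recoloured so that it joins two parts of level m + 1.
    exchange : ∀ T → map el T ↭ els → (st : Stable T) → ∀ c → Redundant (part T (Stable.N st)) (levels T (Stable.N st)) (sieve (crossing (part T (Stable.N st)) c) T) → Improved T
    exchange T els↭ st c (redundant {t₀} {Y} {Z} pull Z⊆Y conn) = finish (drop-level N ¬monoN)
      where
      open Stable st
      κ = part T N
      X = sieve (crossing κ c) T
      t₀∈X : t₀ ∈ₗ X
      t₀∈X = PP.∈-resp-↭ (↭-sym pull) (here refl)
      cr : ∀ {t} → t ∈ₗ X → t ∈ₗ T × col t ≡ c × mono κ (el t) ≡ false
      cr {t} i with j , e ← sieve-∈ (crossing κ c) T i = j , ==⇒≡ (proj₁ (∧-elim e)) , not-f (proj₂ (∧-elim {col t == c} e))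
      ¬monoN : mono (part T N) (el t₀) ≡ false
      ¬monoN = proj₂ (proj₂ (cr t₀∈X))
      rem = sieve-remove (crossing κ c) T pull
      T₀ = proj₁ rem
      T↭ : T ↭ t₀ ∷ T₀
      T↭ = proj₁ (proj₂ rem)
      Y⊆T₀ : ∀ {t} → t ∈ₗ Y → t ∈ₗ T₀
      Y⊆T₀ = proj₂ (proj₂ rem)
      drop-level : ∀ N → mono (part T N) (el t₀) ≡ false → Σ[ m ∈ ℕ ] m < N × mono (part T m) (el t₀) ≡ true × mono (part T (suc m)) (el t₀) ≡ false
      drop-level zero f = ⊥-elim (true≢false (∧-intro (==-refl s₀) (==-refl s₀)) f)
      drop-level (suc N) f with bool? (mono (part T N) (el t₀))
      ... | inj₁ m = N , ≤-refl , m , f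
      ... | inj₂ g = let m , lt , r = drop-level N g in m , ≤-trans lt (n≤1+n N) , r
      finish : (Σ[ m ∈ ℕ ] m < N × mono (part T m) (el t₀) ≡ true × mono (part T (suc m)) (el t₀) ≡ false) → Improved T
      finish (m , m<N , mono-m , ¬mono-m) = T' , m , ↭-trans (PP.map⁺ el (P.prep t' (↭-refl {x = T₀}))) (↭-trans (PP.map⁺ el (↭-sym T↭)) els↭) ,
          ≤-trans m<N small , (λ i le → ≤-antisym (μ-≤ (fwd i le)) (μ-≤ (bwd i le))) , μ-< (up m ≤-refl) _ _ joined (proj₂ o')
        where
        o' = not-mono (part T (suc m)) (el t₀) ¬mono-m
        t' = it (el t₀) (σ m) (proj₁ o')
        T' = t' ∷ T₀
        monoi : ∀ i → i ≤ m → mono (part T i) (el t₀) ≡ true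
        monoi i le = mono-resp (el t₀) (refine≤ T le) mono-m
        fwd : ∀ i → i ≤ m → Respects (part T' i) (part T i)
        bwd : ∀ i → i ≤ m → Respects (part T i) (part T' i)
        up : ∀ i → i ≤ m → Respects (part T' (suc i)) (part T (suc i))
        up i le = part-univ T i f hyp
          where
          f = part T' (suc i)
          in' : ∀ {t} → t ∈ₗ T₀ → col t ≡ σ i → mono (part T i) (el t) ≡ true → f (proj₁ (pair t)) ≡ f (proj₂ (pair t))
          in' {t} j ct mt = part-in {T'} {i} (there j) ct (mono-resp (el t) (fwd i le) mt)
          i≤N = ≤-trans le (<⇒≤ m<N)
          hyp : ∀ {t} → t ∈ₗ T → col t ≡ σ i → mono (part T i) (el t) ≡ true → f (proj₁ (pair t)) ≡ f (proj₂ (pair t))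
          hyp {t} j ct mt with PP.∈-resp-↭ T↭ j
          ... | there j' = in' j' ct mt
          ... | here refl = joins-univ κ f (pairs Z) (fixed c f fκ) (λ l → fZ l) _ _ conn
            where
            c≡ : c ≡ σ i
            c≡ = trans (sym (proj₁ (proj₂ (cr t₀∈X)))) ct
            fκ : ∀ {t} → t ∈ₗ T → col t ≡ c → mono κ (el t) ≡ true → f (proj₁ (pair t)) ≡ f (proj₂ (pair t))
            fκ {t} l cl ml with PP.∈-resp-↭ T↭ l
            ... | here refl = ⊥-elim (true≢false ml ¬monoN)
            ... | there l' = in' l' (trans cl c≡) (mono-resp (el t) (refine≤ T i≤N) ml)
            fZ : ∀ {x y} → (x , y) ∈ₗ pairs Z → f x ≡ f y
            fZ l with t , l' , refl ← pair∈ l with ly , lv ← Z⊆Y l' =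
              in' (Y⊆T₀ ly) (trans (proj₁ (proj₂ (cr (PP.∈-resp-↭ (↭-sym pull) (there ly))))) c≡) (lev-mono T N t₀ t i i≤N lv (monoi i le))
        fwd zero    le u v e = refl
        fwd (suc i) le = up i (≤-trans (n≤1+n i) le)
        bwd zero    le u v e = refl
        bwd (suc i) le = part-univ T' i (part T (suc i)) hyp
          where
          hyp : ∀ {t} → t ∈ₗ T' → col t ≡ σ i → mono (part T' i) (el t) ≡ true → part T (suc i) (proj₁ (pair t)) ≡ part T (suc i) (proj₂ (pair t))
          hyp (here refl) ct mt = mono-option (part T (suc i)) (proj₁ o') (el t₀) (monoi (suc i) le)
          hyp {t} (there j) ct mt = part-in {T} {i} (PP.∈-resp-↭ (↭-sym T↭) (there j)) ct (mono-resp (el t) (bwd i (≤-trans (n≤1+n i) le)) mt)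
        joined : part T' (suc m) (proj₁ (pair t')) ≡ part T' (suc m) (proj₂ (pair t'))
        joined = part-in {T'} {m} (here refl) refl (mono-resp (el t₀) (fwd m ≤-refl) mono-m)

    improve : ∀ T → map el T ↭ els → (∀ {t} → t ∈ₗ T → VertsIn S (el t)) → Spanning T ⊎ Improved T
    improve T els↭ vin = decide (FP.any? λ v → (S v 𝔹.≟ true) ×-dec ¬? (κ v F.≟ κ s₀))
      where
      st = stabilise T
      N = Stable.N st
      κ = part T N
      decide : Dec (∃[ v ] S v ≡ true × κ v ≢ κ s₀) → Spanning T ⊎ Improved T
      decide (yes (v , Sv , ne)) = let c , r = find-redundant T els↭ vin κ (part-Labels T vin N) (levels T N) Sv Ss₀ ne in inj₂ (exchange T els↭ st c r)
      decide (no none) = inj₁ λ c {u} {v} Su Sv → Stable.fixed st c (joins id (pairs (sieve (λ t → col t == c) T)))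
          (λ {t} i ci _ → joins-edge id (∈-map⁺ pair (∈-sieve (λ t → col t == c) i (trans (cong (_== c) ci) (==-refl c))))) u v (trans (same u Su) (sym (same v Sv)))
        where
        same : ∀ v → S v ≡ true → κ v ≡ κ s₀
        same v Sv with κ v F.≟ κ s₀
        ... | yes p = p
        ... | no p = contradiction (v , Sv , p) none

    val : List It → ℕ → ℕ
    val T zero    = μ (part T 0)
    val T (suc i) = val T i * suc M + μ (part T (suc i))

    val-≡ : ∀ T T' j → (∀ i → i ≤ j → μ (part T' i) ≡ μ (part T i)) → val T' j ≡ val T j
    val-≡ T T' zero    e = e 0 ≤-refl
    val-≡ T T' (suc j) e = cong₂ (λ a b → a * suc M + b) (val-≡ T T' j λ i le → e i (≤-trans le (n≤1+n j))) (e (suc j) ≤-refl)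

    val-< : ∀ T T' j → (∀ i → i ≤ j → μ (part T' i) ≡ μ (part T i)) → μ (part T' (suc j)) < μ (part T (suc j)) → ∀ i → val T' (i + suc j) < val T (i + suc j)
    val-< T T' j e lt zero = ≤-trans (≤-reflexive (cong (λ z → suc (z * suc M + μ (part T' (suc j)))) (val-≡ T T' j e))) (+-monoʳ-< (val T j * suc M) lt)
      where open import Data.Nat.Properties using (+-monoʳ-<)
    val-< T T' j e lt (suc i) = ≤-trans (s≤s (+-monoʳ-≤ (val T' (i + suc j) * suc M) (μ≤M _)))
      (≤-trans (≤-reflexive (re (val T' (i + suc j)) M)) (≤-trans (*-monoˡ-≤ (suc M) (val-< T T' j e lt i)) (m≤m+n _ _)))
      where re : ∀ v m → suc (v * suc m + m) ≡ suc v * suc m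
            re = solve-∀

    pack : (∀ {e} → e ∈ₗ els → VertsIn S e) → Σ[ T ∈ List It ] map el T ↭ els × Spanning T
    pack vin = go _ (map (λ e → it e F.zero ab) els) (↭-reflexive (trans (sym (map-∘ els)) (map-id els))) ≤-refl
      where
      open import Data.List.Properties using (map-id)
      L = M * h
      go : ∀ m T → map el T ↭ els → val T L ≤ m → Σ[ T ∈ List It ] map el T ↭ els × Spanning T
      go m T p le with improve T p (λ i → vin (PP.∈-resp-↭ p (∈-map⁺ el i)))
      ... | inj₁ sp = T , p , sp
      ... | inj₂ (T' , j , p' , j<L , e , lt) with subst (λ z → val T' z < val T z) (m∸n+n≡m j<L) (val-< T T' j e lt (L ∸ suc j))
      ...   | less with m
      ...     | zero = contradiction (≤-trans less le) n≮0
      ...     | suc m' = go m' T' p' (≤-pred (≤-trans less le))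

xcut : List (Edge n) → VSet n → Bool
xcut []            X = false
xcut ((u , w) ∷ E) X = (X u xor X w) xor xcut E X

xor-self : ∀ b → b xor b ≡ false
xor-self true  = refl
xor-self false = refl

xor-≡ : ∀ {a b} → a xor b ≡ false → a ≡ b
xor-≡ {true}  {true}  _ = refl
xor-≡ {false} {false} _ = refl

xcut-++ : ∀ (E D : List (Edge n)) X → xcut (E ++ D) X ≡ xcut E X xor xcut D X
xcut-++ [] D X = refl
xcut-++ ((u , w) ∷ E) D X = trans (cong ((X u xor X w) xor_) (xcut-++ E D X)) (sym (𝔹.xor-assoc (X u xor X w) (xcut E X) (xcut D X)))

xcut-↭ : ∀ {E D : List (Edge n)} X → E ↭ D → xcut E X ≡ xcut D X
xcut-↭ X P.refl = refl
xcut-↭ X (P.prep (u , w) p) = cong ((X u xor X w) xor_) (xcut-↭ X p)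
xcut-↭ X (P.swap {xs = E} (u , w) (u' , w') p) = trans (sym (𝔹.xor-assoc (X u xor X w) _ _)) (trans (cong (_xor xcut E X) (𝔹.xor-comm (X u xor X w) (X u' xor X w')))
  (trans (𝔹.xor-assoc (X u' xor X w') _ _) (cong (λ z → (X u' xor X w') xor ((X u xor X w) xor z)) (xcut-↭ X p))))
xcut-↭ X (P.trans p q) = trans (xcut-↭ X p) (xcut-↭ X q)

d-closed : ∀ {X : VSet n} F → d F X ≡ 0 → ∀ {u w} → (u , w) ∈ₗ F → X u ≡ X w
d-closed {X = X} F e {u} {w} i = cross-0 X (n≤0⇒n≡0 (≤-trans (sumOf-∈ (cross X) i) (≤-reflexive e)))

xcut-const : ∀ {X : VSet n} E → (∀ {u w} → (u , w) ∈ₗ E → X u ≡ X w) → xcut E X ≡ false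
xcut-const [] h = refl
xcut-const {X = X} ((u , w) ∷ E) h rewrite h (here refl) | xor-self (X w) = xcut-const E (h ∘ there)

_△_ : VSet n → VSet n → VSet n
(X △ Y) v = X v xor Y v

-- T-joins, with the set T given by the parity of its intersection with each vertex set.
module TJoin {n : ℕ} where
  Linear : (VSet n → Bool) → Set
  Linear θ = (∀ {X Y} → (∀ v → X v ≡ Y v) → θ X ≡ θ Y) × (∀ X Y → θ (X △ Y) ≡ θ X xor θ Y)

  xor-4 : ∀ a b c e → (a xor b) xor (c xor e) ≡ (a xor c) xor (b xor e)
  xor-4 true  true  true  e     = refl
  xor-4 true  true  false true  = refl
  xor-4 true  true  false false = refl
  xor-4 true  false true  true  = refl
  xor-4 true  false true  false = refl
  xor-4 true  false false e     = refl
  xor-4 false true  true  true  = refl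
  xor-4 false true  true  false = refl
  xor-4 false true  false e     = refl
  xor-4 false false c     e     = refl

  xcut-linear : ∀ E → Linear (xcut E)
  xcut-linear [] = (λ _ → refl) , (λ _ _ → refl)
  xcut-linear ((u , w) ∷ E) = (λ e → cong₂ _xor_ (cong₂ _xor_ (e u) (e w)) (proj₁ (xcut-linear E) e)) ,
    λ X Y → trans (cong₂ _xor_ (xor-4 (X u) (Y u) (X w) (Y w)) (proj₂ (xcut-linear E) X Y)) (xor-4 (X u xor X w) _ _ _)

  add : Fin n → Fin n → (VSet n → Bool) → VSet n → Bool
  add x y θ X = (X x xor X y) xor θ X

  add-linear : ∀ x y {θ : VSet n → Bool} → Linear θ → Linear (add x y θ)
  add-linear x y {θ} (e , l) = (λ h → cong₂ _xor_ (cong₂ _xor_ (h x) (h y)) (e h)) ,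
    λ X Y → trans (cong₂ _xor_ (xor-4 (X x) (Y x) (X y) (Y y)) (l X Y)) (xor-4 (X x xor X y) _ _ _)

  tjoin : ∀ F θ → Linear θ → (∀ X → d F X ≡ 0 → θ X ≡ false) → Σ[ J ∈ List (Edge n) ] Σ[ R ∈ List (Edge n) ] F ↭ J ++ R × (∀ X → xcut J X ≡ θ X)
  tjoin [] θ l h = [] , [] , ↭-refl , λ X → sym (h X refl)
  tjoin ((x , y) ∷ F) θ l h with anyVSet (λ X → (d F X ≟ℕ 0) ×-dec (θ X 𝔹.≟ true)) (λ e (p , q) → trans (sym (d-ext F e)) p , trans (sym (proj₁ l e)) q)
    where open import Data.Nat.Properties using () renaming (_≟_ to _≟ℕ_)
  ... | no none with J , R , p , hJ ← tjoin F θ l (λ X c → ¬true λ t → none (X , c , t)) = J , (x , y) ∷ R , ↭-trans (P.prep _ p) (↭-sym (PP.shift _ J R)) , hJ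
  ... | yes (X₀ , c₀ , t₀) = let J , R , p , hJ = tjoin F (add x y θ) (add-linear x y l) even in
      (x , y) ∷ J , R , P.prep _ p , λ X → trans (cong ((X x xor X y) xor_) (hJ X)) (trans (sym (𝔹.xor-assoc (X x xor X y) (X x xor X y) (θ X))) (cong (_xor θ X) (xor-self (X x xor X y))))
    where
    closed : ∀ Z → d F Z ≡ 0 → Z x ≡ Z y → θ Z ≡ false
    closed Z c e = h Z (cong₂ _+_ (cross-≡ Z e) c)
    odd₀ : X₀ x xor X₀ y ≡ true
    odd₀ with bool? (X₀ x xor X₀ y)
    ... | inj₁ t = t
    ... | inj₂ f = ⊥-elim (true≢false t₀ (closed X₀ c₀ (xor-≡ f)))
    d△ : ∀ Z → d F Z ≡ 0 → d F (X₀ △ Z) ≡ 0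
    d△ Z c = sumOf-0 F λ {e} i → cross-≡ (X₀ △ Z) (cong₂ _xor_ (d-closed F c₀ i) (d-closed F c i))
    even : ∀ Z → d F Z ≡ 0 → add x y θ Z ≡ false
    even Z c with bool? (Z x xor Z y)
    ... | inj₂ f = cong₂ _xor_ f (closed Z c (xor-≡ f))
    ... | inj₁ t = trans (cong₂ _xor_ t (sym (xor-≡ (trans (sym (proj₂ l X₀ Z)) (closed (X₀ △ Z) (d△ Z c) (xor-≡ (trans (xor-4 (X₀ x) (Z x) (X₀ y) (Z y)) (cong₂ _xor_ odd₀ t))))))))
      (cong (true xor_) t₀)

pw : List (Fin n) → List (Edge n)
pw []          = []
pw (a ∷ [])    = []
pw (a ∷ b ∷ w) = (a , b) ∷ pw (b ∷ w)

last' : Fin n → List (Fin n) → Fin n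
last' u []       = u
last' u (v ∷ vs) = last' v vs

pw-++ : ∀ (u : Fin n) α β → pw (u ∷ α ++ β) ≡ pw (u ∷ α) ++ pw (last' u α ∷ β)
pw-++ u []      β = refl
pw-++ u (a ∷ α) β = cong ((u , a) ∷_) (pw-++ a α β)

last-++ : ∀ (u : Fin n) α β → last' u (α ++ β) ≡ last' (last' u α) β
last-++ u []      β = refl
last-++ u (a ∷ α) β = last-++ a α β

Spans : VSet n → List (Edge n) → Set
Spans S F = ∀ X → Sep S X → 1 ≤ d F X

InS : VSet n → List (Edge n) → Set
InS S F = ∀ {u w} → (u , w) ∈ₗ F → S u ≡ true × S w ≡ true

module Euler {n} (S : VSet n) (s₀ : Fin n) (Ss₀ : S s₀ ≡ true) where

  infixr 5 _∙_
  infix 4 _⇝_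

  record _⇝_ (E D : List (Edge n)) : Set where
    constructor flips
    field
      imm  : Imm Any-v E D
      same : ∀ X → d E X ≡ d D X
      par  : ∀ X → xcut E X ≡ xcut D X
      inS  : InS S E → InS S D
  open _⇝_

  perm⇝ : ∀ {E D} → E ↭ D → E ⇝ D
  perm⇝ p = flips (perm p) (λ X → d-↭ X p) (λ X → xcut-↭ X p) (λ h i → h (PP.∈-resp-↭ (↭-sym p) i))

  flip⇝ : ∀ {u w E} → ((u , w) ∷ E) ⇝ ((w , u) ∷ E)
  flip⇝ {u} {w} {E} = flips flip (λ X → cong (_+ d E X) (cross-flip X u w)) (λ X → cong (_xor xcut E X) (𝔹.xor-comm (X u) (X w)))
    (λ h → λ { (here refl) → proj₂ (h (here refl)) , proj₁ (h (here refl)) ; (there i) → h (there i) })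

  _∙_ : ∀ {E D F} → E ⇝ D → D ⇝ F → E ⇝ F
  p ∙ q = flips (imm p ⨾ imm q) (λ X → trans (same p X) (same q X)) (λ X → trans (par p X) (par q X)) (inS q ∘ inS p)

  cons⇝ : ∀ {e E D} → E ⇝ D → (e ∷ E) ⇝ (e ∷ D)
  cons⇝ {e} p = flips (consI (imm p)) (λ X → cong (cross X e +_) (same p X)) (λ X → cong ((X (proj₁ e) xor X (proj₂ e)) xor_) (par p X))
    λ h → λ { (here refl) → h (here refl) ; (there i) → inS p (λ j → h (there j)) i }

  prefix⇝ : ∀ C {E D} → E ⇝ D → (C ++ E) ⇝ (C ++ D)
  prefix⇝ []      p = p
  prefix⇝ (e ∷ C) p = cons⇝ (prefix⇝ C p)

  Out : VSet n → List (Edge n) → Set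
  Out X R = Σ[ x ∈ Fin n ] Σ[ y ∈ Fin n ] Σ[ R' ∈ List (Edge n) ] (R ⇝ ((x , y) ∷ R')) × X x ≡ true × X y ≡ false × suc (length R') ≡ length R

  out : ∀ X R → 1 ≤ d R X → Out X R
  out X ((u , w) ∷ R) le = go (bool? (X u)) (bool? (X w))
    where
    skip : X u ≡ X w → Out X ((u , w) ∷ R)
    skip e with x , y , R' , p , q , r , l ← out X R (subst (λ z → 1 ≤ z + d R X) (cross-≡ X e) le) =
      x , y , (u , w) ∷ R' , (cons⇝ p ∙ perm⇝ (P.swap _ _ ↭-refl)) , q , r , cong suc l
    go : (X u ≡ true) ⊎ (X u ≡ false) → (X w ≡ true) ⊎ (X w ≡ false) → Out X ((u , w) ∷ R)
    go (inj₁ a) (inj₂ b) = u , w , R , perm⇝ ↭-refl , a , b , refl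
    go (inj₂ a) (inj₁ b) = w , u , R , flip⇝ , b , a , refl
    go (inj₁ a) (inj₁ b) = skip (trans a (sym b))
    go (inj₂ a) (inj₂ b) = skip (trans a (sym b))

  xor-move : ∀ {a} b {c} → a ≡ b xor c → c ≡ b xor a
  xor-move b {c} refl = trans (cong (_xor c) (sym (xor-self b))) (𝔹.xor-assoc b b c)

  Trail : Fin n → Fin n → List (Edge n) → Set
  Trail x y R = Σ[ vs ∈ List (Fin n) ] Σ[ R' ∈ List (Edge n) ] (R ⇝ (pw (x ∷ vs) ++ R')) × last' x vs ≡ y × (∀ X → xcut R' X ≡ false) × length R' ≤ length R

  trail : ∀ m x y R → length R ≤ m → (∀ X → xcut R X ≡ X x xor X y) → Trail x y R
  trail m x y R le odd with x F.≟ y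
  ... | yes refl = [] , R , perm⇝ ↭-refl , refl , (λ X → trans (odd X) (xor-self (X x))) , ≤-refl
  ... | no ne = go m le (out (sg x) R crosses)
    where
    crosses : 1 ≤ d R (sg x)
    crosses with 1 ≤? d R (sg x)
    ... | yes p = p
    ... | no p = ⊥-elim (true≢false (trans (odd (sg x)) (cong₂ _xor_ (==-refl x) (≢⇒== (ne ∘ sym)))) (xcut-const R (d-closed R (n≤0⇒n≡0 (≤-pred (≰⇒> p))))))
    go : ∀ m → length R ≤ m → Out (sg x) R → Trail x y R
    go zero le (x' , z , R' , p , _ , _ , l) = contradiction (≤-trans (≤-reflexive l) le) λ ()
    go (suc m) le (x' , z , R' , p , xx , _ , l) with refl ← ==⇒≡ {u = x'} {x} xx =
      let vs , R'' , q , e , ev , l' = trail m z y R' (≤-pred (≤-trans (≤-reflexive l) le)) (λ X → trans (xor-move (X x' xor X z) (trans (sym (odd X)) (par p X))) (sol (X x') (X z) (X y)))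
      in z ∷ vs , R'' , (p ∙ cons⇝ q) , e , ev , ≤-trans l' (≤-trans (n≤1+n _) (≤-reflexive l))
      where
      sol : ∀ a b c → (a xor b) xor (a xor c) ≡ b xor c
      sol true  true  c = refl
      sol true  false true = refl
      sol true  false false = refl
      sol false b     c = refl

  pw-∈ : ∀ w {u v : Fin n} → (u , v) ∈ₗ pw w → u ∈ₗ w × v ∈ₗ w
  pw-∈ (a ∷ b ∷ w) (here refl) = here refl , there (here refl)
  pw-∈ (a ∷ b ∷ w) (there i) = let p , q = pw-∈ (b ∷ w) i in there p , there q

  cutAt : ∀ {x : Fin n} u vs → x ∈ₗ u ∷ vs → Σ[ α ∈ List (Fin n) ] Σ[ β ∈ List (Fin n) ] vs ≡ α ++ β × last' u α ≡ x
  cutAt u vs (here refl) = [] , vs , refl , refl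
  cutAt u (v ∷ vs) (there i) = let α , β , e , l = cutAt v vs i in v ∷ α , β , cong (v ∷_) e , l

  Tour : List (Edge n) → Set
  Tour D = Σ[ vs ∈ List (Fin n) ] Σ[ R ∈ List (Edge n) ] Imm Any-v D (pw (s₀ ∷ vs) ++ R) × last' s₀ vs ≡ s₀ × (∀ {v} → S v ≡ true → v ∈ₗ s₀ ∷ vs)

  -- Hierholzer's algorithm.
  euler : ∀ D → Spans S D → (∀ X → xcut D X ≡ false) → Tour D
  euler D sp ev = go (length D) [] D ≤-refl refl (perm⇝ ↭-refl) ev
    where
    go : ∀ m vs R → length R ≤ m → last' s₀ vs ≡ s₀ → D ⇝ (pw (s₀ ∷ vs) ++ R) → (∀ X → xcut R X ≡ false) → Tour D
    go m vs R le la p evR with FP.any? (λ v → (S v 𝔹.≟ true) ×-dec ¬? (v ∈? (s₀ ∷ vs)))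
    ... | no none = vs , R , imm p , la , λ {v} Sv → case v ∈? (s₀ ∷ vs) of λ { (yes i) → i ; (no ni) → contradiction (v , Sv , ni) none }
    ... | yes (v , Sv , ni) = advance m le (out X R crosses)
      where
      X : VSet n
      X v = ⌊ v ∈? (s₀ ∷ vs) ⌋
      X-in : ∀ {v} → v ∈ₗ s₀ ∷ vs → X v ≡ true
      X-in {v} i with v ∈? (s₀ ∷ vs)
      ... | yes _ = refl
      ... | no h = contradiction i h
      X-out : ∀ {v} → ¬ v ∈ₗ s₀ ∷ vs → X v ≡ false
      X-out {v} h with v ∈? (s₀ ∷ vs)
      ... | yes i = contradiction i h
      ... | no _ = refl
      in-X : ∀ {v} → X v ≡ true → v ∈ₗ s₀ ∷ vs
      in-X {v} e with v ∈? (s₀ ∷ vs)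
      ... | yes i = i
      crosses : 1 ≤ d R X
      crosses = subst (1 ≤_) (trans (same p X) (trans (sumOf-++ (cross X) (pw (s₀ ∷ vs)) R) (cong (_+ d R X) (sumOf-0 (pw (s₀ ∷ vs))
        λ i → let a , b = pw-∈ (s₀ ∷ vs) i in cross-≡ X (trans (X-in a) (sym (X-in b)))))))
        (sp X ((s₀ , Ss₀ , X-in (here refl)) , (v , Sv , X-out ni)))
      advance : ∀ m → length R ≤ m → Out X R → Tour D
      advance zero le (x , y , R₁ , q , _ , _ , l) = contradiction (≤-trans (≤-reflexive l) le) λ ()
      advance (suc m) le (x , y , R₁ , q , Xx , _ , l) with α , β , refl , refl ← cutAt s₀ vs (in-X Xx)
                                                    with ws , R₂ , t , lw , ev₂ , l₂ ← trail (length R₁) y x R₁ ≤-refl (λ X → trans (xor-move (X x xor X y) (trans (sym (evR X)) (par q X))) (trans (𝔹.xor-identityʳ (X x xor X y)) (𝔹.xor-comm (X x) (X y)))) =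
        go m (α ++ (y ∷ ws) ++ β) R₂ (≤-pred (≤-trans (s≤s l₂) (≤-trans (≤-reflexive l) le)))
          (trans (last-++ s₀ α ((y ∷ ws) ++ β)) (trans (last-++ y ws β) (trans (cong (λ z → last' z β) lw) (trans (sym (last-++ s₀ α β)) la))))
          (p ∙ prefix⇝ (pw (s₀ ∷ α ++ β)) (q ∙ cons⇝ t) ∙ perm⇝ re) ev₂
        where
        w₁ = pw (s₀ ∷ α)
        w₂ = pw (x ∷ β)
        w₃ = (x , y) ∷ pw (y ∷ ws)
        eq : pw (s₀ ∷ α ++ (y ∷ ws) ++ β) ≡ w₁ ++ w₃ ++ w₂
        eq = trans (pw-++ s₀ α ((y ∷ ws) ++ β)) (cong (λ z → w₁ ++ (x , y) ∷ z) (trans (pw-++ y ws β) (cong (λ z → pw (y ∷ ws) ++ pw (z ∷ β)) lw)))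
        re : pw (s₀ ∷ α ++ β) ++ w₃ ++ R₂ ↭ pw (s₀ ∷ α ++ (y ∷ ws) ++ β) ++ R₂
        re = ↭-trans (↭-reflexive (trans (cong (_++ w₃ ++ R₂) (pw-++ s₀ α β)) (++-assoc w₁ w₂ (w₃ ++ R₂))))
          (↭-trans (PP.++⁺ˡ w₁ (PP.shifts w₂ w₃)) (↭-reflexive (trans (cong (w₁ ++_) (sym (++-assoc w₃ w₂ R₂))) (trans (sym (++-assoc w₁ (w₃ ++ w₂) R₂)) (cong (_++ R₂) (sym eq))))))

  closed-walk : ∀ {s₁} → S s₁ ≡ true → s₁ ≢ s₀ → ∀ F₁ F₂ → Spans S F₁ → Spans S F₂ → InS S F₁ →
    Σ[ m ∈ List (Fin n) ] Imm Any-v (F₁ ++ F₂) (pw (s₀ ∷ m ++ s₀ ∷ [])) × (∀ {v} → S v ≡ true → v ≢ s₀ → v ∈ₗ m)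
  closed-walk {s₁} S₁ ne F₁ F₂ sp₁ sp₂ in₁ with TJoin.tjoin F₂ (xcut F₁) (TJoin.xcut-linear F₁) closed
    where
    closed : ∀ X → d F₂ X ≡ 0 → xcut F₁ X ≡ false
    closed X e = xcut-const F₁ λ {u} {w} i → const u w (proj₁ (in₁ i)) (proj₂ (in₁ i))
      where
      const : ∀ u w → S u ≡ true → S w ≡ true → X u ≡ X w
      const u w a b with bool? (X u) | bool? (X w)
      ... | inj₁ p | inj₁ q = trans p (sym q)
      ... | inj₂ p | inj₂ q = trans p (sym q)
      ... | inj₁ p | inj₂ q = contradiction (sp₂ X ((u , a , p) , (w , b , q))) (<⇒≱ (s≤s (≤-reflexive e)))
      ... | inj₂ p | inj₁ q = contradiction (sp₂ X ((w , b , q) , (u , a , p))) (<⇒≱ (s≤s (≤-reflexive e)))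
  ... | J , R , p , hJ with euler (F₁ ++ J) (λ X s → ≤-trans (sp₁ X s) (≤-trans (m≤m+n _ _) (≤-reflexive (sym (sumOf-++ (cross X) F₁ J)))))
          (λ X → trans (xcut-++ F₁ J X) (trans (cong (xcut F₁ X xor_) (hJ X)) (xor-self (xcut F₁ X))))
  ...   | vs , R' , i , la , all with snoc vs la
    where
    snoc : ∀ vs → last' s₀ vs ≡ s₀ → (vs ≡ []) ⊎ (Σ[ m ∈ List (Fin n) ] vs ≡ m ++ s₀ ∷ [])
    snoc [] e = inj₁ refl
    snoc (v ∷ vs) e = inj₂ (lem v vs e)
      where lem : ∀ v vs → last' v vs ≡ s₀ → Σ[ m ∈ List (Fin n) ] v ∷ vs ≡ m ++ s₀ ∷ []
            lem v [] refl = [] , refl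
            lem v (w ∷ vs) e = let m , q = lem w vs e in v ∷ m , cong (v ∷_) q
  ...     | inj₁ refl = contradiction (only (all S₁)) ne
    where only : s₁ ∈ₗ s₀ ∷ [] → s₁ ≡ s₀
          only (here e) = e
  ...     | inj₂ (m , refl) = m , (perm (PP.++⁺ˡ F₁ p) ⨾ ≡I (sym (++-assoc F₁ J R)) ⨾ perm (PP.++-comm (F₁ ++ J) R) ⨾ dropI R ⨾ i ⨾ perm (PP.++-comm _ R') ⨾ dropI R') ,
      λ {v} Sv ne → [ id , (λ { (here e) → contradiction e ne }) ]′ (∈-++⁻ m (other (all Sv) ne))
    where other : ∀ {v} → v ∈ₗ s₀ ∷ m ++ s₀ ∷ [] → v ≢ s₀ → v ∈ₗ m ++ s₀ ∷ []
          other (here e) ne = contradiction e ne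
          other (there i) _ = i

-- Erdős–Szekeres.
module Monotone {A : Set} (p : A → ℕ) where
  Inc Dec' : List A → Set
  Inc  = AllPairs λ x y → p x < p y
  Dec' = AllPairs λ x y → p y < p x

  Sub : List A → List A → Set
  Sub = Sublist._⊆_

  above below : A → List A → List A
  above x = sieve (λ y → ⌊ p x <? p y ⌋)
  below x = sieve (λ y → ⌊ p y <? p x ⌋)

  sieve-⊆ : (q : A → Bool) → ∀ xs → Sub (sieve q xs) xs
  sieve-⊆ q [] = Sublist.[]
  sieve-⊆ q (x ∷ xs) with q x
  ... | true  = refl Sublist.∷ sieve-⊆ q xs
  ... | false = x Sublist.∷ʳ sieve-⊆ q xs

  ⌊⌋-true : ∀ {P : Set} {D : Dec P} → ⌊ D ⌋ ≡ true → P
  ⌊⌋-true {D = yes q} _ = q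

  halves : ∀ x xs → (∀ {y} → y ∈ₗ xs → p y ≢ p x) → length xs ≤ length (above x xs) + length (below x xs)
  halves x [] h = z≤n
  halves x (y ∷ xs) h with p x <? p y | p y <? p x
  ... | yes _ | yes _ = s≤s (≤-trans (halves x xs (h ∘ there)) (+-monoʳ-≤ (length (above x xs)) (n≤1+n _)))
  ... | yes _ | no _ = s≤s (halves x xs (h ∘ there))
  ... | no _ | yes _ = ≤-trans (s≤s (halves x xs (h ∘ there))) (≤-reflexive (sym (+-suc (length (above x xs)) _)))
  ... | no a | no b = contradiction (≤-antisym (≮⇒≥ a) (≮⇒≥ b)) (h (here refl))

  Result : ℕ → ℕ → List A → Set
  Result a b xs = Σ[ ys ∈ List A ] Sub ys xs × ((length ys ≡ a × Inc ys) ⊎ (length ys ≡ b × Dec' ys))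

  subPairs : ∀ {R : A → A → Set} {xs ys} → Sub ys xs → AllPairs R xs → AllPairs R ys
  subPairs Sublist.[] [] = []
  subPairs (y Sublist.∷ʳ s) (_ ∷ r) = subPairs s r
  subPairs (refl Sublist.∷ s) (a ∷ r) = All.tabulate (λ i → All.lookup a (Sublist.lookup s i)) ∷ subPairs s r

  es : ∀ a b xs → AllPairs (λ x y → p x ≢ p y) xs → 2 ^ (a + b) ≤ length xs → Result a b xs
  es zero    b       xs un le = [] , Sublist.minimum xs , inj₁ (refl , [])
  es (suc a) zero    xs un le = [] , Sublist.minimum xs , inj₂ (refl , [])
  es (suc a) (suc b) []       un le = contradiction (≤-trans (m^n>0 2 (suc a + suc b)) le) λ ()
    where open import Data.Nat.Properties using (m^n>0)
  es (suc a) (suc b) (x ∷ xs) (nx ∷ un) le with 2 ^ (a + suc b) ≤? length (above x xs) | 2 ^ (suc a + b) ≤? length (below x xs)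
  ... | yes h | _ with es a (suc b) (above x xs) (subPairs (sieve-⊆ _ xs) un) h
  ...   | ys , s , inj₂ r = ys , x Sublist.∷ʳ Sublist.⊆-trans s (sieve-⊆ _ xs) , inj₂ r
  ...   | ys , s , inj₁ (e , inc) = x ∷ ys , refl Sublist.∷ Sublist.⊆-trans s (sieve-⊆ _ xs) , inj₁ (cong suc e , All.tabulate (λ i → ⌊⌋-true (proj₂ (sieve-∈ _ xs (Sublist.lookup s i)))) ∷ inc)
  es (suc a) (suc b) (x ∷ xs) (nx ∷ un) le | no _ | yes h with es (suc a) b (below x xs) (subPairs (sieve-⊆ _ xs) un) h
  ...   | ys , s , inj₁ r = ys , x Sublist.∷ʳ Sublist.⊆-trans s (sieve-⊆ _ xs) , inj₁ r
  ...   | ys , s , inj₂ (e , dec) = x ∷ ys , refl Sublist.∷ Sublist.⊆-trans s (sieve-⊆ _ xs) , inj₂ (cong suc e , All.tabulate (λ i → ⌊⌋-true (proj₂ (sieve-∈ _ xs (Sublist.lookup s i)))) ∷ dec)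
  es (suc a) (suc b) (x ∷ xs) (nx ∷ un) le | no h | no h' = ⊥-elim (lin⊥ 0 (+-mono-≤ (≰⇒> h) (+-mono-≤ (≰⇒> h') (+-mono-≤ (halves x xs λ i e → All.lookup nx i (sym e)) le)))
      (trans (cong (λ z → suc (length (above x xs)) + (suc (length (below x xs)) + (length xs + (2 ^ (a + suc b) + (z + 0))))) (cong (2 ^_) (+-suc a b))) (re (length (above x xs)) (length (below x xs)) (length xs) (2 ^ (a + suc b)) (2 ^ (suc a + b)))))
    where
    re : ∀ u v l P Q → suc u + (suc v + (l + (P + (Q + 0)))) ≡ suc (P + (Q + ((u + v) + suc l)) + 0)
    re = solve-∀

tower : ℕ → ℕ → ℕ
tower zero    r = r
tower (suc t) r = 2 ^ (tower t r + tower t r)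

module Words {n : ℕ} where
  Sub : List (Fin n) → List (Fin n) → Set
  Sub = Sublist._⊆_

  idx : List (Fin n) → Fin n → ℕ
  idx []      x = 0
  idx (y ∷ m) x = if x == y then 0 else suc (idx m x)

  idx-inj : ∀ m {x y} → x ∈ₗ m → y ∈ₗ m → idx m x ≡ idx m y → x ≡ y
  idx-inj (z ∷ m) {x} {y} i j e with x F.≟ z | y F.≟ z
  ... | yes p | yes q = trans p (sym q)
  idx-inj (z ∷ m) (here p) j e | no a | _ = contradiction p a
  idx-inj (z ∷ m) i (here q) e | _ | no b = contradiction q b
  idx-inj (z ∷ m) (there i) (there j) e | no _ | no _ = idx-inj m i j (suc-injective e)
  idx-inj (z ∷ m) i j () | yes p | no b
  idx-inj (z ∷ m) i j () | no a | yes q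

  inc-sub : ∀ m L → AllPairs (λ x y → idx m x < idx m y) L → (∀ {x} → x ∈ₗ L → x ∈ₗ m) → Sub L m
  inc-sub m [] inc h = Sublist.minimum m
  inc-sub [] (x ∷ L) inc h = case h (here refl) of λ ()
  inc-sub (z ∷ m) (x ∷ L) (a ∷ inc) h = go (x F.≟ z)
    where
    strip : ∀ {y} → y ≢ z → y ∈ₗ z ∷ m → y ∈ₗ m
    strip ne (here e) = contradiction e ne
    strip ne (there i) = i
    ne-tail : ∀ {y} → y ∈ₗ L → y ≢ z
    ne-tail {y} i refl = contradiction (≤-trans (All.lookup a i) (≤-reflexive (cong (λ b → if b then 0 else suc (idx m y)) (==-refl y)))) n≮0
    down : ∀ L → (∀ {y} → y ∈ₗ L → y ≢ z) → AllPairs (λ u v → idx (z ∷ m) u < idx (z ∷ m) v) L → AllPairs (λ u v → idx m u < idx m v) L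
    down [] _ [] = []
    down (u ∷ L) ne (b ∷ r) = All.tabulate (λ {v} i → lem u v (ne (here refl)) (ne (there i)) (All.lookup b i)) ∷ down L (ne ∘ there) r
      where lem : ∀ u v → u ≢ z → v ≢ z → idx (z ∷ m) u < idx (z ∷ m) v → idx m u < idx m v
            lem u v p q lt rewrite ≢⇒== p | ≢⇒== q = ≤-pred lt
    go : Dec (x ≡ z) → Sub (x ∷ L) (z ∷ m)
    go (yes refl) = refl Sublist.∷ inc-sub m L (down L ne-tail inc) (λ i → strip (ne-tail i) (h (there i)))
    go (no xz) = z Sublist.∷ʳ inc-sub m (x ∷ L) (down (x ∷ L) ne (a ∷ inc)) (λ i → strip (ne i) (h i))
      where
      ne : ∀ {y} → y ∈ₗ x ∷ L → y ≢ z
      ne (here refl) = xz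
      ne (there i)   = ne-tail i

  rev-pairs : ∀ {R : Fin n → Fin n → Set} xs → AllPairs (λ x y → R y x) xs → AllPairs R (reverse xs)
  rev-pairs [] [] = []
  rev-pairs {R} (x ∷ xs) (a ∷ r) = subst (AllPairs R) (sym (unfold-reverse x xs)) (AllPairsP.++⁺ (rev-pairs xs r) ([] ∷ [])
    (All.tabulate λ {y} i → All.lookup a (PP.∈-resp-↭ (PP.↭-reverse xs) i) ∷ []))

  order : ∀ a L m → Unique L → (∀ {x} → x ∈ₗ L → x ∈ₗ m) → 2 ^ (a + a) ≤ length L → Σ[ L' ∈ List (Fin n) ] Sub L' L × length L' ≡ a × (Sub L' m ⊎ Sub L' (reverse m))
  order a L m un h le with Monotone.es (idx m) a a L (distinct L un h) le
    where
    distinct : ∀ L → Unique L → (∀ {x} → x ∈ₗ L → x ∈ₗ m) → AllPairs (λ x y → idx m x ≢ idx m y) L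
    distinct [] [] h = []
    distinct (x ∷ L) (a ∷ un) h = All.tabulate (λ i e → All.lookup a i (idx-inj m (h (here refl)) (h (there i)) e)) ∷ distinct L un (h ∘ there)
  ... | L' , s , inj₁ (e , inc) = L' , s , e , inj₁ (inc-sub m L' inc (h ∘ Sublist.lookup s))
  ... | L' , s , inj₂ (e , dec) = L' , s , e , inj₂ (subst (λ z → Sub z (reverse m)) (reverse-involutive L')
        (SublistP.reverse⁺ (inc-sub m (reverse L') (rev-pairs L' dec) (λ i → h (Sublist.lookup s (PP.∈-resp-↭ (PP.↭-reverse L') i))))))

  cyc : List (Fin n) → List (Edge n)
  cyc []      = []
  cyc (l ∷ L) = pw (l ∷ L ++ l ∷ [])

  word : Fin n → List (Fin n) → List (Edge n)
  word s m = pw (s ∷ m ++ s ∷ [])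

  thin : ∀ u e {L m} → Sub L m → Imm Any-v (pw (u ∷ m ++ e ∷ [])) (pw (u ∷ L ++ e ∷ []))
  thin u e Sublist.[] = idI
  thin u e (refl Sublist.∷ s) = consI (thin _ e s)
  thin u e {L} (y Sublist.∷ʳ s) = consI (thin y e s) ⨾ short L
    where short : ∀ L → Imm Any-v ((u , y) ∷ pw (y ∷ L ++ e ∷ [])) (pw (u ∷ L ++ e ∷ []))
          short []      = split tt
          short (l ∷ L) = split tt

  pw-snoc : ∀ xs (b a : Fin n) → pw ((xs ++ b ∷ []) ++ a ∷ []) ≡ pw (xs ++ b ∷ []) ++ (b , a) ∷ []
  pw-snoc []           b a = refl
  pw-snoc (x ∷ [])     b a = refl
  pw-snoc (x ∷ y ∷ xs) b a = cong ((x , y) ∷_) (pw-snoc (y ∷ xs) b a)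

  pw-reverse : ∀ w → Imm Any-v (pw w) (pw (reverse w))
  pw-reverse []      = idI
  pw-reverse (a ∷ []) = idI
  pw-reverse (a ∷ b ∷ w) = consI (pw-reverse (b ∷ w)) ⨾ flip ⨾ perm (PP.++-comm ((b , a) ∷ []) (pw (reverse (b ∷ w)))) ⨾
    ≡I (trans (cong (λ z → pw z ++ (b , a) ∷ []) (unfold-reverse b w)) (trans (sym (pw-snoc (reverse w) b a))
      (cong pw (trans (cong (_++ a ∷ []) (sym (unfold-reverse b w))) (sym (unfold-reverse a (b ∷ w)))))))

  word-reverse : ∀ s m → Imm Any-v (word s m) (word s (reverse m))
  word-reverse s m = pw-reverse (s ∷ m ++ s ∷ []) ⨾ ≡I (cong pw (trans (unfold-reverse s (m ++ s ∷ [])) (cong (_++ s ∷ []) (reverse-++ m (s ∷ [])))))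

  word-cyc : ∀ s L → Imm Any-v (word s L) (cyc L)
  word-cyc s []      = dropI (word s []) ⨾ idI
  word-cyc s (l ∷ L) = perm (PP.++-comm ((s , l) ∷ []) (pw (l ∷ L ++ s ∷ []))) ⨾ ≡I (sym (pw-snoc (l ∷ L) s l)) ⨾ thin l l (SublistP.++⁺ʳ (s ∷ []) Sublist.⊆-refl)

  common : ∀ s r ms L → Unique L → (∀ {m} → m ∈ₗ ms → ∀ {x} → x ∈ₗ L → x ∈ₗ m) → tower (length ms) r ≤ length L →
    Σ[ L' ∈ List (Fin n) ] Sub L' L × length L' ≡ r × Imm Any-v (concat (map (word s) ms)) (concat (map (λ _ → cyc L') ms))
  common s r [] L un h le = take r L , SublistP.take-⊆ r L , trans (length-take r L) (m≤n⇒m⊓n≡m le) , idI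
    where open import Data.Nat.Properties using (m≤n⇒m⊓n≡m)
  common s r (m ∷ ms) L un h le with order (tower (length ms) r) L m un (h (here refl)) le
  ... | L₁ , s₁ , e₁ , sub with common s r ms L₁ (Monotone.subPairs {A = Fin n} (λ _ → 0) s₁ un) (λ i j → h (there i) (Sublist.lookup s₁ j)) (≤-reflexive (sym e₁))
  ...   | L' , s' , e , i = L' , Sublist.⊆-trans s' s₁ , e , (one sub ⊕ i)
    where
    one : Sub L₁ m ⊎ Sub L₁ (reverse m) → Imm Any-v (word s m) (cyc L')
    one (inj₁ q) = thin s s (Sublist.⊆-trans s' q) ⨾ word-cyc s L'
    one (inj₂ q) = word-reverse s m ⨾ thin s s (Sublist.⊆-trans s' q) ⨾ word-cyc s L'

flat-↭ : ∀ {L M : List (El n)} → L ↭ M → flat L ↭ flat M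
flat-↭ P.refl = ↭-refl
flat-↭ {n} (P.prep e p) = ↭-trans (↭-reflexive (flat-++ (e ∷ []) _)) (↭-trans (PP.++⁺ˡ (flat (e ∷ [])) (flat-↭ p)) (↭-reflexive (sym (flat-++ (e ∷ []) _))))
flat-↭ (P.swap {xs = L} {M} e f p) = ↭-trans (↭-reflexive (trans (flat-++ (e ∷ []) (f ∷ L)) (cong (flat (e ∷ []) ++_) (flat-++ (f ∷ []) L))))
  (↭-trans (PP.shifts (flat (e ∷ [])) (flat (f ∷ []))) (↭-trans (PP.++⁺ˡ (flat (f ∷ [])) (PP.++⁺ˡ (flat (e ∷ [])) (flat-↭ p)))
    (↭-reflexive (sym (trans (flat-++ (f ∷ []) (e ∷ M)) (cong (flat (f ∷ []) ++_) (flat-++ (e ∷ []) M)))))))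
flat-↭ (P.trans p q) = ↭-trans (flat-↭ p) (flat-↭ q)

-- An immersion of C_{t,r}: t closed walks running through the r terminals in the same cyclic order.
record Target {n} (t r : ℕ) (S : VSet n) (E : List (Edge n)) : Set where
  field
    L      : List (Fin n)
    lengthL : length L ≡ r
    unique : Unique L
    termL  : ∀ {v} → v ∈ₗ L → S v ≡ true
    imm    : Imm Any-v E (concat (replicate t (Words.cyc L)))

module StarCase {n} (t' r : ℕ) (1≤r : 1 ≤ r) {k} (S : VSet n) (2≤k : 2 ≤ k) (3h≤k : 3 * (suc t' + suc t') ≤ k) where
  t h' : ℕ
  t  = suc t'
  h' = t' + suc t'

  good-verts : ∀ e → GoodEl S e → VertsIn S e
  good-verts (pr u w) (a , b , _) = a , b , b
  good-verts (tr y u v w) (_ , a , b , c , _) = a , b , c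

  module Coloured (s₀ : Fin n) (Ss₀ : S s₀ ≡ true) (big : suc (tower t r) ≤ size S) (els : List (El n)) (good : ∀ {e} → e ∈ₗ els → GoodEl S e)
                  (τ : List (Packing.It h' S s₀ Ss₀)) (τ↭ : map Packing.It.el τ ↭ els)
                  (spanning : ∀ c {u v} → S u ≡ true → S v ≡ true → joins id (map Packing.It.pair (sieve (λ x → Packing.It.col x == c) τ)) u
                                                                  ≡ joins id (map Packing.It.pair (sieve (λ x → Packing.It.col x == c) τ)) v) where
    open Packing h' S s₀ Ss₀
    private
      good-τ : ∀ {x} → x ∈ₗ τ → GoodEl S (el x)
      good-τ i = good (PP.∈-resp-↭ τ↭ (∈-map⁺ el i))

      chosen : ∀ τ → (∀ {x} → x ∈ₗ τ → GoodEl S (el x)) → Imm Any-v (flat (map el τ)) (nl (pairs τ))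
      chosen [] g = idI
      chosen (it (pr u w) c ab ∷ τ) g rewrite ≢⇒== (proj₂ (proj₂ (g (here refl)))) = consI (chosen τ (g ∘ there))
      chosen (it (pr u w) c bc ∷ τ) g rewrite ==-refl w = del ⨾ chosen τ (g ∘ there)
      chosen (it (tr y u v w) c ab ∷ τ) g with _ , _ , _ , _ , uv , _ , _ ← g (here refl) rewrite ≢⇒== uv = flip ⨾ split tt ⨾ consI (del ⨾ chosen τ (g ∘ there))
      chosen (it (tr y u v w) c bc ∷ τ) g with _ , _ , _ , _ , _ , _ , vw ← g (here refl) rewrite ≢⇒== vw = del ⨾ flip ⨾ split tt ⨾ consI (chosen τ (g ∘ there))

      F : List It → Fin h → List (Edge n)
      F τ c = nl (pairs (sieve (λ x → col x == c) τ))

      nl-++ : (A B : List (Edge n)) → nl (A ++ B) ≡ nl A ++ nl B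
      nl-++ [] B = refl
      nl-++ (e ∷ A) B with nonloop e
      ... | true  = cong (e ∷_) (nl-++ A B)
      ... | false = nl-++ A B

      group : ∀ cs → Unique cs → ∀ τ → Imm Any-v (nl (pairs τ)) (concat (map (F τ) cs))
      group [] [] τ = clearI (nl (pairs τ))
      group (c ∷ cs) (nc ∷ un) τ = perm (sieve-↭ nonloop (PP.map⁺ pair (sieve-halves p τ))) ⨾ ≡I (trans (cong nl (map-++ pair (sieve p τ) τ')) (nl-++ (pairs (sieve p τ)) (pairs τ')))
          ⨾ prefixI (F τ c) (group cs un τ' ⨾ ≡I (cong concat (same cs nc)))
        where
        p = λ x → col x == c
        τ' = sieve (not ∘ p) τ
        again : ∀ c' → c ≢ c' → ∀ τ → sieve (λ x → col x == c') (sieve (not ∘ p) τ) ≡ sieve (λ x → col x == c') τ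
        again c' ne [] = refl
        again c' ne (x ∷ τ) with col x F.≟ c
        ... | yes refl rewrite ≢⇒== ne = again c' ne τ
        ... | no _ with col x == c'
        ...   | true  = cong (x ∷_) (again c' ne τ)
        ...   | false = again c' ne τ
        same : ∀ cs → All (c ≢_) cs → map (F τ') cs ≡ map (F τ) cs
        same [] [] = refl
        same (c' ∷ cs) (ne ∷ a) = cong₂ _∷_ (cong (nl ∘ pairs) (again c' ne τ)) (same cs a)

      Good : List (Edge n) → Set
      Good L = Spans S L × InS S L

      good-F : ∀ c → Good (F τ c)
      good-F c = span , inS
        where
        τ' = sieve (λ x → col x == c) τ
        inS : InS S (F τ c)
        inS i with x , j , refl ← ∈-map⁻ pair (proj₁ (sieve-∈ nonloop (pairs τ') i)) = option-in {S = S} (opt x) (el x) (good-verts (el x) (good-τ (proj₁ (sieve-∈ _ τ j))))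
        span : Spans S (F τ c)
        span X ((u , Su , Xu) , (w , Sw , Xw)) with 1 ≤? d (F τ c) X
        ... | yes q = q
        ... | no q = ⊥-elim (true≢false Xu (trans (cong X (trans (sym fu) (trans same fw))) Xw))
          where
          e0 : d (pairs τ') X ≡ 0
          e0 = trans (sym (d-nl (pairs τ') X)) (n≤0⇒n≡0 (≤-pred (≰⇒> q)))
          f : Fin n → Fin n
          f v = if X v then u else w
          fu : f u ≡ u
          fu = cong (λ b → if b then u else w) Xu
          fw : f w ≡ w
          fw = cong (λ b → if b then u else w) Xw
          same : f u ≡ f w
          same = joins-univ id f (pairs τ') (λ a b e → cong f e) (λ i → cong (λ b → if b then u else w) (d-closed (pairs τ') e0 i)) u w (spanning c Su Sw)

      L₀ : List (Fin n)
      L₀ = sieve (λ v → S v ∧ not (v == s₀)) (allFin n)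

      L₀∈ : ∀ {v} → v ∈ₗ L₀ → S v ≡ true × v ≢ s₀
      L₀∈ {v} i with _ , e ← sieve-∈ (λ v → S v ∧ not (v == s₀)) (allFin n) i = proj₁ (∧-elim e) , λ { refl → true≢false (==-refl v) (not-f (proj₂ (∧-elim {S v} e))) }

      L₀-big : tower t r ≤ length L₀
      L₀-big = ≤-pred (≤-trans big (≤-trans (sumOf-≤ (allFin n) λ {v} _ → pt v (S v) (v == s₀))
        (≤-reflexive (trans (sumOf-+ (λ v → b2n (v == s₀) * 1) _ (allFin n)) (cong₂ _+_ (sum-at (λ _ → 1) s₀) (sym (sieve-length (λ v → S v ∧ not (v == s₀)) (allFin n))))))))
        where
        pt : ∀ (v : Fin n) a b → b2n a ≤ b2n b * 1 + b2n (a ∧ not b)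
        pt v true  true  = ≤-refl
        pt v true  false = ≤-refl
        pt v false b     = z≤n

      L₀-unique : Unique L₀
      L₀-unique = Monotone.subPairs {A = Fin n} (λ _ → 0) (Monotone.sieve-⊆ {A = Fin n} (λ _ → 0) _ (allFin n)) (allFin⁺ n)

      second : Σ[ s₁ ∈ Fin n ] S s₁ ≡ true × s₁ ≢ s₀
      second with L₀ in eq
      ... | [] = contradiction (≤-trans (tower≥1 t) (≤-trans L₀-big (≤-reflexive (cong length eq)))) λ ()
        where tower≥1 : ∀ t → 1 ≤ tower t r
              tower≥1 zero    = 1≤r
              tower≥1 (suc t) = m^n>0 2 (tower t r + tower t r)
                where open import Data.Nat.Properties using (m^n>0)
      ... | s₁ ∷ _ = s₁ , L₀∈ (subst (s₁ ∈ₗ_) (sym eq) (here refl))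

      walks : ∀ t Ls → length Ls ≡ t + t → (∀ {L} → L ∈ₗ Ls → Good L) →
        Σ[ ms ∈ List (List (Fin n)) ] length ms ≡ t × Imm Any-v (concat Ls) (concat (map (Words.word s₀) ms)) × (∀ {m} → m ∈ₗ ms → ∀ {v} → S v ≡ true → v ≢ s₀ → v ∈ₗ m)
      walks zero [] e g = [] , refl , idI , λ ()
      walks (suc t) (F₁ ∷ []) e g = contradiction (suc-injective e) (λ q → case trans q (+-suc t t) of λ ())
      walks (suc t) (F₁ ∷ F₂ ∷ Ls) e g =
        let m , i , cov = Euler.closed-walk S s₀ Ss₀ (proj₁ (proj₂ second)) (proj₂ (proj₂ second)) F₁ F₂ (proj₁ (g (here refl))) (proj₁ (g (there (here refl)))) (proj₂ (g (here refl)))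
            ms , l , j , covs = walks t Ls (suc-injective (trans (suc-injective e) (+-suc t t))) (λ k → g (there (there k)))
        in m ∷ ms , cong suc l , (≡I (sym (++-assoc F₁ F₂ (concat Ls))) ⨾ (i ⊕ j)) , λ { (here refl) → cov ; (there k) → covs k }

      tours = walks t (map (F τ) (allFin h)) (trans (length-map (F τ) (allFin h)) (length-tabulate {n = h} id)) (λ i → let c , _ , e = ∈-map⁻ (F τ) i in subst Good (sym e) (good-F c))
        where open import Data.List.Properties using (length-tabulate)

    target : ∀ {E} → Imm (λ v → S v ≡ false) (nl E) (flat els) → Target t r S E
    target {E} imm with ms , lms , i , cov ← tours with L , sub , len , j ← Words.common s₀ r ms L₀ L₀-unique (λ i j → cov i (proj₁ (L₀∈ j)) (proj₂ (L₀∈ j))) (subst (λ z → tower z r ≤ length L₀) (sym lms) L₀-big) = record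
      { L = L ; lengthL = len ; unique = Monotone.subPairs {A = Fin n} (λ _ → 0) sub L₀-unique ; termL = λ k → proj₁ (L₀∈ (Sublist.lookup sub k))
      ; imm = filterI nonloop E ⨾ weaken (λ _ _ → tt) imm ⨾ perm (flat-↭ (↭-sym τ↭)) ⨾ chosen τ good-τ ⨾ group (allFin h) (allFin⁺ h) τ ⨾ i ⨾ j ⨾ ≡I (cong concat (const-map ms lms)) }
      where
      const-map : ∀ {X : Set} {x : X} {m} (ms : List (List (Fin n))) → length ms ≡ m → map (λ _ → x) ms ≡ replicate m x
      const-map [] refl = refl
      const-map (_ ∷ ms) refl = cong (_ ∷_) (const-map ms refl)

  star-target : (E : List (Edge n)) → Conn k S E → Indep S E → suc (tower t r) ≤ size S → Target t r S E
  star-target E c ind big = finish some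
    where
    some : Σ[ s ∈ Fin n ] s ∈ₗ allFin n × S s ≡ true
    some with findᵇ S (allFin n)
    ... | inj₁ x = x
    ... | inj₂ none = contradiction (≤-trans big (≤-reflexive (sumOf-0 (allFin n) λ i → cong b2n (none i)))) λ ()
    nonloops : Conn k S (nl E)
    nonloops X s = ≤-trans (c X s) (≤-reflexive (sym (d-nl E X)))
    finish : Σ[ s ∈ Fin n ] s ∈ₗ allFin n × S s ≡ true → Target t r S E
    finish (s₀ , _ , Ss₀) = coloured (Engine.engine k 2≤k S (nl E) (nl-NonLoop E) (λ i ne → ind (proj₁ (sieve-∈ nonloop E i)) ne) nonloops)
      where
      coloured : Engine.Els k 2≤k S (nl E) → Target t r S E
      coloured record { els = els ; imm = imm ; good = good ; cut = cut } = let τ , τ↭ , sp = Packing.pack h' S s₀ Ss₀ {k} 3h≤k els cut (λ {e} i → good-verts e (good i)) in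
        Coloured.target s₀ Ss₀ big els good τ τ↭ sp imm

-- How a strand crosses a region with terminal s: without meeting it, through s, or through a vertex y joined to s.
data Kind (n : ℕ) : Set where
  thru dir : Kind n
  tri      : Fin n → Kind n

touches : Kind n → Bool
touches thru    = false
touches dir     = true
touches (tri _) = true

pieces : Fin n → List (Fin n) → List (Kind n) → List (Edge n)
pieces s []       ks           = []
pieces s (x ∷ xs) []           = []
pieces s (x ∷ xs) (thru ∷ ks)  = pieces s xs ks
pieces s (x ∷ xs) (dir ∷ ks)   = (x , s) ∷ pieces s xs ks
pieces s (x ∷ xs) (tri y ∷ ks) = (x , y) ∷ (y , s) ∷ pieces s xs ks

next : Fin n → Fin n → Kind n → Fin n
next s x thru    = x
next s x dir     = s
next s x (tri y) = y

nexts : Fin n → List (Fin n) → List (Kind n) → List (Fin n)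
nexts s []       ks       = []
nexts s (x ∷ xs) []       = x ∷ xs
nexts s (x ∷ xs) (κ ∷ ks) = next s x κ ∷ nexts s xs ks

Region : ℕ → Set
Region n = Fin n × List (Kind n)

diagram : List (Region n) → List (Fin n) → List (Edge n)
diagram []              xs = []
diagram ((s , ks) ∷ rs) xs = pieces s xs ks ++ diagram rs (nexts s xs ks)

data Link {n} : List (Fin n) → List (Fin n) → List (Edge n) → Set where
  []   : Link [] [] []
  same : ∀ {x xs ys D} → Link xs ys D → Link (x ∷ xs) (x ∷ ys) D
  edge : ∀ {x y xs ys D} → Link xs ys D → Link (x ∷ xs) (y ∷ ys) ((x , y) ∷ D)

infixr 5 _⋆_
_⋆_ : ∀ {e f g} {D D' F : List (Edge n)} → Imm Any-v (e ∷ f ∷ []) (g ∷ []) → Imm Any-v (D ++ D') F → Imm Any-v ((e ∷ D) ++ (f ∷ D')) (g ∷ F)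
_⋆_ {e = e} {f} {D = D} {D'} i j = perm (P.prep e (PP.shift f D D')) ⨾ suffixI {H = D ++ D'} i ⨾ consI j

link-region : ∀ s {xs ys D} → Link {n} xs ys D → ∀ ks → Σ[ D' ∈ List (Edge n) ] Link (nexts s xs ks) (nexts s ys ks) D' × Imm Any-v (D ++ pieces s ys ks) (pieces s xs ks ++ D')
link-region s [] ks = [] , [] , idI
link-region s {D = D} (same l) [] = D , same l , ≡I (++-identityʳ D)
link-region s {D = (x , y) ∷ D} (edge l) [] = (x , y) ∷ D , edge l , ≡I (++-identityʳ _)
link-region s (same l) (thru ∷ ks) = let D' , l' , i = link-region s l ks in D' , same l' , i
link-region s {D = D} (same {x = x} {xs} {ys} l) (dir ∷ ks) = let D' , l' , i = link-region s l ks in D' , same l' , perm (PP.shift (x , s) D (pieces s ys ks)) ⨾ consI i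
link-region s {D = D} (same {x = x} {xs} {ys} l) (tri y ∷ ks) = let D' , l' , i = link-region s l ks in
  D' , same l' , perm (PP.shifts D ((x , y) ∷ (y , s) ∷ [])) ⨾ consI (consI i)
link-region s {D = _ ∷ D} (edge {x} {y} {xs} {ys} l) (thru ∷ ks) = let D' , l' , i = link-region s l ks in
  (x , y) ∷ D' , edge l' , consI i ⨾ perm (↭-sym (PP.shift (x , y) (pieces s xs ks) D'))
link-region s {D = _ ∷ D} (edge {x} {y} {xs} {ys} l) (dir ∷ ks) = let D' , l' , i = link-region s l ks in D' , same l' , (split tt ⋆ i)
link-region s {D = _ ∷ D} (edge {x} {y} {xs} {ys} l) (tri z ∷ ks) = let D' , l' , i = link-region s l ks in
  D' , same l' , (split tt ⋆ (perm (PP.shift (z , s) D (pieces s ys ks)) ⨾ consI i))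

prolong : ∀ rs {xs ys D} → Link {n} xs ys D → Imm Any-v (D ++ diagram rs ys) (diagram rs xs)
prolong [] {D = D} l = dropI D ⨾ idI
prolong ((s , ks) ∷ rs) {xs} {ys} {D} l = let D' , l' , i = link-region s l ks in
  ≡I (sym (++-assoc D (pieces s ys ks) _)) ⨾ suffixI i ⨾ ≡I (++-assoc (pieces s xs ks) D' _) ⨾ prefixI (pieces s xs ks) (prolong rs l')

pass : ∀ s ks rs xs → Imm Any-v (diagram {n} ((s , ks) ∷ rs) xs) (diagram rs xs)
pass {n} s ks rs xs = let D , l , i = go xs ks in suffixI i ⨾ prolong rs l
  where
  go : ∀ xs ks → Σ[ D ∈ List (Edge n) ] Link xs (nexts s xs ks) D × Imm Any-v (pieces s xs ks) D
  go [] ks = [] , [] , idI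
  go (x ∷ xs) [] = [] , refl-link (x ∷ xs) , idI
    where refl-link : ∀ xs → Link {n} xs xs []
          refl-link [] = []
          refl-link (x ∷ xs) = same (refl-link xs)
  go (x ∷ xs) (thru ∷ ks) = let D , l , i = go xs ks in D , same l , i
  go (x ∷ xs) (dir ∷ ks) = let D , l , i = go xs ks in (x , s) ∷ D , edge l , consI i
  go (x ∷ xs) (tri y ∷ ks) = let D , l , i = go xs ks in (x , y) ∷ D , edge l , consI (del ⨾ i)

-- At the selected terminals strands of colour A and of colour B alternately arrive and depart; the others (colour N) are cut off.
data Col : Set where
  colA colB colN : Col

other : Col → Col
other colA   = colB
other colB   = colA
other colN = colN

is : Col → Col → Bool
is colA colA = true
is colB colB = true
is _  _  = false

count : Col → List Col → ℕ
count c γ = sumOf (λ g → b2n (is c g)) γ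

data Live {n} (c : Col) (v : Fin n) : List Col → List (Fin n) → Set where
  []  : ∀ {xs} → Live c v [] xs
  _∷_ : ∀ {g γ x xs} → (is c g ≡ true → x ≡ v) → Live c v γ xs → Live c v (g ∷ γ) (x ∷ xs)

data Fits {n} : List Col → List (Kind n) → Set where
  []  : Fits [] []
  _∷_ : ∀ {g γ κ ks} → (∀ c → is c g ≡ true → touches κ ≡ true) → Fits γ ks → Fits (g ∷ γ) (κ ∷ ks)

is-other : ∀ c {g} → is c g ≡ true → is (other c) g ≡ false
is-other colA {colA} _ = refl
is-other colB {colB} _ = refl

drop-piece : ∀ s x xs (κ : Kind n) ks → Imm Any-v (pieces s (x ∷ xs) (κ ∷ ks)) (pieces s xs ks)
drop-piece s x xs thru    ks = idI
drop-piece s x xs dir     ks = del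
drop-piece s x xs (tri y) ks = del ⨾ del

hook : ∀ {c v} s rs {γ xs ks} → Live {n} c v γ xs → Fits γ ks → length γ ≡ length xs →
  Σ[ xs' ∈ List (Fin n) ] Live (other c) s γ xs' × length γ ≡ length xs' × Imm Any-v (diagram ((s , ks) ∷ rs) xs) (replicate (count c γ) (v , s) ++ diagram rs xs')
hook {n} {c} {v} s rs {γ} {xs} {ks} L F e = let xs' , D , l' , k , e' , i = go L F e in
    xs' , l' , e' , suffixI i ⨾ ≡I (++-assoc (replicate (count c γ) (v , s)) D _) ⨾ prefixI (replicate (count c γ) (v , s)) (prolong rs k)
  where
  go : ∀ {γ xs ks} → Live c v γ xs → Fits γ ks → length γ ≡ length xs →
    Σ[ xs' ∈ List (Fin n) ] Σ[ D ∈ List (Edge n) ] Live (other c) s γ xs' × Link xs' (nexts s xs ks) D × length γ ≡ length xs' ×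
      Imm Any-v (pieces s xs ks) (replicate (count c γ) (v , s) ++ D)
  go {xs = []} [] [] e = [] , [] , [] , [] , refl , idI
  go {γ = g ∷ γ} {x ∷ xs} {κ ∷ ks} (a ∷ L) (f ∷ F) e with go L F (suc-injective e) | bool? (is c g) | bool? (is (other c) g)
  ... | xs' , D , l' , k , e' , i | inj₁ t | _ with refl ← a t = arrive κ (f c t)
    where
    R = replicate (count c γ) (v , s)
    eq : replicate (b2n (is c g) + count c γ) (v , s) ≡ (v , s) ∷ R
    eq = cong (λ z → replicate (b2n z + count c γ) (v , s)) t
    arrive : ∀ κ → touches κ ≡ true → Σ[ xs' ∈ List (Fin n) ] Σ[ D ∈ List (Edge n) ] Live (other c) s (g ∷ γ) xs' × Link xs' (nexts s (x ∷ xs) (κ ∷ ks)) D × suc (length γ) ≡ length xs' ×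
      Imm Any-v (pieces s (x ∷ xs) (κ ∷ ks)) (replicate (b2n (is c g) + count c γ) (x , s) ++ D)
    arrive dir     _ = s ∷ xs' , D , (λ o → ⊥-elim (true≢false o (is-other c t))) ∷ l' , same k , cong suc e' , consI i ⨾ ≡I (cong (_++ D) (sym eq))
    arrive (tri y) _ = y ∷ xs' , D , (λ o → ⊥-elim (true≢false o (is-other c t))) ∷ l' , same k , cong suc e' , split tt ⨾ consI i ⨾ ≡I (cong (_++ D) (sym eq))
  ... | xs' , D , l' , k , e' , i | inj₂ t | inj₁ o = depart κ (f (other c) o)
    where
    R = replicate (count c γ) (v , s)
    eq : replicate (b2n (is c g) + count c γ) (v , s) ≡ R
    eq = cong (λ z → replicate (b2n z + count c γ) (v , s)) t
    depart : ∀ κ → touches κ ≡ true → Σ[ xs' ∈ List (Fin n) ] Σ[ D ∈ List (Edge n) ] Live (other c) s (g ∷ γ) xs' × Link xs' (nexts s (x ∷ xs) (κ ∷ ks)) D × suc (length γ) ≡ length xs' ×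
      Imm Any-v (pieces s (x ∷ xs) (κ ∷ ks)) (replicate (b2n (is c g) + count c γ) (v , s) ++ D)
    depart dir     _ = s ∷ xs' , D , (λ _ → refl) ∷ l' , same k , cong suc e' , del ⨾ i ⨾ ≡I (cong (_++ D) (sym eq))
    depart (tri y) _ = s ∷ xs' , (s , y) ∷ D , (λ _ → refl) ∷ l' , edge k , cong suc e' ,
      del ⨾ flip ⨾ consI i ⨾ perm (↭-sym (PP.shift (s , y) R D)) ⨾ ≡I (cong (_++ (s , y) ∷ D) (sym eq))
  ... | xs' , D , l' , k , e' , i | inj₂ t | inj₂ o = next s x κ ∷ xs' , D , (λ o' → ⊥-elim (true≢false o' o)) ∷ l' , same k , cong suc e' ,
      drop-piece s x xs κ ks ⨾ i ⨾ ≡I (cong (_++ D) (sym (cong (λ z → replicate (b2n z + count c γ) (v , s)) t)))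

mask : Region n → List Bool
mask (_ , ks) = map touches ks

_=ᵐ_ : List Bool → List Bool → Bool
[]       =ᵐ []       = true
(a ∷ as) =ᵐ (b ∷ bs) = not (a xor b) ∧ (as =ᵐ bs)
_        =ᵐ _        = false

=ᵐ⇒≡ : ∀ as bs → (as =ᵐ bs) ≡ true → as ≡ bs
=ᵐ⇒≡ [] [] e = refl
=ᵐ⇒≡ (a ∷ as) (b ∷ bs) e = cong₂ _∷_ (xor-≡ (not-f (proj₁ (∧-elim e)))) (=ᵐ⇒≡ as bs (proj₂ (∧-elim {not (a xor b)} e)))

pigeonhole : ∀ k N (ms : List (List Bool)) → (∀ {m} → m ∈ₗ ms → length m ≡ k) → N * 2 ^ k ≤ length ms →
  Σ[ μ ∈ List Bool ] length μ ≡ k × N ≤ sumOf (λ m → b2n (m =ᵐ μ)) ms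
pigeonhole zero N ms len le = [] , refl , ≤-trans (≤-trans (≤-reflexive (sym (*-identityʳ N))) le) (≤-reflexive (all ms len))
  where
  all : ∀ ms → (∀ {m} → m ∈ₗ ms → length m ≡ 0) → length ms ≡ sumOf (λ m → b2n (m =ᵐ [])) ms
  all [] _ = refl
  all ([] ∷ ms) h = cong suc (all ms (h ∘ there))
  all ((_ ∷ _) ∷ ms) h = case h (here refl) of λ ()
pigeonhole (suc k) N ms len le = choose (≤-total (N * 2 ^ k) (length (tails true ms)))
  where
  tails : Bool → List (List Bool) → List (List Bool)
  tails b [] = []
  tails b ([] ∷ ms) = tails b ms
  tails true  ((true ∷ m) ∷ ms)  = m ∷ tails true ms
  tails true  ((false ∷ m) ∷ ms) = tails true ms
  tails false ((true ∷ m) ∷ ms)  = tails false ms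
  tails false ((false ∷ m) ∷ ms) = m ∷ tails false ms
  tails-len : ∀ b ms → (∀ {m} → m ∈ₗ ms → length m ≡ suc k) → ∀ {m} → m ∈ₗ tails b ms → length m ≡ k
  tails-len b ([] ∷ ms) h i = tails-len b ms (h ∘ there) i
  tails-len true  ((true ∷ m) ∷ ms) h (here refl) = suc-injective (h (here refl))
  tails-len true  ((true ∷ m) ∷ ms) h (there i) = tails-len true ms (h ∘ there) i
  tails-len true  ((false ∷ m) ∷ ms) h i = tails-len true ms (h ∘ there) i
  tails-len false ((true ∷ m) ∷ ms) h i = tails-len false ms (h ∘ there) i
  tails-len false ((false ∷ m) ∷ ms) h (here refl) = suc-injective (h (here refl))
  tails-len false ((false ∷ m) ∷ ms) h (there i) = tails-len false ms (h ∘ there) i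
  both : ∀ ms → (∀ {m} → m ∈ₗ ms → length m ≡ suc k) → length ms ≡ length (tails true ms) + length (tails false ms)
  both [] _ = refl
  both ([] ∷ ms) h = case h (here refl) of λ ()
  both ((true ∷ m) ∷ ms) h = cong suc (both ms (h ∘ there))
  both ((false ∷ m) ∷ ms) h = trans (cong suc (both ms (h ∘ there))) (sym (+-suc _ _))
  lift : ∀ b μ ms → sumOf (λ m → b2n (m =ᵐ μ)) (tails b ms) ≤ sumOf (λ m → b2n (m =ᵐ (b ∷ μ))) ms
  lift b μ [] = z≤n
  lift b μ ([] ∷ ms) = lift b μ ms
  lift true  μ ((true ∷ m) ∷ ms) = +-monoʳ-≤ (b2n (m =ᵐ μ)) (lift true μ ms)
  lift true  μ ((false ∷ m) ∷ ms) = lift true μ ms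
  lift false μ ((true ∷ m) ∷ ms) = lift false μ ms
  lift false μ ((false ∷ m) ∷ ms) = +-monoʳ-≤ (b2n (m =ᵐ μ)) (lift false μ ms)
  use : ∀ b → N * 2 ^ k ≤ length (tails b ms) → Σ[ μ ∈ List Bool ] length μ ≡ suc k × N ≤ sumOf (λ m → b2n (m =ᵐ μ)) ms
  use b h = let μ , l , q = pigeonhole k N (tails b ms) (tails-len b ms len) h in b ∷ μ , cong suc l , ≤-trans q (lift b μ ms)
  choose : _ → _
  choose (inj₁ h) = use true h
  choose (inj₂ h) = use false (+-cancelˡ-≤ (N * 2 ^ k) _ _ (≤-trans (≤-reflexive (re N (2 ^ k))) (≤-trans le (≤-trans (≤-reflexive (both ms len)) (+-monoˡ-≤ _ h)))))
    where re : ∀ N p → N * p + N * p ≡ N * (p + (p + 0))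
          re = solve-∀

colour : ℕ → ℕ → List Bool → List Col
colour a       b       []          = []
colour a       b       (false ∷ μ) = colN ∷ colour a b μ
colour (suc a) b       (true ∷ μ)  = colA ∷ colour a b μ
colour zero    (suc b) (true ∷ μ)  = colB ∷ colour zero b μ
colour zero    zero    (true ∷ μ)  = colN ∷ colour zero zero μ

trues : List Bool → ℕ
trues = sumOf b2n

colour-length : ∀ a b μ → length (colour a b μ) ≡ length μ
colour-length a       b       []          = refl
colour-length a       b       (false ∷ μ) = cong suc (colour-length a b μ)
colour-length (suc a) b       (true ∷ μ)  = cong suc (colour-length a b μ)
colour-length zero    (suc b) (true ∷ μ)  = cong suc (colour-length zero b μ)
colour-length zero    zero    (true ∷ μ)  = cong suc (colour-length zero zero μ)

colour-count : ∀ a b μ → a + b ≤ trues μ → count colA (colour a b μ) ≡ a × count colB (colour a b μ) ≡ b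
colour-count zero    zero    []          le = refl , refl
colour-count a       b       (false ∷ μ) le = colour-count a b μ le
colour-count (suc a) b       (true ∷ μ)  le = let p , q = colour-count a b μ (≤-pred le) in cong suc p , q
colour-count zero    (suc b) (true ∷ μ)  le = let p , q = colour-count zero b μ (≤-pred le) in p , cong suc q
colour-count zero    zero    (true ∷ μ)  le = colour-count zero zero μ z≤n

colour-fits : ∀ a b (ks : List (Kind n)) → Fits (colour a b (map touches ks)) ks
colour-fits a b [] = []
colour-fits a b (κ ∷ ks) with touches κ in eq
colour-fits a       b       (κ ∷ ks) | false = (λ { colA () ; colB () ; colN () }) ∷ colour-fits a b ks
colour-fits (suc a) b       (κ ∷ ks) | true = (λ _ _ → eq) ∷ colour-fits a b ks
colour-fits zero    (suc b) (κ ∷ ks) | true = (λ _ _ → eq) ∷ colour-fits zero b ks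
colour-fits zero    zero    (κ ∷ ks) | true = (λ _ _ → eq) ∷ colour-fits zero zero ks

module Run {n : ℕ} (N : ℕ) (μ : List Bool) (N≤ : N + N ≤ trues μ) where
  private
    γ = colour N N μ

    matches : List (Region n) → ℕ
    matches = sumOf (λ ρ → b2n (mask ρ =ᵐ μ))

    fits : ∀ s ks → (mask {n} (s , ks) =ᵐ μ) ≡ true → Fits γ ks
    fits s ks e = subst (λ z → Fits (colour N N z) ks) (=ᵐ⇒≡ _ _ e) (colour-fits N N ks)

    cnt : ∀ c → c ≢ colN → count c γ ≡ N
    cnt colA _ = proj₁ (colour-count N N μ N≤)
    cnt colB _ = proj₂ (colour-count N N μ N≤)
    cnt colN h = contradiction refl h

    other≢ : ∀ {c} → c ≢ colN → other c ≢ colN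
    other≢ {colA} _ ()
    other≢ {colB} _ ()
    other≢ {colN} h _ = h refl

  run : ∀ rs xs c v r → c ≢ colN → Live c v γ xs → length γ ≡ length xs → r ≤ matches rs →
    Σ[ L ∈ List (Fin n) ] length L ≡ r × Sublist._⊆_ L (map proj₁ rs) × Imm Any-v (diagram rs xs) (concat (map (replicate N) (pw (v ∷ L))))
  run rs xs c v zero nc l e le = [] , refl , Sublist.minimum _ , clearI (diagram rs xs)
  run [] xs c v (suc r) nc l e ()
  run ((s , ks) ∷ rs) xs c v (suc r) nc l e le with bool? (mask {n} (s , ks) =ᵐ μ)
  ... | inj₂ f = let L , len , sub , i = run rs xs c v (suc r) nc l e (subst (λ z → suc r ≤ b2n z + matches rs) f le) in L , len , s Sublist.∷ʳ sub , (pass s ks rs xs ⨾ i)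
  ... | inj₁ t = let xs' , l' , e' , i = hook s rs l (fits s ks t) e
                     L , len , sub , j = run rs xs' (other c) s r (other≢ nc) l' e' (≤-pred (subst (λ z → suc r ≤ b2n z + matches rs) t le))
                 in s ∷ L , cong suc len , refl Sublist.∷ sub , i ⨾ ≡I (cong (λ z → replicate z (v , s) ++ diagram rs xs') (cnt c nc)) ⨾ prefixI (replicate N (v , s)) j

  start : ∀ rs xs r → length γ ≡ length xs → suc r ≤ matches rs →
    Σ[ v ∈ Fin n ] Σ[ L ∈ List (Fin n) ] length L ≡ r × Sublist._⊆_ (v ∷ L) (map proj₁ rs) × Imm Any-v (diagram rs xs) (concat (map (replicate N) (pw (v ∷ L))))
  start [] xs r e ()
  start ((s , ks) ∷ rs) xs r e le with bool? (mask {n} (s , ks) =ᵐ μ)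
  ... | inj₂ f = let v , L , len , sub , i = start rs xs r e (subst (λ z → suc r ≤ b2n z + matches rs) f le) in v , L , len , s Sublist.∷ʳ sub , (pass s ks rs xs ⨾ i)
  ... | inj₁ t = let xs' , l' , e' , i = go (fits s ks t) e
                     L , len , sub , j = run rs xs' colA s r (λ ()) l' e' (≤-pred (subst (λ z → suc r ≤ b2n z + matches rs) t le))
                 in s , L , len , refl Sublist.∷ sub , (i ⨾ j)
    where
    go : ∀ {ks} → Fits γ ks → length γ ≡ length xs → Σ[ xs' ∈ List (Fin n) ] Live colA s γ xs' × length γ ≡ length xs' × Imm Any-v (diagram ((s , ks) ∷ rs) xs) (diagram rs xs')
    go {ks} F e = let xs' , D , l' , k , e' , i = dep {xs = xs} F e in xs' , l' , e' , (suffixI i ⨾ prolong rs k)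
      where
      dep : ∀ {γ xs ks} → Fits γ ks → length γ ≡ length xs → Σ[ xs' ∈ List (Fin n) ] Σ[ D ∈ List (Edge n) ] Live colA s γ xs' × Link xs' (nexts s xs ks) D × length γ ≡ length xs' × Imm Any-v (pieces s xs ks) D
      dep {xs = []} [] e = [] , [] , [] , [] , refl , idI
      dep {γ = g ∷ γ} {x ∷ xs} {κ ∷ ks} (f ∷ F) e with dep F (suc-injective e) | bool? (is colA g)
      ... | xs' , D , l' , k , e' , i | inj₂ o = next s x κ ∷ xs' , D , (λ o' → ⊥-elim (true≢false o' o)) ∷ l' , same k , cong suc e' , drop-piece s x xs κ ks ⨾ i
      ... | xs' , D , l' , k , e' , i | inj₁ o with κ | f colA o
      ...   | dir   | _ = s ∷ xs' , D , (λ _ → refl) ∷ l' , same k , cong suc e' , del ⨾ i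
      ...   | tri y | _ = s ∷ xs' , (s , y) ∷ D , (λ _ → refl) ∷ l' , edge k , cong suc e' , del ⨾ flip ⨾ consI i

fold-path : ∀ t (v : Fin n) L → Imm Any-v (concat (map (replicate (t + t)) (pw (v ∷ L)))) (concat (replicate t (Words.cyc L)))
fold-path {n} t v L = perm (transpose (t + t) (pw (v ∷ L))) ⨾ ≡I (cong concat (replicate-+ t t)) ⨾ ≡I (concat-++' (replicate t Q₁) (replicate t Q₁)) ⨾ zip-up t
  where
  open import Data.List.Properties using (concat-++)
  Q₁ = pw (v ∷ L)
  concat-++' : ∀ (A B : List (List (Edge n))) → concat (A ++ B) ≡ concat A ++ concat B
  concat-++' A B = sym (concat-++ A B)
  replicate-+ : ∀ {x : List (Edge n)} a b → replicate (a + b) x ≡ replicate a x ++ replicate b x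
  replicate-+ zero    b = refl
  replicate-+ (suc a) b = cong (_ ∷_) (replicate-+ a b)
  transpose : ∀ c (es : List (Edge n)) → concat (map (replicate c) es) ↭ concat (replicate c es)
  transpose c [] = ↭-reflexive (sym (nil c))
    where nil : ∀ c → concat (replicate c ([] {A = Edge n})) ≡ []
          nil zero = refl
          nil (suc c) = nil c
  transpose c (e ∷ es) = ↭-trans (PP.++⁺ˡ (replicate c e) (transpose c es)) (merge c)
    where
    merge : ∀ c → replicate c e ++ concat (replicate c es) ↭ concat (replicate c (e ∷ es))
    merge zero = ↭-refl
    merge (suc c) = P.prep e (↭-trans (PP.shifts (replicate c e) es) (PP.++⁺ˡ es (merge c)))
  there-and-back : ∀ L → Imm Any-v (pw (v ∷ L) ++ pw (v ∷ L)) (Words.cyc L)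
  there-and-back [] = idI
  there-and-back (l ∷ L') = prefixI (pw (v ∷ l ∷ L')) (Words.pw-reverse (v ∷ l ∷ L') ⨾ ≡I (trans (cong pw (unfold-reverse v (l ∷ L'))) (trans (cong (λ z → pw (z ++ v ∷ [])) rev) refl)))
        ⨾ ≡I (sym (trans (cong (λ z → pw (v ∷ z)) (++-assoc (l ∷ L') m (v ∷ []))) (pw-++ v (l ∷ L') (m ++ v ∷ []))))
        ⨾ Words.thin v v {l ∷ L'} {(l ∷ L') ++ m} (SublistP.++⁺ʳ m Sublist.⊆-refl) ⨾ Words.word-cyc v (l ∷ L')
    where
    back : ∀ (l : Fin n) L' → Σ[ m ∈ List (Fin n) ] reverse (l ∷ L') ≡ last' l L' ∷ m
    back l [] = [] , refl
    back l (x ∷ L') = let m , e = back x L' in m ++ l ∷ [] , trans (unfold-reverse l (x ∷ L')) (cong (_++ l ∷ []) e)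
    m = proj₁ (back l L')
    rev : reverse (l ∷ L') ≡ last' l L' ∷ m
    rev = proj₂ (back l L')
  zip-up : ∀ t → Imm Any-v (concat (replicate t Q₁) ++ concat (replicate t Q₁)) (concat (replicate t (Words.cyc L)))
  zip-up zero = idI
  zip-up (suc t) = ≡I (++-assoc Q₁ _ _) ⨾ prefixI Q₁ (perm (PP.shifts (concat (replicate t Q₁)) Q₁)) ⨾ ≡I (sym (++-assoc Q₁ Q₁ _)) ⨾ (there-and-back L ⊕ zip-up t)

zipE : List (Fin n) → List (Fin n) → List (Edge n)
zipE (x ∷ xs) (z ∷ zs) = (x , z) ∷ zipE xs zs
zipE _        _        = []

Item : ℕ → Set
Item n = Fin n × Kind n × Fin n

itemE : Fin n → Item n → List (Edge n)
itemE s (x , thru  , z) = (x , z) ∷ []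
itemE s (x , dir   , z) = (x , s) ∷ (s , z) ∷ []
itemE s (x , tri y , z) = (x , y) ∷ (y , s) ∷ (y , z) ∷ []

itemsE : Fin n → List (Item n) → List (Edge n)
itemsE s L = concat (map (itemE s) L)

leftI rightI : Item n → Fin n
leftI  (x , _ , _) = x
rightI (_ , _ , z) = z

kindI : Item n → Kind n
kindI (_ , κ , _) = κ

concat-↭ : {L M : List (List A)} → L ↭ M → concat L ↭ concat M
concat-↭ P.refl = ↭-refl
concat-↭ (P.prep x p) = PP.++⁺ˡ x (concat-↭ p)
concat-↭ (P.swap x y p) = ↭-trans (PP.++⁺ˡ x (PP.++⁺ˡ y (concat-↭ p))) (PP.shifts x y)
concat-↭ (P.trans p q) = ↭-trans (concat-↭ p) (concat-↭ q)

items-pieces : ∀ {Q : Fin n → Set} s L → Imm Q (itemsE s L) (pieces s (map leftI L) (map kindI L) ++ zipE (nexts s (map leftI L) (map kindI L)) (map rightI L))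
items-pieces s [] = idI
items-pieces s ((x , thru , z) ∷ L) = consI (items-pieces s L) ⨾ perm (↭-sym (PP.shift (x , z) (pieces s (map leftI L) (map kindI L)) _))
items-pieces s ((x , dir , z) ∷ L) = consI (consI (items-pieces s L) ⨾ perm (↭-sym (PP.shift (s , z) (pieces s (map leftI L) (map kindI L)) _)))
items-pieces s ((x , tri y , z) ∷ L) = consI (consI (consI (items-pieces s L) ⨾ perm (↭-sym (PP.shift (y , z) (pieces s (map leftI L) (map kindI L)) _))))

endsIn-++ : ∀ (P : VSet n) E D → endsIn P (E ++ D) ≡ endsIn P E ++ endsIn P D
endsIn-++ P [] D = refl
endsIn-++ P ((u , w) ∷ E) D = trans (cong (λ z → pick P u ++ pick P w ++ z) (endsIn-++ P E D))
  (trans (cong (pick P u ++_) (sym (++-assoc (pick P w) (endsIn P E) (endsIn P D)))) (sym (++-assoc (pick P u) _ _)))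

pick-tf : ∀ {P : VSet n} {u w} → P u ≡ true → P w ≡ false → ∀ zs → pick P u ++ pick P w ++ zs ≡ u ∷ zs
pick-tf e f zs rewrite e | f = refl

pick-ft : ∀ {P : VSet n} {u w} → P u ≡ false → P w ≡ true → ∀ zs → pick P u ++ pick P w ++ zs ≡ w ∷ zs
pick-ft e f zs rewrite e | f = refl

pick-ff : ∀ {P : VSet n} {u w} → P u ≡ false → P w ≡ false → ∀ zs → pick P u ++ pick P w ++ zs ≡ zs
pick-ff e f zs rewrite e | f = refl

endsIn-none : ∀ (P : VSet n) E → (∀ {u w} → (u , w) ∈ₗ E → P u ≡ false × P w ≡ false) → endsIn P E ≡ []
endsIn-none P [] h = refl
endsIn-none P ((u , w) ∷ E) h = trans (pick-ff {P = P} (proj₁ (h (here refl))) (proj₂ (h (here refl))) _) (endsIn-none P E (h ∘ there))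

endsIn-sieve : ∀ (P : VSet n) q E → (∀ {u w} → (u , w) ∈ₗ E → q (u , w) ≡ false → P u ≡ false × P w ≡ false) → endsIn P (sieve q E) ≡ endsIn P E
endsIn-sieve P q [] h = refl
endsIn-sieve P q ((u , w) ∷ E) h with q (u , w) in eq
... | true  = cong (λ z → pick P u ++ pick P w ++ z) (endsIn-sieve P q E (h ∘ there))
... | false = trans (endsIn-sieve P q E (h ∘ there)) (sym (pick-ff {P = P} (proj₁ (h (here refl) eq)) (proj₂ (h (here refl) eq)) _))

d-endsIn : ∀ (P Z : VSet n) E → Z ⊆ P → (∀ {u w} → (u , w) ∈ₗ E → P u ∧ P w ≡ false) → d E Z ≡ sumOf (b2n ∘ Z) (endsIn P E)
d-endsIn P Z [] h k = refl
d-endsIn P Z ((u , w) ∷ E) h k = trans (cong₂ _+_ (go (bool? (P u)) (bool? (P w))) (d-endsIn P Z E h (k ∘ there))) (trans (sym (sumOf-++ _ (pick P u ++ pick P w) (endsIn P E)))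
    (cong (sumOf (b2n ∘ Z)) (++-assoc (pick P u) (pick P w) _)))
  where
  Zf : ∀ {v} → P v ≡ false → Z v ≡ false
  Zf f = ¬true λ t → true≢false (h _ t) f
  nm-f : ∀ x → nm x false false ≡ b2n x
  nm-f true = refl
  nm-f false = refl
  nm-f' : ∀ x → nm false x x ≡ b2n x
  nm-f' true = refl
  nm-f' false = refl
  go : (P u ≡ true) ⊎ (P u ≡ false) → (P w ≡ true) ⊎ (P w ≡ false) → cross Z (u , w) ≡ sumOf (b2n ∘ Z) (pick P u ++ pick P w)
  go (inj₁ a) (inj₁ b) = ⊥-elim (true≢false (∧-intro a b) (k (here refl)))
  go (inj₁ a) (inj₂ b) rewrite a | b | Zf b = trans (nm-f (Z u)) (sym (+-identityʳ _))
  go (inj₂ a) (inj₁ b) rewrite a | b | Zf a = trans (nm-f' (Z w)) (sym (+-identityʳ _))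
  go (inj₂ a) (inj₂ b) rewrite a | b | Zf a | Zf b = refl

sumOf-sieve : (f : A → ℕ) (q : A → Bool) → ∀ xs → (∀ {x} → x ∈ₗ xs → q x ≡ false → f x ≡ 0) → sumOf f (sieve q xs) ≡ sumOf f xs
sumOf-sieve f q [] h = refl
sumOf-sieve f q (x ∷ xs) h with q x in eq
... | true  = cong (f x +_) (sumOf-sieve f q xs (h ∘ there))
... | false = trans (sumOf-sieve f q xs (h ∘ there)) (cong (_+ sumOf f xs) (sym (h (here refl) eq)))

elnm-≤ : ∀ (X : VSet n) L → elcut L X ≤ d (flat L) X
elnm-≤ X [] = z≤n
elnm-≤ X (pr u w ∷ L) = +-monoʳ-≤ (cross X (u , w)) (elnm-≤ X L)
elnm-≤ X (tr y u v w ∷ L) = ≤-trans (+-mono-≤ (bits (X y) (X u) (X v) (X w)) (elnm-≤ X L)) (≤-reflexive (re (cross X (y , u)) (cross X (y , v)) (cross X (y , w)) (d (flat L) X)))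
  where
  re : ∀ a b c d → a + b + c + d ≡ a + (b + (c + d))
  re = solve-∀
  bits : ∀ y u v w → nm u v w ≤ nm y u u + nm y v v + nm y w w
  bits true  true  true  true  = z≤n
  bits true  true  true  false = ≤-refl
  bits true  true  false true  = ≤-refl
  bits true  true  false false = s≤s z≤n
  bits true  false true  true  = s≤s z≤n
  bits true  false true  false = s≤s z≤n
  bits true  false false true  = s≤s z≤n
  bits true  false false false = z≤n
  bits false true  true  true  = z≤n
  bits false true  true  false = s≤s z≤n
  bits false true  false true  = s≤s z≤n
  bits false true  false false = s≤s z≤n
  bits false false true  true  = s≤s z≤n
  bits false false true  false = ≤-refl
  bits false false false true  = ≤-refl
  bits false false false false = z≤n

module Three {n} (a s b : Fin n) (a≢s : a ≢ s) (a≢b : a ≢ b) (s≢b : s ≢ b) where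
  S₃ : VSet n
  S₃ v = (v == a) ∨ (v == s) ∨ (v == b)

  S₃a : S₃ a ≡ true
  S₃a = ∨-introˡ (==-refl a)
  S₃s : S₃ s ≡ true
  S₃s = ∨-introʳ {s == a} (∨-introˡ (==-refl s))
  S₃b : S₃ b ≡ true
  S₃b = ∨-introʳ {b == a} (∨-introʳ {b == s} (==-refl b))

  data Which : Fin n → Set where
    is-a : Which a
    is-s : Which s
    is-b : Which b

  which : ∀ v → S₃ v ≡ true → Which v
  which v e with v F.≟ a | v F.≟ s | v F.≟ b
  ... | yes refl | _ | _ = is-a
  ... | no _ | yes refl | _ = is-s
  ... | no _ | no _ | yes refl = is-b
  which v () | no _ | no _ | no _

  Inv₃ : List (Edge n) → VSet n → Set
  Inv₃ E S = ∀ v → S v ≡ S₃ v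

  -- One side of every separating set contains a single terminal.
  move₃ : ∀ {k} E S X → State k Inv₃ S E → Tight k S E X → Move k (λ v → S₃ v ≡ false) Inv₃ E S X
  move₃ {k} E S X (state c at inv) tX = choose (bool? (X a)) (bool? (X s)) (bool? (X b))
    where
    tX' : Tight k S E (∁ X)
    tX' = Sep-∁ (proj₁ tX) , ≤-trans (≤-reflexive (SLike.com (d-SLike E) X)) (proj₂ tX)
    side : ∀ X' t → Tight k S E X' → (∀ e → cross X' e ≡ cross X e) → S₃ t ≡ true → X' t ≡ true → (∀ {v} → Which v → v ≢ t → X' v ≡ false) → Move k (λ v → S₃ v ≡ false) Inv₃ E S X
    side X' t tt' sm St Xt others = record { X' = X' ; s = t ; tight' = tt' ; same = sm ; Ss = trans (inv t) St ; X's = Xt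
      ; split' = λ v Xv ne → ¬true λ Sv → true≢false Xv (others (which v Sv) ne)
      ; inv' = λ v → keeps v (bool? (S₃ v)) }
      where
      keeps : ∀ v → (S₃ v ≡ true) ⊎ (S₃ v ≡ false) → keep X' t S v ≡ S₃ v
      keeps v (inj₂ f) = trans (cong (_∧ _) (trans (inv v) f)) (sym f)
      keeps v (inj₁ e) with v F.≟ t
      ... | yes refl = trans (∧-intro (trans (inv v) e) (∨-introʳ {not (X' v)} refl)) (sym e)
      ... | no ne = trans (∧-intro (trans (inv v) e) (∨-introˡ (not-t (others (which v e) ne)))) (sym e)
    flipped : ∀ e → cross (∁ X) e ≡ cross X e
    flipped (u , w) = SLike.com (nmSet-SLike u w w) X
    all-same : ∀ {β} → X a ≡ β → X s ≡ β → X b ≡ β → ∀ {v} → S v ≡ true → X v ≡ β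
    all-same p q r {v} Sv with which v (trans (sym (inv v)) Sv)
    ... | is-a = p
    ... | is-s = q
    ... | is-b = r
    choose : (X a ≡ true) ⊎ (X a ≡ false) → (X s ≡ true) ⊎ (X s ≡ false) → (X b ≡ true) ⊎ (X b ≡ false) → Move k (λ v → S₃ v ≡ false) Inv₃ E S X
    choose (inj₁ p) (inj₁ q) (inj₁ r) = let w , Sw , Xw = proj₂ (proj₁ tX) in ⊥-elim (true≢false (all-same p q r Sw) Xw)
    choose (inj₂ p) (inj₂ q) (inj₂ r) = let w , Sw , Xw = proj₁ (proj₁ tX) in ⊥-elim (true≢false Xw (all-same p q r Sw))
    choose (inj₁ p) (inj₂ q) (inj₂ r) = side X a tX (λ _ → refl) S₃a p λ { is-a ne → contradiction refl ne ; is-s _ → q ; is-b _ → r }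
    choose (inj₂ p) (inj₁ q) (inj₂ r) = side X s tX (λ _ → refl) S₃s q λ { is-a _ → p ; is-s ne → contradiction refl ne ; is-b _ → r }
    choose (inj₂ p) (inj₂ q) (inj₁ r) = side X b tX (λ _ → refl) S₃b r λ { is-a _ → p ; is-s _ → q ; is-b ne → contradiction refl ne }
    choose (inj₂ p) (inj₁ q) (inj₁ r) = side (∁ X) a tX' flipped S₃a (not-t p) λ { is-a ne → contradiction refl ne ; is-s _ → cong not q ; is-b _ → cong not r }
    choose (inj₁ p) (inj₂ q) (inj₁ r) = side (∁ X) s tX' flipped S₃s (not-t q) λ { is-a _ → cong not p ; is-s ne → contradiction refl ne ; is-b _ → cong not r }
    choose (inj₁ p) (inj₁ q) (inj₂ r) = side (∁ X) b tX' flipped S₃b (not-t r) λ { is-a _ → cong not p ; is-s _ → cong not q ; is-b ne → contradiction refl ne }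

  Reduced : ℕ → List (Edge n) → Set
  Reduced k E = Σ[ els ∈ List (El n) ] Imm (λ v → S₃ v ≡ false) E (flat els) × (∀ e → e ∈ₗ els → GoodEl S₃ e) × (∀ X → Sep S₃ X → k ≤ elcut els X)

  reduce₃ : ∀ {k} → 2 ≤ k → ∀ E → Conn k S₃ E → Reduced k E
  reduce₃ {k} 2≤k E c with E₁ , i₁ , c₁ , at₁ ← minimise {Q = λ v → S₃ v ≡ false} _ E ≤-refl c
                      with E₂ , S' , i₂ , state c₂ at₂ inv , ind ← torso move₃ _ E₁ S₃ ≤-refl (state c₁ at₁ λ _ → refl) = finish (Engine.engine k 2≤k S₃ (nl E₂) (nl-NonLoop E₂) ind' c')
    where
    ind' : Indep S₃ (nl E₂)
    ind' {u} {w} i ne = [ (λ e → inj₁ (trans (sym (inv u)) e)) , (λ e → inj₂ (trans (sym (inv w)) e)) ]′ (ind (proj₁ (sieve-∈ nonloop E₂ i)) ne)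
    c' : Conn k S₃ (nl E₂)
    c' X ((u , p , q) , (w , p' , q')) = ≤-trans (c₂ X ((u , trans (inv u) p , q) , (w , trans (inv w) p' , q'))) (≤-reflexive (sym (d-nl E₂ X)))
    finish : Engine.Els k 2≤k S₃ (nl E₂) → Reduced k E
    finish record { els = els ; imm = imm ; good = good ; cut = cut } = els , (i₁ ⨾ i₂ ⨾ filterI nonloop E₂ ⨾ imm) , (λ e → good {e}) , cut

  -- Reading off the strands of a region with left side outside Y, right side Y' and terminal s from its reduction to the terminals a, s, b.
  module Parse (Y Y' : VSet n) (Ya : Y a ≡ false) (Ys : Y s ≡ true) (Y's : Y' s ≡ false) (Y'b : Y' b ≡ true) (sub : Y' ⊆ Y) where
    ρ : Fin n → Fin n
    ρ v = if Y' v then b else if Y v then v else a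

    ρ-right : ∀ {v} → Y' v ≡ true → ρ v ≡ b
    ρ-right e rewrite e = refl

    ρ-left : ∀ {v} → Y v ≡ false → ρ v ≡ a
    ρ-left {v} e rewrite ¬true {Y' v} (λ t → true≢false (sub v t) e) | e = refl

    ρ-mid : ∀ {v} → Y v ≡ true → Y' v ≡ false → ρ v ≡ v
    ρ-mid e f rewrite f | e = refl

    data Place (v : Fin n) : Set where
      right : Y' v ≡ true → ρ v ≡ b → Place v
      left  : Y v ≡ false → ρ v ≡ a → Place v
      mid   : Y v ≡ true → Y' v ≡ false → ρ v ≡ v → Place v

    place : ∀ v → Place v
    place v with bool? (Y' v) | bool? (Y v)
    ... | inj₁ t | _ = right t (ρ-right t)
    ... | inj₂ f | inj₂ g = left g (ρ-left g)
    ... | inj₂ f | inj₁ t = mid t f (ρ-mid t f)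

    a∉Y' : Y' a ≡ false
    a∉Y' = ¬true λ t → true≢false (sub a t) Ya

    inv-a : ∀ {v} → ρ v ≡ a → Y v ≡ false
    inv-a {v} e with place v
    ... | right t r = contradiction (trans (sym e) r) a≢b
    ... | left f _ = f
    ... | mid t _ r = ⊥-elim (true≢false (subst (λ z → Y z ≡ true) (trans (sym r) e) t) Ya)

    inv-b : ∀ {v} → ρ v ≡ b → Y' v ≡ true
    inv-b {v} e with place v
    ... | right t r = t
    ... | left f r = contradiction (trans (sym r) e) a≢b
    ... | mid t f r = ⊥-elim (true≢false Y'b (subst (λ z → Y' z ≡ false) (trans (sym r) e) f))

    inv-mid : ∀ {v w} → ρ v ≡ w → w ≢ a → w ≢ b → v ≡ w × Y w ≡ true × Y' w ≡ false
    inv-mid {v} e na nb with place v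
    ... | right t r = contradiction (trans (sym e) r) nb
    ... | left f r = contradiction (trans (sym e) r) na
    ... | mid t f r with refl ← trans (sym r) e = refl , t , f

    inv-s : ∀ {v} → ρ v ≡ s → v ≡ s
    inv-s e = proj₁ (inv-mid e (a≢s ∘ sym) s≢b)

    OkItem : Item n → Set
    OkItem (x , κ , z) = Y x ≡ false × Y' z ≡ true × (∀ y → κ ≡ tri y → Y' y ≡ false × Y y ≡ true)

    record Parsed (Q : Fin n → Set) (els : List (El n)) (D : List (Edge n)) : Set where
      constructor parsed
      field
        {As Bs} : List (Fin n)
        {Ms}    : List (Item n)
        imm     : Imm Q D (map (_, s) As ++ map (s ,_) Bs ++ itemsE s Ms)
        okA     : ∀ {x} → x ∈ₗ As → Y x ≡ false
        okB     : ∀ {z} → z ∈ₗ Bs → Y' z ≡ true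
        okM     : ∀ {m} → m ∈ₗ Ms → OkItem m
        cut-a   : elcut els (sg a) ≡ length As + length Ms
        cut-b   : elcut els (sg b) ≡ length Bs + length Ms
        cut-s   : elcut els (sg s) ≡ length As + length Bs + sumOf (b2n ∘ touches ∘ kindI) Ms

    nm-1 : ∀ x y z → (x ≢ y) ⊎ (y ≢ z) → nm x y z ≡ 1
    nm-1 true  true  true  (inj₁ h) = contradiction refl h
    nm-1 true  true  true  (inj₂ h) = contradiction refl h
    nm-1 true  true  false _ = refl
    nm-1 true  false z     _ = refl
    nm-1 false true  z     _ = refl
    nm-1 false false true  _ = refl
    nm-1 false false false (inj₁ h) = contradiction refl h
    nm-1 false false false (inj₂ h) = contradiction refl h

    one-of : ∀ (t : Fin n) {u v w} → u ≢ v → u ≢ w → v ≢ w → (t ≡ u) ⊎ ((t ≡ v) ⊎ (t ≡ w)) → nm (u == t) (v == t) (w == t) ≡ 1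
    one-of t uv uw vw (inj₁ refl) = nm-1 _ _ _ (inj₁ λ e → true≢false (trans (sym e) (==-refl t)) (≢⇒== (uv ∘ sym)))
    one-of t uv uw vw (inj₂ (inj₁ refl)) = nm-1 _ _ _ (inj₁ λ e → true≢false (trans e (==-refl t)) (≢⇒== uv))
    one-of t uv uw vw (inj₂ (inj₂ refl)) = nm-1 _ _ _ (inj₂ λ e → true≢false (trans e (==-refl t)) (≢⇒== vw))

    cut-1 : ∀ (t : Fin n) {u w} → u ≢ w → (t ≡ u) ⊎ (t ≡ w) → nm (u == t) (w == t) (w == t) ≡ 1
    cut-1 t uw (inj₁ refl) = nm-1 _ _ _ (inj₁ λ e → true≢false (trans (sym e) (==-refl t)) (≢⇒== (uw ∘ sym)))
    cut-1 t uw (inj₂ refl) = nm-1 _ _ _ (inj₁ λ e → true≢false (trans e (==-refl t)) (≢⇒== uw))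

    cut-none : ∀ (t : Fin n) {u w} → u ≢ t → w ≢ t → nm (u == t) (w == t) (w == t) ≡ 0
    cut-none t p q rewrite ≢⇒== p | ≢⇒== q = refl

    module _ {Q : Fin n → Set} where
      add-A : ∀ {e els x D} → Parsed Q els D → Y x ≡ false → elnm (sg a) e ≡ 1 → elnm (sg b) e ≡ 0 → elnm (sg s) e ≡ 1 → Parsed Q (e ∷ els) ((x , s) ∷ D)
      add-A {x = x} (parsed {As} i oA oB oM ca cb cs) Yx ea eb es = parsed {As = x ∷ As} (consI i) (λ { (here refl) → Yx ; (there j) → oA j }) oB oM
        (cong₂ _+_ ea ca) (cong₂ _+_ eb cb) (cong₂ _+_ es cs)

      add-B : ∀ {e els z D} → Parsed Q els D → Y' z ≡ true → elnm (sg a) e ≡ 0 → elnm (sg b) e ≡ 1 → elnm (sg s) e ≡ 1 → Parsed Q (e ∷ els) ((s , z) ∷ D)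
      add-B {z = z} (parsed {As} {Bs} {Ms} i oA oB oM ca cb cs) Yz ea eb es = parsed {As = As} {z ∷ Bs} (consI i ⨾ perm (↭-sym (PP.shift (s , z) (map (_, s) As) _))) oA
        (λ { (here refl) → Yz ; (there j) → oB j }) oM (cong₂ _+_ ea ca) (cong₂ _+_ eb cb)
        (trans (cong₂ _+_ es cs) (cong (_+ sumOf (b2n ∘ touches ∘ kindI) Ms) (sym (+-suc (length As) (length Bs)))))

      add-M : ∀ {e els m D} → Parsed Q els D → OkItem m → elnm (sg a) e ≡ 1 → elnm (sg b) e ≡ 1 → elnm (sg s) e ≡ b2n (touches (kindI m)) → Parsed Q (e ∷ els) (itemE s m ++ D)
      add-M {m = m} (parsed {As} {Bs} {Ms} i oA oB oM ca cb cs) ok ea eb es = parsed {As = As} {Bs} {m ∷ Ms}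
        (prefixI (itemE s m) i ⨾ perm (PP.shifts (itemE s m) (map (_, s) As)) ⨾ prefixI (map (_, s) As) (perm (PP.shifts (itemE s m) (map (s ,_) Bs)))) oA oB
        (λ { (here refl) → ok ; (there j) → oM j }) (trans (cong₂ _+_ ea ca) (sym (+-suc (length As) _))) (trans (cong₂ _+_ eb cb) (sym (+-suc (length Bs) _)))
        (trans (cong₂ _+_ es cs) (re (b2n (touches (kindI m))) (length As) (length Bs) _))
        where re : ∀ x a b c → x + (a + b + c) ≡ a + b + (x + c)
              re = solve-∀

      pre : ∀ {els D D'} → Imm Q D D' → Parsed Q els D' → Parsed Q els D
      pre j (parsed i oA oB oM ca cb cs) = parsed (j ⨾ i) oA oB oM ca cb cs

      swp : ∀ {e f : Edge n} {D} → Imm Q (e ∷ f ∷ D) (f ∷ e ∷ D)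
      swp = perm (P.swap _ _ ↭-refl)

      parse : ∀ els D → mapE ρ D ≡ flat els → (∀ e → e ∈ₗ els → GoodEl S₃ e) → Parsed Q els D
      parse [] [] eq g = parsed {As = []} {[]} {[]} idI (λ ()) (λ ()) (λ ()) refl refl refl
      parse (pr u w ∷ els) (e₁@(u' , w') ∷ D) eq g with g _ (here refl)
      ... | Su , Sw , u≢w = go (which u Su) (which w Sw) refl refl
        where
        p : ρ u' ≡ u
        p = cong proj₁ (∷-injectiveˡ eq)
        q : ρ w' ≡ w
        q = cong proj₂ (∷-injectiveˡ eq)
        rec = parse els D (∷-injectiveʳ eq) (λ e i → g e (there i))
        go : ∀ {u₀ w₀} → Which u₀ → Which w₀ → u ≡ u₀ → w ≡ w₀ → Parsed Q (pr u w ∷ els) ((u' , w') ∷ D)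
        go is-a is-a refl refl = contradiction refl u≢w
        go is-s is-s refl refl = contradiction refl u≢w
        go is-b is-b refl refl = contradiction refl u≢w
        go is-a is-s refl refl with refl ← inv-s q = add-A rec (inv-a p) (cut-1 a u≢w (inj₁ refl)) (cut-none b a≢b s≢b) (cut-1 s u≢w (inj₂ refl))
        go is-s is-a refl refl with refl ← inv-s p = pre flip (add-A rec (inv-a q) (cut-1 a u≢w (inj₂ refl)) (cut-none b s≢b a≢b) (cut-1 s u≢w (inj₁ refl)))
        go is-s is-b refl refl with refl ← inv-s p = add-B rec (inv-b q) (cut-none a (a≢s ∘ sym) (a≢b ∘ sym)) (cut-1 b u≢w (inj₂ refl)) (cut-1 s u≢w (inj₁ refl))
        go is-b is-s refl refl with refl ← inv-s q = pre flip (add-B rec (inv-b p) (cut-none a (a≢b ∘ sym) (a≢s ∘ sym)) (cut-1 b u≢w (inj₁ refl)) (cut-1 s u≢w (inj₂ refl)))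
        go is-a is-b refl refl = add-M {m = u' , thru , w'} rec (inv-a p , inv-b q , λ _ ()) (cut-1 a u≢w (inj₁ refl)) (cut-1 b u≢w (inj₂ refl)) (cut-none s a≢s (s≢b ∘ sym))
        go is-b is-a refl refl = pre flip (add-M {m = w' , thru , u'} rec (inv-a q , inv-b p , λ _ ()) (cut-1 a u≢w (inj₂ refl)) (cut-1 b u≢w (inj₁ refl)) (cut-none s (s≢b ∘ sym) a≢s))
      parse (tr y u v w ∷ els) ((y₁ , u') ∷ (y₂ , v') ∷ (y₃ , w') ∷ D) eq g with g _ (here refl)
      ... | Sy , Su , Sv , Sw , u≢v , u≢w , v≢w = go (which u Su) (which v Sv) (which w Sw) refl refl refl
        where
        eq₂ = ∷-injectiveʳ eq
        eq₃ = ∷-injectiveʳ eq₂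
        rec = parse els D (∷-injectiveʳ eq₃) (λ e i → g e (there i))
        p = cong proj₂ (∷-injectiveˡ eq)
        q = cong proj₂ (∷-injectiveˡ eq₂)
        r = cong proj₂ (∷-injectiveˡ eq₃)
        y≢ : ∀ {t} → S₃ t ≡ true → y ≢ t
        y≢ St refl = true≢false St Sy
        yy : ∀ {y'} → ρ y' ≡ y → y' ≡ y × Y y ≡ true × Y' y ≡ false
        yy e = inv-mid e (y≢ S₃a) (y≢ S₃b)
        c : ∀ t → (t ≡ u) ⊎ ((t ≡ v) ⊎ (t ≡ w)) → nm (u == t) (v == t) (w == t) ≡ 1
        c t = one-of t u≢v u≢w v≢w
        finish : ∀ {x z} → ρ x ≡ a → ρ z ≡ b → (a ≡ u) ⊎ ((a ≡ v) ⊎ (a ≡ w)) → (b ≡ u) ⊎ ((b ≡ v) ⊎ (b ≡ w)) → (s ≡ u) ⊎ ((s ≡ v) ⊎ (s ≡ w)) → Parsed Q (tr y u v w ∷ els) ((y , x) ∷ (y , s) ∷ (y , z) ∷ D)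
        finish {x} {z} px pz ia ib is = pre flip (add-M {m = x , tri y , z} rec (inv-a px , inv-b pz , λ { _ refl → let _ , t , f = yy (cong proj₁ (∷-injectiveˡ eq)) in f , t }) (c a ia) (c b ib) (c s is))
        go : ∀ {u₀ v₀ w₀} → Which u₀ → Which v₀ → Which w₀ → u ≡ u₀ → v ≡ v₀ → w ≡ w₀ → Parsed Q (tr y u v w ∷ els) ((y₁ , u') ∷ (y₂ , v') ∷ (y₃ , w') ∷ D)
        go α β γ e₁ e₂ e₃ with refl ← proj₁ (yy (cong proj₁ (∷-injectiveˡ eq))) | refl ← proj₁ (yy (cong proj₁ (∷-injectiveˡ eq₂))) | refl ← proj₁ (yy (cong proj₁ (∷-injectiveˡ eq₃))) = arrange α β γ e₁ e₂ e₃
          where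
          arrange : ∀ {u₀ v₀ w₀} → Which u₀ → Which v₀ → Which w₀ → u ≡ u₀ → v ≡ v₀ → w ≡ w₀ → Parsed Q (tr y u v w ∷ els) ((y , u') ∷ (y , v') ∷ (y , w') ∷ D)
          arrange is-a is-a _ refl refl _ = contradiction refl u≢v
          arrange is-s is-s _ refl refl _ = contradiction refl u≢v
          arrange is-b is-b _ refl refl _ = contradiction refl u≢v
          arrange is-a _ is-a refl _ refl = contradiction refl u≢w
          arrange is-s _ is-s refl _ refl = contradiction refl u≢w
          arrange is-b _ is-b refl _ refl = contradiction refl u≢w
          arrange _ is-s is-s _ refl refl = contradiction refl v≢w
          arrange _ is-b is-b _ refl refl = contradiction refl v≢w
          arrange _ is-a is-a _ refl refl = contradiction refl v≢w
          arrange is-a is-s is-b refl refl refl with refl ← inv-s q = finish p r (inj₁ refl) (inj₂ (inj₂ refl)) (inj₂ (inj₁ refl))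
          arrange is-a is-b is-s refl refl refl with refl ← inv-s r = pre (consI swp) (finish p q (inj₁ refl) (inj₂ (inj₁ refl)) (inj₂ (inj₂ refl)))
          arrange is-s is-a is-b refl refl refl with refl ← inv-s p = pre swp (finish q r (inj₂ (inj₁ refl)) (inj₂ (inj₂ refl)) (inj₁ refl))
          arrange is-s is-b is-a refl refl refl with refl ← inv-s p = pre (consI swp ⨾ swp) (finish r q (inj₂ (inj₂ refl)) (inj₂ (inj₁ refl)) (inj₁ refl))
          arrange is-b is-a is-s refl refl refl with refl ← inv-s r = pre (swp ⨾ consI swp) (finish q p (inj₂ (inj₁ refl)) (inj₁ refl) (inj₂ (inj₂ refl)))
          arrange is-b is-s is-a refl refl refl with refl ← inv-s q = pre (swp ⨾ consI swp ⨾ swp) (finish r p (inj₂ (inj₂ refl)) (inj₁ refl) (inj₂ (inj₁ refl)))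

d-const : ∀ {X : VSet n} E → (∀ {u w} → (u , w) ∈ₗ E → X u ≡ X w) → d E X ≡ 0
d-const {X = X} E h = sumOf-0 E λ i → cross-≡ X (h i)

zip-∈ : ∀ xs zs {u w : Fin n} → (u , w) ∈ₗ zipE xs zs → u ∈ₗ xs × w ∈ₗ zs
zip-∈ (x ∷ xs) (z ∷ zs) (here refl) = here refl , here refl
zip-∈ (x ∷ xs) (z ∷ zs) (there i) = let p , q = zip-∈ xs zs i in there p , there q

zip-endsˡ : ∀ (P : VSet n) xs zs → length xs ≡ length zs → (∀ {x} → x ∈ₗ xs → P x ≡ true) → (∀ {z} → z ∈ₗ zs → P z ≡ false) → endsIn P (zipE xs zs) ≡ xs
zip-endsˡ P [] [] e h k = refl
zip-endsˡ P (x ∷ xs) (z ∷ zs) e h k = trans (pick-tf {P = P} (h (here refl)) (k (here refl)) _) (cong (x ∷_) (zip-endsˡ P xs zs (suc-injective e) (h ∘ there) (k ∘ there)))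

zip-endsʳ : ∀ (P : VSet n) xs zs → length xs ≡ length zs → (∀ {x} → x ∈ₗ xs → P x ≡ false) → (∀ {z} → z ∈ₗ zs → P z ≡ true) → endsIn P (zipE xs zs) ≡ zs
zip-endsʳ P [] [] e h k = refl
zip-endsʳ P (x ∷ xs) (z ∷ zs) e h k = trans (pick-ft {P = P} (h (here refl)) (k (here refl)) _) (cong (z ∷_) (zip-endsʳ P xs zs (suc-injective e) (h ∘ there) (k ∘ there)))

sum-ends : ∀ (P : VSet n) L → (∀ {x} → x ∈ₗ L → P x ≡ true) → sumOf (b2n ∘ P) L ≡ length L
sum-ends P [] h = refl
sum-ends P (x ∷ L) h = cong₂ _+_ (cong b2n (h (here refl))) (sum-ends P L (h ∘ there))

endsIn-all : ∀ (P : VSet n) E {x} → x ∈ₗ endsIn P E → P x ≡ true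
endsIn-all P ((u , w) ∷ E) i with bool? (P u) | bool? (P w)
... | inj₁ a | inj₁ b rewrite a | b = lem i
  where lem : ∀ {x} → x ∈ₗ u ∷ w ∷ endsIn P E → P x ≡ true
        lem (here refl) = a
        lem (there (here refl)) = b
        lem (there (there j)) = endsIn-all P E j
... | inj₁ a | inj₂ b rewrite a | b = lem i
  where lem : ∀ {x} → x ∈ₗ u ∷ endsIn P E → P x ≡ true
        lem (here refl) = a
        lem (there j) = endsIn-all P E j
... | inj₂ a | inj₁ b rewrite a | b = lem i
  where lem : ∀ {x} → x ∈ₗ w ∷ endsIn P E → P x ≡ true
        lem (here refl) = b
        lem (there j) = endsIn-all P E j
... | inj₂ a | inj₂ b rewrite a | b = endsIn-all P E i

no-rest : ∀ {xs ys zs : List A} → xs ↭ ys ++ zs → length xs ≤ length ys → xs ↭ ys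
no-rest {ys = ys} {[]} p le = ↭-trans p (↭-reflexive (++-identityʳ ys))
no-rest {ys = ys} {z ∷ zs} p le = contradiction (≤-trans (≤-reflexive (trans (sym (trans (length-++ ys) (+-suc (length ys) (length zs)))) (sym (PP.↭-length p)))) (≤-trans le (m≤m+n _ (length zs)))) 1+n≰n

module Normalise {n} (k : ℕ) (2≤k : 2 ≤ k) (S₀ : VSet n) (E₀ : List (Edge n)) (conn : Conn k S₀ E₀) (a : Fin n) (Sa : S₀ a ≡ true) where

  record St (Y : VSet n) (xs zs : List (Fin n)) (In : List (Edge n)) : Set where
    field
      Ya   : Y a ≡ false
      small : d E₀ Y ≤ k
      lenx : length xs ≡ k
      lenz : length zs ≡ k
      xs∉  : ∀ {x} → x ∈ₗ xs → Y x ≡ false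
      zs∈  : ∀ {z} → z ∈ₗ zs → Y z ≡ true
      In⊆  : ∀ {u w} → (u , w) ∈ₗ In → Y u ≡ true × Y w ≡ true
      cut= : ∀ Z → Z ⊆ Y → d (zipE xs zs ++ In) Z ≡ d E₀ Z

  record Step (Y' : VSet n) (s : Fin n) (xs zs : List (Fin n)) (In : List (Edge n)) : Set where
    field
      ks   : List (Kind n)
      zs'  : List (Fin n)
      In'  : List (Edge n)
      imm  : Imm Any-v (zipE xs zs ++ In) (pieces s xs ks ++ zipE (nexts s xs ks) zs' ++ In')
      st   : St Y' (nexts s xs ks) zs' In'
      len  : length ks ≡ k
      half : k ≤ sumOf (b2n ∘ touches) ks + sumOf (b2n ∘ touches) ks

  module _ {Y Y' : VSet n} {xs zs In} (st : St Y xs zs In) {s b} (Ss : S₀ s ≡ true) (Ys : Y s ≡ true) (Y's : Y' s ≡ false)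
           (sub : Y' ⊆ Y) (Sb : S₀ b ≡ true) (Y'b : Y' b ≡ true) (small' : d E₀ Y' ≤ k) where
    open St st
    private
      a≢s : a ≢ s
      a≢s refl = true≢false Ys Ya
      a≢b : a ≢ b
      a≢b refl = true≢false (sub b Y'b) Ya
      s≢b : s ≢ b
      s≢b refl = true≢false Y'b Y's
      open Three a s b a≢s a≢b s≢b
      open Parse Y Y' Ya Ys Y's Y'b sub

      Zip = zipE xs zs
      both : Edge n → Bool
      both (u , w) = Y' u ∧ Y' w
      In₁ = sieve both In
      In₂ = sieve (not ∘ both) In
      proper : Edge n → Bool
      proper (u , w) = nonloop (ρ u , ρ w)
      Touch = Zip ++ In₂
      Touch₁ = sieve proper Touch
      Eρ = mapE ρ Touch₁

      whole : Zip ++ In ↭ Touch ++ In₁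
      whole = ↭-trans (PP.++⁺ˡ Zip (↭-trans (sieve-halves both In) (PP.++-comm In₁ In₂))) (↭-reflexive (sym (++-assoc Zip In₂ In₁)))

      not-both : ∀ {u w} → (u , w) ∈ₗ Touch → Y' u ∧ Y' w ≡ false
      not-both {u} {w} i with ∈-++⁻ Zip i
      ... | inj₁ j = cong (_∧ Y' w) (¬true λ t → true≢false (sub _ t) (xs∉ (proj₁ (zip-∈ xs zs j))))
      ... | inj₂ j = not-f (proj₂ (sieve-∈ (not ∘ both) In j))

      loops : ∀ {u w} → (u , w) ∈ₗ Touch → proper (u , w) ≡ false → u ≡ w × Y u ≡ true × Y' u ≡ false
      loops {u} {w} i e with ∈-++⁻ Zip i | ==⇒≡ {u = ρ u} {ρ w} (unnot e)
      ... | inj₁ j | eq = ⊥-elim (true≢false (zs∈ (proj₂ (zip-∈ xs zs j))) (inv-a (trans (sym eq) (ρ-left (xs∉ (proj₁ (zip-∈ xs zs j)))))))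
      ... | inj₂ j | eq with In⊆ (proj₁ (sieve-∈ (not ∘ both) In j)) | place u | place w
      ...   | Yu , Yw | left f _ | _ = ⊥-elim (true≢false Yu f)
      ...   | Yu , Yw | right t r | _ = ⊥-elim (true≢false (∧-intro t (inv-b (trans (sym eq) r))) (not-both i))
      ...   | Yu , Yw | mid t f r | left g _ = ⊥-elim (true≢false Yw g)
      ...   | Yu , Yw | mid t f r | right t' r' = ⊥-elim (true≢false (inv-b (trans eq r')) f)
      ...   | Yu , Yw | mid t f r | mid _ _ r' = trans (sym r) (trans eq r') , t , f

      d-Touch : ∀ Z → d Touch₁ Z + d In₁ Z ≡ d (Zip ++ In) Z
      d-Touch Z = trans (cong (_+ d In₁ Z) (sumOf-sieve (cross Z) proper Touch λ {e} i f → cross-≡ Z (cong Z (proj₁ (loops i f)))))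
        (trans (sym (sumOf-++ (cross Z) Touch In₁)) (sym (d-↭ Z whole)))

      d-ρ : ∀ X → d Eρ X ≡ d (Zip ++ In) (X ∘ ρ)
      d-ρ X = trans (d-mapE ρ Touch₁ X) (trans (sym (+-identityʳ _)) (trans (cong (d Touch₁ (X ∘ ρ) +_) (sym (d-const In₁ λ i →
        let _ , e = sieve-∈ both In i ; p , q = ∧-elim e in cong X (trans (ρ-right p) (sym (ρ-right q)))))) (d-Touch (X ∘ ρ))))

      ρs : ρ s ≡ s
      ρs = ρ-mid Ys Y's
      ρb : ρ b ≡ b
      ρb = ρ-right Y'b
      ρa : ρ a ≡ a
      ρa = ρ-left Ya

      low : ∀ X → X a ≡ false → Sep S₃ X → k ≤ d Eρ X
      low X Xa ((t , St , Xt) , _) = subst (k ≤_) (sym (trans (d-ρ X) (cut= (X ∘ ρ) inY))) (conn (X ∘ ρ) (pt (which t St) Xt , (a , Sa , trans (cong X ρa) Xa)))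
        where
        inY : (X ∘ ρ) ⊆ Y
        inY v e with bool? (Y v)
        ... | inj₁ t = t
        ... | inj₂ f = ⊥-elim (true≢false e (trans (cong X (ρ-left f)) Xa))
        pt : ∀ {t} → Which t → X t ≡ true → ∃[ u ] S₀ u ≡ true × X (ρ u) ≡ true
        pt is-a e = ⊥-elim (true≢false e Xa)
        pt is-s e = s , Ss , trans (cong X ρs) e
        pt is-b e = b , Sb , trans (cong X ρb) e

      conn₃ : Conn k S₃ Eρ
      conn₃ X sep with bool? (X a)
      ... | inj₂ f = low X f sep
      ... | inj₁ t = subst (k ≤_) (SLike.com (d-SLike Eρ) X) (low (∁ X) (cong not t) (Sep-∁ sep))

      d-a : d Eρ (sg a) ≤ k
      d-a = ≤-trans (≤-reflexive (trans (d-ρ (sg a)) (trans (d-ext (Zip ++ In) pt) (trans (SLike.com (d-SLike (Zip ++ In)) Y) (cut= Y λ _ e → e))))) small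
        where pt : ∀ v → (ρ v == a) ≡ not (Y v)
              pt v with place v
              ... | right t r = trans (cong (_== a) r) (trans (≢⇒== (a≢b ∘ sym)) (sym (cong not (sub v t))))
              ... | left f r = trans (cong (_== a) r) (trans (==-refl a) (sym (not-t f)))
              ... | mid t f r = trans (cong (_== a) r) (trans (≢⇒== λ { refl → true≢false t Ya }) (sym (cong not t)))

      d-b : d Eρ (sg b) ≤ k
      d-b = ≤-trans (≤-reflexive (trans (d-ρ (sg b)) (trans (d-ext (Zip ++ In) pt) (cut= Y' sub)))) small'
        where pt : ∀ v → (ρ v == b) ≡ Y' v
              pt v with place v
              ... | right t r = trans (cong (_== b) r) (trans (==-refl b) (sym t))
              ... | left f r = trans (cong (_== b) r) (trans (≢⇒== a≢b) (sym (¬true λ t → true≢false (sub v t) f)))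
              ... | mid t f r = trans (cong (_== b) r) (trans (≢⇒== λ { refl → true≢false Y'b f }) (sym f))

      NonS : Fin n → Set
      NonS v = S₃ (ρ v) ≡ false

      ρ-inj : ∀ u v → ρ u ≡ ρ v → S₃ (ρ u) ≡ false → u ≡ v
      ρ-inj u v e f with place u | place v
      ... | right _ r | _ = ⊥-elim (true≢false (trans (cong S₃ r) S₃b) f)
      ... | left _ r | _ = ⊥-elim (true≢false (trans (cong S₃ r) S₃a) f)
      ... | mid _ _ r | right _ r' = ⊥-elim (true≢false (trans (cong S₃ (trans e r')) S₃b) f)
      ... | mid _ _ r | left _ r' = ⊥-elim (true≢false (trans (cong S₃ (trans e r')) S₃a) f)
      ... | mid _ _ r | mid _ _ r' = trans (sym r) (trans e r')

      sep-of : ∀ t → S₃ t ≡ true → (∃[ o ] S₃ o ≡ true × o ≢ t) → Sep S₃ (sg t)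
      sep-of t St (o , So , ne) = (t , St , ==-refl t) , (o , So , ≢⇒== ne)

      module Items (D : List (Edge n)) (iD : Imm NonS Touch₁ D) {els} (P : Parsed NonS els D)
                   (ca : k ≤ elcut els (sg a)) (ca' : elcut els (sg a) ≤ k) (cb : k ≤ elcut els (sg b)) (cb' : elcut els (sg b) ≤ k) (cs : k ≤ elcut els (sg s)) where
        open Parsed P renaming (imm to immP)

        sameAB : length As ≡ length Bs
        sameAB = +-cancelʳ-≡ (length Ms) _ _ (trans (sym cut-a) (trans (≤-antisym ca' ca) (trans (≤-antisym cb cb') cut-b)))

        dirs : List (Fin n) → List (Fin n) → List (Item n)
        dirs (x ∷ As) (z ∷ Bs) = (x , dir , z) ∷ dirs As Bs
        dirs _        _        = []

        Lst = dirs As Bs ++ Ms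

        dirs-imm : ∀ As Bs → length As ≡ length Bs → Imm NonS (map (_, s) As ++ map (s ,_) Bs) (itemsE s (dirs As Bs))
        dirs-imm [] [] e = idI
        dirs-imm (x ∷ As) (z ∷ Bs) e = consI (perm (PP.shift (s , z) (map (_, s) As) _) ⨾ consI (dirs-imm As Bs (suc-injective e)))

        itemsE-++ : ∀ L M → itemsE s (L ++ M) ≡ itemsE s L ++ itemsE s M
        itemsE-++ [] M = refl
        itemsE-++ (m ∷ L) M = trans (cong (itemE s m ++_) (itemsE-++ L M)) (sym (++-assoc (itemE s m) _ _))

        immL : Imm NonS Touch₁ (itemsE s Lst)
        immL = iD ⨾ immP ⨾ ≡I (sym (++-assoc (map (_, s) As) _ _)) ⨾ suffixI (dirs-imm As Bs sameAB) ⨾ ≡I (sym (itemsE-++ (dirs As Bs) Ms))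

        okDirs : ∀ As Bs → (∀ {x} → x ∈ₗ As → Y x ≡ false) → (∀ {z} → z ∈ₗ Bs → Y' z ≡ true) → ∀ {m} → m ∈ₗ dirs As Bs → OkItem m
        okDirs (x ∷ As) (z ∷ Bs) p q (here refl) = p (here refl) , q (here refl) , λ _ ()
        okDirs (x ∷ As) (z ∷ Bs) p q (there i) = okDirs As Bs (p ∘ there) (q ∘ there) i

        okL : ∀ {m} → m ∈ₗ Lst → OkItem m
        okL i = [ okDirs As Bs okA okB , okM ]′ (∈-++⁻ (dirs As Bs) i)

        dirs-len : ∀ As Bs → length As ≡ length Bs → length (dirs As Bs) ≡ length As
        dirs-len [] [] e = refl
        dirs-len (x ∷ As) (z ∷ Bs) e = cong suc (dirs-len As Bs (suc-injective e))

        lenL : length Lst ≡ k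
        lenL = trans (length-++ (dirs As Bs)) (trans (cong (_+ length Ms) (dirs-len As Bs sameAB)) (trans (sym cut-a) (≤-antisym ca' ca)))

        touching : List (Item n) → ℕ
        touching = sumOf (b2n ∘ touches ∘ kindI)

        dirs-touch : ∀ As Bs → length As ≡ length Bs → touching (dirs As Bs) ≡ length As
        dirs-touch [] [] e = refl
        dirs-touch (x ∷ As) (z ∷ Bs) e = cong suc (dirs-touch As Bs (suc-injective e))

        halfL : k ≤ touching Lst + touching Lst
        halfL = ≤-trans cs (≤-trans (≤-reflexive cut-s) (≤-trans (m≤m+n _ (touching Ms)) (≤-reflexive (trans (cong (λ z → length As + z + touching Ms + touching Ms) (sym sameAB))
          (trans (re (length As) (touching Ms)) (sym (cong (λ z → z + z) (trans (sumOf-++ _ (dirs As Bs) Ms) (cong (_+ touching Ms) (dirs-touch As Bs sameAB))))))))))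
          where re : ∀ x y → x + x + y + y ≡ (x + y) + (x + y)
                re = solve-∀

        lefts : ∀ L → (∀ {m} → m ∈ₗ L → OkItem m) → endsIn (∁ Y) (itemsE s L) ≡ map leftI L
        lefts [] h = refl
        lefts ((x , thru , z) ∷ L) h with p , q , _ ← h (here refl) = trans (pick-tf {P = ∁ Y} (not-t p) (cong not (sub z q)) _) (cong (x ∷_) (lefts L (h ∘ there)))
        lefts ((x , dir , z) ∷ L) h with p , q , _ ← h (here refl) = trans (pick-tf {P = ∁ Y} (not-t p) (cong not Ys) _)
          (cong (x ∷_) (trans (pick-ff {P = ∁ Y} (cong not Ys) (cong not (sub z q)) _) (lefts L (h ∘ there))))
        lefts ((x , tri y , z) ∷ L) h with p , q , r ← h (here refl) with Yy ← cong not (proj₂ (r y refl)) = trans (pick-tf {P = ∁ Y} (not-t p) Yy _)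
          (cong (x ∷_) (trans (pick-ff {P = ∁ Y} Yy (cong not Ys) _) (trans (pick-ff {P = ∁ Y} Yy (cong not (sub z q)) _) (lefts L (h ∘ there)))))

        rights : ∀ L → (∀ {m} → m ∈ₗ L → OkItem m) → endsIn Y' (itemsE s L) ≡ map rightI L
        rights [] h = refl
        rights ((x , thru , z) ∷ L) h with p , q , _ ← h (here refl) = trans (pick-ft {P = Y'} (¬true λ t → true≢false (sub x t) p) q _) (cong (z ∷_) (rights L (h ∘ there)))
        rights ((x , dir , z) ∷ L) h with p , q , _ ← h (here refl) = trans (pick-ff {P = Y'} (¬true λ t → true≢false (sub x t) p) Y's _)
          (trans (pick-ft {P = Y'} Y's q _) (cong (z ∷_) (rights L (h ∘ there))))
        rights ((x , tri y , z) ∷ L) h with p , q , r ← h (here refl) with y∉ ← proj₁ (r y refl) = trans (pick-ff {P = Y'} (¬true λ t → true≢false (sub x t) p) y∉ _)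
          (trans (pick-ff {P = Y'} y∉ Y's _) (trans (pick-ft {P = Y'} y∉ q _) (cong (z ∷_) (rights L (h ∘ there)))))

        xs↭ : xs ↭ map leftI Lst
        xs↭ = let lost , p = endsIn-Imm (∁ Y) (λ v e → cong not (inside-Y v e)) immL in
          no-rest (↭-trans (↭-reflexive (sym old)) (↭-trans p (PP.++⁺ʳ lost (↭-reflexive (lefts Lst okL))))) (≤-reflexive (trans lenx (trans (sym lenL) (sym (length-map leftI Lst)))))
          where
          inside-Y : ∀ v → NonS v → Y v ≡ true
          inside-Y v e with bool? (Y v)
          ... | inj₁ t = t
          ... | inj₂ f = ⊥-elim (true≢false (trans (cong S₃ (ρ-left f)) S₃a) e)
          old : endsIn (∁ Y) Touch₁ ≡ xs
          old = trans (endsIn-sieve (∁ Y) proper Touch λ i f → let e , t , _ = loops i f in cong not t , cong not (subst (λ z → Y z ≡ true) e t))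
            (trans (endsIn-++ (∁ Y) Zip In₂) (trans (cong₂ _++_ (zip-endsˡ (∁ Y) xs zs (trans lenx (sym lenz)) (λ i → not-t (xs∉ i)) (λ i → cong not (zs∈ i)))
              (endsIn-none (∁ Y) In₂ λ i → let p , q = In⊆ (proj₁ (sieve-∈ (not ∘ both) In i)) in cong not p , cong not q)) (++-identityʳ xs)))

        not-both₁ : ∀ {u w} → (u , w) ∈ₗ Touch₁ → Y' u ∧ Y' w ≡ false
        not-both₁ i = not-both (proj₁ (sieve-∈ proper Touch i))

        ws = endsIn Y' Touch₁

        ws↭ : ws ↭ map rightI Lst
        ws↭ = let lost , p = endsIn-Imm Y' outside immL in no-rest (↭-trans p (PP.++⁺ʳ lost (↭-reflexive (rights Lst okL))))
            (≤-trans (≤-reflexive (trans (sym (sum-ends Y' ws (endsIn-all Y' Touch₁))) (trans (sym (d-endsIn Y' Y' Touch₁ (λ _ e → e) not-both₁))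
              (trans (sym (+-identityʳ _)) (trans (cong (d Touch₁ Y' +_) (sym (d-const In₁ λ i → let _ , e = sieve-∈ both In i ; p , q = ∧-elim e in trans p (sym q)))) (trans (d-Touch Y') (cut= Y' sub)))))))
              (≤-trans small' (≤-reflexive (trans (sym lenL) (sym (length-map rightI Lst))))))
          where
          outside : ∀ v → NonS v → Y' v ≡ false
          outside v e = ¬true λ t → true≢false (trans (cong S₃ (ρ-right t)) S₃b) e

        normalised : Step Y' s xs zs In
        normalised with L , e , q ← PP.↭-map-inv leftI (↭-sym xs↭) = record
          { ks = ks ; zs' = zs' ; In' = In₁
          ; imm = perm whole ⨾ suffixI (filterI proper Touch ⨾ weaken (λ _ _ → tt) immL ⨾ perm (concat-↭ (PP.map⁺ (itemE s) q)) ⨾ items-pieces s L ⨾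
                   ≡I (cong (λ z → pieces s z ks ++ zipE (nexts s z ks) zs') (sym e))) ⨾ ≡I (++-assoc (pieces s xs ks) _ In₁)
          ; st = record
            { Ya = a∉Y' ; small = small' ; lenx = trans (nexts-len xs ks) lenx ; lenz = trans (length-map rightI L) lenL'
            ; xs∉ = xs'∉ ; zs∈ = zs'∈
            ; In⊆ = λ i → ∧-elim (proj₂ (sieve-∈ both In i)) ; cut= = cut' }
          ; len = trans (length-map kindI L) lenL'
          ; half = ≤-trans halfL (≤-reflexive (cong (λ z → z + z) (trans (sumOf-↭ _ q) (sym (sumOf-map (b2n ∘ touches) kindI L))))) }
          where
          ks = map kindI L
          zs' = map rightI L
          okL' : ∀ {m} → m ∈ₗ L → OkItem m
          okL' i = okL (PP.∈-resp-↭ (↭-sym q) i)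
          lenL' : length L ≡ k
          lenL' = trans (sym (PP.↭-length q)) lenL
          nexts-len : ∀ xs ks → length (nexts s xs ks) ≡ length xs
          nexts-len [] ks = refl
          nexts-len (x ∷ xs) [] = refl
          nexts-len (x ∷ xs) (κ ∷ ks) = cong suc (nexts-len xs ks)
          next∉ : ∀ L → (∀ {m} → m ∈ₗ L → OkItem m) → ∀ {x} → x ∈ₗ nexts s (map leftI L) (map kindI L) → Y' x ≡ false
          next∉ ((x , κ , z) ∷ L) h (there i) = next∉ L (h ∘ there) i
          next∉ ((x , thru , z) ∷ L) h (here refl) = ¬true λ t → true≢false (sub x t) (proj₁ (h (here refl)))
          next∉ ((x , dir , z) ∷ L) h (here refl) = Y's
          next∉ ((x , tri y , z) ∷ L) h (here refl) = proj₁ (proj₂ (proj₂ (h (here refl))) y refl)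
          zs'∈ : ∀ {z} → z ∈ₗ zs' → Y' z ≡ true
          zs'∈ i = let m , j , eq = ∈-map⁻ rightI i in subst (λ z → Y' z ≡ true) (sym eq) (proj₁ (proj₂ (okL' j)))
          xs'∉ : ∀ {x} → x ∈ₗ nexts s xs ks → Y' x ≡ false
          xs'∉ {x} i = next∉ L okL' (subst (λ z → x ∈ₗ nexts s z ks) e i)
          cut' : ∀ Z → Z ⊆ Y' → d (zipE (nexts s xs ks) zs' ++ In₁) Z ≡ d E₀ Z
          cut' Z Z⊆ = trans (sumOf-++ (cross Z) (zipE (nexts s xs ks) zs') In₁) (trans (cong (_+ d In₁ Z) (trans
              (d-endsIn Y' Z (zipE (nexts s xs ks) zs') Z⊆ λ {u} {w} i → cong (_∧ Y' w) (xs'∉ (proj₁ (zip-∈ _ zs' i))))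
              (trans (cong (sumOf (b2n ∘ Z)) (zip-endsʳ Y' (nexts s xs ks) zs' (trans (nexts-len xs ks) (trans lenx (sym (trans (length-map rightI L) lenL')))) xs'∉ zs'∈))
                (trans (sumOf-↭ (b2n ∘ Z) (↭-sym (↭-trans ws↭ (PP.map⁺ rightI q)))) (sym (d-endsIn Y' Z Touch₁ Z⊆ not-both₁))))))
            (trans (d-Touch Z) (cut= Z λ v → sub v ∘ Z⊆ v)))

    private
      finish : Reduced k Eρ → Step Y' s xs zs In
      finish (els , i , good , cut) = lifted (liftI ρ ρ-inj i Touch₁ refl)
        where
        lifted : Σ[ D ∈ List (Edge n) ] Imm NonS Touch₁ D × mapE ρ D ≡ flat els → Step Y' s xs zs In
        lifted (D , j , e) = Items.normalised D j (parse els D e good) (cut (sg a) (sep-of a S₃a (s , S₃s , a≢s ∘ sym))) (≤-trans (elnm-≤ (sg a) els) (≤-trans (d-Imm i (sg a)) d-a))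
          (cut (sg b) (sep-of b S₃b (s , S₃s , s≢b))) (≤-trans (elnm-≤ (sg b) els) (≤-trans (d-Imm i (sg b)) d-b)) (cut (sg s) (sep-of s S₃s (a , S₃a , a≢s)))

    region : Step Y' s xs zs In
    region = finish (reduce₃ 2≤k Eρ conn₃)

Unique-⊆ : {xs ys : List A} → xs Sublist.⊆ ys → Unique ys → Unique xs
Unique-⊆ Sublist.[]         _        = []
Unique-⊆ (_ Sublist.∷ʳ p)   (_ ∷ us) = Unique-⊆ p us
Unique-⊆ (refl Sublist.∷ p) (u ∷ us) = SublistP.All-resp-⊆ p u ∷ Unique-⊆ p us

sumOf-positive : (p : A → Bool) → ∀ xs → 1 ≤ sumOf (b2n ∘ p) xs → ∃[ x ] x ∈ₗ xs × p x ≡ true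
sumOf-positive p (x ∷ xs) le with p x in eq
... | true  = x , here refl , eq
... | false = let y , i , e = sumOf-positive p xs le in y , there i , e

record Leaving {n} (E : List (Edge n)) (Y : VSet n) : Set where
  field
    xs zs   : List (Fin n)
    In      : List (Edge n)
    imm     : Imm Any-v E (zipE xs zs ++ In)
    lenx    : length xs ≡ d E Y
    lenz    : length zs ≡ d E Y
    xs∉     : ∀ {x} → x ∈ₗ xs → Y x ≡ false
    zs∈     : ∀ {z} → z ∈ₗ zs → Y z ≡ true
    In⊆     : ∀ {u w} → (u , w) ∈ₗ In → Y u ≡ true × Y w ≡ true
    cut=    : ∀ Z → Z ⊆ Y → d (zipE xs zs ++ In) Z ≡ d E Z

leaving : ∀ (Y : VSet n) E → Leaving E Y
leaving Y [] = record { xs = [] ; zs = [] ; In = [] ; imm = idI ; lenx = refl ; lenz = refl ; xs∉ = λ () ; zs∈ = λ () ; In⊆ = λ () ; cut= = λ _ _ → refl }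
leaving {n} Y ((u , w) ∷ E) = choose (bool? (Y u)) (bool? (Y w))
  where
  open Leaving (leaving Y E)
  ∈-∷ : {P : Fin n → Set} {x : Fin n} {ys : List (Fin n)} → P x → (∀ {y} → y ∈ₗ ys → P y) → ∀ {y} → y ∈ₗ x ∷ ys → P y
  ∈-∷ p q (here refl) = p
  ∈-∷ p q (there i) = q i
  choose : (Y u ≡ true) ⊎ (Y u ≡ false) → (Y w ≡ true) ⊎ (Y w ≡ false) → Leaving ((u , w) ∷ E) Y
  choose (inj₁ p) (inj₁ q) = record { xs = xs ; zs = zs ; In = (u , w) ∷ In ; imm = consI imm ⨾ perm (↭-sym (PP.shift (u , w) (zipE xs zs) In))
    ; lenx = trans lenx zero-cross ; lenz = trans lenz zero-cross ; xs∉ = xs∉ ; zs∈ = zs∈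
    ; In⊆ = λ { (here refl) → p , q ; (there i) → In⊆ i }
    ; cut= = λ Z s → trans (d-↭ Z (PP.shift (u , w) (zipE xs zs) In)) (cong (cross Z (u , w) +_) (cut= Z s)) }
    where zero-cross : d E Y ≡ cross Y (u , w) + d E Y
          zero-cross = cong (_+ d E Y) (sym (cross-≡ Y (trans p (sym q))))
  choose (inj₁ p) (inj₂ q) = record { xs = w ∷ xs ; zs = u ∷ zs ; In = In ; imm = flip ⨾ consI imm
    ; lenx = trans (cong suc lenx) one-cross ; lenz = trans (cong suc lenz) one-cross ; xs∉ = ∈-∷ q xs∉ ; zs∈ = ∈-∷ p zs∈ ; In⊆ = In⊆
    ; cut= = λ Z s → cong₂ _+_ (cross-flip Z w u) (cut= Z s) }
    where one-cross : suc (d E Y) ≡ cross Y (u , w) + d E Y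
          one-cross = cong (_+ d E Y) (sym (cross-tf Y p q))
  choose (inj₂ p) (inj₁ q) = record { xs = u ∷ xs ; zs = w ∷ zs ; In = In ; imm = consI imm
    ; lenx = trans (cong suc lenx) one-cross ; lenz = trans (cong suc lenz) one-cross ; xs∉ = ∈-∷ p xs∉ ; zs∈ = ∈-∷ q zs∈ ; In⊆ = In⊆
    ; cut= = λ Z s → cong (cross Z (u , w) +_) (cut= Z s) }
    where one-cross : suc (d E Y) ≡ cross Y (u , w) + d E Y
          one-cross = cong (_+ d E Y) (sym (cross-ft Y p q))
  choose (inj₂ p) (inj₂ q) = record { xs = xs ; zs = zs ; In = In ; imm = del ⨾ imm
    ; lenx = trans lenx zero-cross ; lenz = trans lenz zero-cross ; xs∉ = xs∉ ; zs∈ = zs∈ ; In⊆ = In⊆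
    ; cut= = λ Z s → trans (cut= Z s) (cong (_+ d E Z) (sym (cross-≡ Z (trans (out s p) (sym (out s q)))))) }
    where zero-cross : d E Y ≡ cross Y (u , w) + d E Y
          zero-cross = cong (_+ d E Y) (sym (cross-≡ Y (trans p (sym q))))
          out : ∀ {Z v} → Z ⊆ Y → Y v ≡ false → Z v ≡ false
          out {v = v} s f = ¬true λ t → true≢false (s v t) f

module Chains {n} (k M : ℕ) (2≤k : 2 ≤ k) (S : VSet n) (E : List (Edge n)) (conn : Conn k S E) (a : Fin n) (Sa : S a ≡ true) where
  open Dichotomy {n} k M
  open Normalise k 2≤k S E conn a Sa

  chain-end : ∀ {Y j} → Chain E S Y j → ∃[ b ] S b ≡ true × Y b ≡ true
  chain-end (end {b} Sb Yb) = b , Sb , Yb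
  chain-end (link {s} Ss Ys _ _ _ _) = s , Ss , Ys

  Good : VSet n → Region n → Set
  Good Y (s , ks) = S s ≡ true × Y s ≡ true × length ks ≡ k × k ≤ sumOf (b2n ∘ touches) ks + sumOf (b2n ∘ touches) ks

  record Regions (Y : VSet n) (xs zs : List (Fin n)) (In : List (Edge n)) (j : ℕ) : Set where
    field
      {rs}   : List (Region n)
      number : length rs ≡ j
      good   : All (Good Y) rs
      unique : Unique (map proj₁ rs)
      imm    : Imm Any-v (zipE xs zs ++ In) (diagram rs xs)

  regions : ∀ {Y xs zs In j} → St Y xs zs In → Chain E S Y j → Regions Y xs zs In j
  regions {xs = xs} {zs} {In} st (end _ _) = record { number = refl ; good = [] ; unique = [] ; imm = clearI (zipE xs zs ++ In) }
  regions {Y} {xs} {zs} {In} {suc j} st (link {s} {Y'} Ss Ys Y's sub le chain) with b , Sb , Y'b ← chain-end chain = extend (region st Ss Ys Y's sub Sb Y'b le)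
    where
    extend : Step Y' s xs zs In → Regions Y xs zs In (suc j)
    extend record { ks = ks ; imm = imm ; st = st' ; len = len ; half = half } = record
      { number = cong suc number
      ; good = (Ss , Ys , len , half) ∷ All.map (λ (p , q , r) → p , sub _ q , r) good
      ; unique = AllP.map⁺ (All.map (λ { (_ , q , _) refl → true≢false q Y's }) good) ∷ unique
      ; imm = imm ⨾ prefixI (pieces s xs ks) imm' }
      where open Regions (regions st' chain) renaming (imm to imm')

  module _ (t r : ℕ) (8t≤ : 8 * t ≤ suc k) where
    enough : ∀ {x} → k ≤ x + x → t + t + (t + t) ≤ x
    enough {x} h = ≮⇒≥ λ lt → 1+n≰n (≤-trans (≤-reflexive (cong suc (sym (+-suc x x)))) (≤-trans (+-mono-≤ lt lt) (≤-trans (≤-reflexive (re t)) (≤-trans 8t≤ (s≤s h)))))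
      where re : ∀ t → t + t + (t + t) + (t + t + (t + t)) ≡ 8 * t
            re = solve-∀

    chain-target : Chained E S a (suc r * 2 ^ k) → Target t r S E
    chain-target (chained {Y} out le chain) = use (regions initial chain)
      where
      open Leaving (leaving Y E)
      tight : d E Y ≡ k
      tight = ≤-antisym le (conn Y (chain-end chain , (a , Sa , proj₁ out)))
      initial : St Y xs zs In
      initial = record { Ya = proj₁ out ; small = le ; lenx = trans lenx tight ; lenz = trans lenz tight ; xs∉ = xs∉ ; zs∈ = zs∈ ; In⊆ = In⊆ ; cut= = cut= }
      use : Regions Y xs zs In (suc r * 2 ^ k) → Target t r S E
      use record { rs = rs ; number = number ; good = good ; unique = unique ; imm = imm' } =
        common (pigeonhole k (suc r) (map mask rs) lens (≤-reflexive (sym (trans (length-map mask rs) number))))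
        where
        lens : ∀ {m} → m ∈ₗ map mask rs → length m ≡ k
        lens i with (s , ks) , j , refl ← ∈-map⁻ mask i with _ , _ , len , _ ← All.lookup good j = trans (length-map touches ks) len
        common : Σ[ μ ∈ List Bool ] length μ ≡ k × suc r ≤ sumOf (λ m → b2n (m =ᵐ μ)) (map mask rs) → Target t r S E
        common (μ , lenμ , many) with (s , ks) , i , e ← sumOf-positive (λ ρ → mask ρ =ᵐ μ) rs (≤-trans (s≤s z≤n) (≤-trans many (≤-reflexive (sumOf-map _ mask rs)))) =
            finish (Run.start (t + t) μ (enough half) rs xs r (trans (colour-length (t + t) (t + t) μ) (trans lenμ (sym (trans lenx tight))))
              (≤-trans many (≤-reflexive (sumOf-map _ mask rs))))
          where
          half : k ≤ trues μ + trues μ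
          half = subst (λ m → k ≤ trues m + trues m) (=ᵐ⇒≡ (map touches ks) μ e) (≤-trans (proj₂ (proj₂ (proj₂ (All.lookup good i))))
            (≤-reflexive (sym (cong (λ z → z + z) (sumOf-map b2n touches ks)))))
          finish : Σ[ v ∈ Fin n ] Σ[ L ∈ List (Fin n) ] (length L ≡ r × (v ∷ L) Sublist.⊆ map proj₁ rs × Imm Any-v (diagram rs xs) (concat (map (replicate (t + t)) (pw (v ∷ L))))) → Target t r S E
          finish (v , L , len , sl , i) with Unique-⊆ sl unique
          ... | _ ∷ u = record { L = L ; lengthL = len ; unique = u
            ; termL = λ j → let ρ , p , eq = ∈-map⁻ proj₁ (Sublist.lookup sl (there j)) in trans (cong S eq) (proj₁ (All.lookup good p))
            ; imm = imm ⨾ imm' ⨾ i ⨾ fold-path t v L }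

module Realise (G : Graph) where
  V = Fin (nV G)
  Ed = Fin (nE G)

  _▷_ : ∀ {u v w : V} → Walk G u v → Walk G v w → Walk G u w
  stop ▷ q = q
  step e j p ▷ q = step e j (p ▷ q)

  edges-▷ : ∀ {u v w} (p : Walk G u v) (q : Walk G v w) → edges G (p ▷ q) ≡ edges G p ++ edges G q
  edges-▷ stop q = refl
  edges-▷ (step e j p) q = cong (e ∷_) (edges-▷ p q)

  back : ∀ {u v w} → Walk G u v → Walk G u w → Walk G v w
  back stop q = q
  back (step e (inj₁ j) p) q = back p (step e (inj₂ j) q)
  back (step e (inj₂ j) p) q = back p (step e (inj₁ j) q)

  edges-back : ∀ {u v w} (p : Walk G u v) (q : Walk G u w) → edges G (back p q) ↭ edges G p ++ edges G q
  edges-back stop q = ↭-refl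
  edges-back (step e (inj₁ j) p) q = ↭-trans (edges-back p _) (PP.shift e (edges G p) (edges G q))
  edges-back (step e (inj₂ j) p) q = ↭-trans (edges-back p _) (PP.shift e (edges G p) (edges G q))

  W : Edge (nV G) → Set
  W (u , w) = Walk G u w

  used : {f : A → Edge (nV G)} {xs : List A} → All (W ∘ f) xs → List Ed
  used []       = []
  used (p ∷ ps) = edges G p ++ used ps

  W-↭ : ∀ {E E'} → E ↭ E' → (ps : All W E) → Σ[ qs ∈ All W E' ] used ps ↭ used qs
  W-↭ P.refl ps = ps , ↭-refl
  W-↭ (P.prep _ i) (p ∷ ps) = let qs , j = W-↭ i ps in p ∷ qs , PP.++⁺ˡ (edges G p) j
  W-↭ (P.swap _ _ i) (p ∷ q ∷ ps) = let qs , j = W-↭ i ps in q ∷ p ∷ qs , ↭-trans (PP.++⁺ˡ (edges G p) (PP.++⁺ˡ (edges G q) j)) (PP.shifts (edges G p) (edges G q))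
  W-↭ (P.trans i i') ps = let qs , j = W-↭ i ps ; rs , j' = W-↭ i' qs in rs , ↭-trans j j'

  W-Imm : ∀ {Q : V → Set} {E E'} → Imm Q E E' → (ps : All W E) → Σ[ qs ∈ All W E' ] Σ[ D ∈ List Ed ] used ps ↭ D ++ used qs
  W-Imm (perm i) ps = let qs , j = W-↭ i ps in qs , [] , j
  W-Imm (i ⨾ i') ps = let qs , D , j = W-Imm i ps ; rs , D' , j' = W-Imm i' qs in rs , D ++ D' , ↭-trans j (↭-trans (PP.++⁺ˡ D j') (↭-reflexive (sym (++-assoc D D' _))))
  W-Imm del (p ∷ ps) = ps , edges G p , ↭-refl
  W-Imm flip (p ∷ ps) = back p stop ∷ ps , [] , PP.++⁺ʳ (used ps) (↭-sym (↭-trans (edges-back p stop) (↭-reflexive (++-identityʳ _))))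
  W-Imm (split _) (p ∷ q ∷ ps) = p ▷ q ∷ ps , [] , ↭-reflexive (sym (trans (cong (_++ used ps) (edges-▷ p q)) (++-assoc (edges G p) (edges G q) _)))

  Unique-++ʳ : (D : List A) {L : List A} → Unique (D ++ L) → Unique L
  Unique-++ʳ []      u       = u
  Unique-++ʳ (_ ∷ D) (_ ∷ u) = Unique-++ʳ D u

  Unique-↭ : {L M : List A} → L ↭ M → Unique L → Unique M
  Unique-↭ {A} i = Unique-resp-↭ (↭⇒↭ₛ i)
    where open import Data.List.Relation.Binary.Permutation.Setoid.Properties (setoid A) using (Unique-resp-↭)

  Unique-disjoint : (L : List A) {M : List A} → Unique (L ++ M) → Disjoint L M
  Unique-disjoint (x ∷ L) (a ∷ u) (here refl , j) = All.lookup a (∈-++⁺ʳ L j) refl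
  Unique-disjoint (x ∷ L) (a ∷ u) (there i , j) = Unique-disjoint L u (i , j)

  used-∈ : {f : A → Edge (nV G)} {xs : List A} (ps : All (W ∘ f) xs) {x : A} (i : x ∈ₗ xs) {e : Ed} → e ∈ₗ edges G (All.lookup ps i) → e ∈ₗ used ps
  used-∈ (p ∷ ps) (here refl) j = ∈-++⁺ˡ j
  used-∈ (p ∷ ps) (there i) j = ∈-++⁺ʳ (edges G p) (used-∈ ps i j)

  used-disjoint : {f : A → Edge (nV G)} {xs : List A} (ps : All (W ∘ f) xs) → Unique (used ps) → ∀ {x y} (i : x ∈ₗ xs) (j : y ∈ₗ xs) → x ≢ y →
    Disjoint (edges G (All.lookup ps i)) (edges G (All.lookup ps j))
  used-disjoint (p ∷ ps) u (here refl) (here refl) ne = contradiction refl ne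
  used-disjoint (p ∷ ps) u (here refl) (there j) ne (a , b) = Unique-disjoint (edges G p) u (a , used-∈ ps j b)
  used-disjoint (p ∷ ps) u (there i) (here refl) ne (a , b) = Unique-disjoint (edges G p) u (b , used-∈ ps i a)
  used-disjoint (p ∷ ps) u (there i) (there j) ne = used-disjoint ps (Unique-++ʳ (edges G p) u) i j ne

  used-map⁻ : {f : A → Edge (nV G)} (xs : List A) (ps : All W (map f xs)) → used (AllP.map⁻ {xs = xs} ps) ≡ used ps
  used-map⁻ []       []       = refl
  used-map⁻ (x ∷ xs) (p ∷ ps) = cong (edges G p ++_) (used-map⁻ xs ps)

  suffix : ∀ {u v x} (p : Walk G u v) → x ∈ₗ verts G p → IsPath G p → Σ[ q ∈ Walk G x v ] IsPath G q × (∀ {e} → e ∈ₗ edges G q → e ∈ₗ edges G p)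
  suffix stop (here refl) u = stop , u , id
  suffix (step e j p) (here refl) u = step e j p , u , id
  suffix (step e j p) (there i) (_ ∷ u) = let q , u' , h = suffix p i u in q , u' , there ∘ h

  shorten : ∀ {u v} (p : Walk G u v) → Σ[ q ∈ Walk G u v ] IsPath G q × (∀ {e} → e ∈ₗ edges G q → e ∈ₗ edges G p)
  shorten stop = stop , [] ∷ [] , id
  shorten {u} (step e j p) with q , path , h ← shorten p with u ∈? verts G q
  ... | yes i = let q' , path' , h' = suffix q i path in q' , path' , there ∘ h ∘ h'
  ... | no u∉ = step e j q , AllP.¬Any⇒All¬ _ u∉ ∷ path , λ { (here refl) → here refl ; (there i) → there (h i) }

  list : List (Edge (nV G))
  list = map (ends G) (allFin (nE G))

  single : (es : List Ed) → Σ[ ps ∈ All W (map (ends G) es) ] used ps ≡ es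
  single [] = [] , refl
  single (e ∷ es) = let ps , q = single es in step e (inj₁ refl) stop ∷ ps , cong (e ∷_) q

  connected : ∀ k (S : Subset (nV G)) → EdgeConnectedSet G k S → Conn k (Vec.lookup S) list
  connected k S c X ((u , Su , Xu) , (w , Sw , Xw)) = ≮⇒≥ λ lt → avoid (c u w (VecP.lookup⇒[]= u S Su) (VecP.lookup⇒[]= w S Sw) F (≤-trans (s≤s (≤-reflexive (length-F (allFin (nE G))))) lt))
    where
    crossing : Ed → Bool
    crossing e = X (proj₁ (ends G e)) xor X (proj₂ (ends G e))
    F = sieve crossing (allFin (nE G))
    bit : ∀ a b → nm a b b ≡ b2n (a xor b)
    bit true  true  = refl
    bit true  false = refl
    bit false true  = refl
    bit false false = refl
    length-F : ∀ es → length (sieve crossing es) ≡ d (map (ends G) es) X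
    length-F [] = refl
    length-F (e ∷ es) rewrite bit (X (proj₁ (ends G e))) (X (proj₂ (ends G e))) with crossing e
    ... | true  = cong suc (length-F es)
    ... | false = length-F es
    stays : ∀ {u w} (p : Walk G u w) → All (λ e → e ∉ₗ F) (edges G p) → X u ≡ X w
    stays stop _ = refl
    stays (step e j p) (a ∷ as) = trans (across j) (stays p as)
      where
      agree : X (proj₁ (ends G e)) ≡ X (proj₂ (ends G e))
      agree = xor-≡ (¬true λ t → a (∈-sieve crossing (∈-allFin e) t))
      across : ∀ {u w} → Joins G e u w → X u ≡ X w
      across (inj₁ q) = trans (cong X (sym (cong proj₁ q))) (trans agree (cong X (cong proj₂ q)))
      across (inj₂ q) = trans (cong X (sym (cong proj₂ q))) (trans (sym agree) (cong X (cong proj₁ q)))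
    avoid : ¬ ConnectedAvoiding G F u w
    avoid (p , _ , as) = true≢false Xu (trans (stays p as) Xw)

  cyclic : (L : List V) → Fin (length L) → Edge (nV G)
  cyclic L i = L ‼ i , L ‼ cnext i

  cyc-tabulate : ∀ L → Words.cyc L ≡ map (cyclic L) (allFin (length L))
  cyc-tabulate [] = refl
  cyc-tabulate (l ∷ L) = trans (go l L l (λ i → (l ∷ L) ‼ cnext i) (λ i → cong ((l ∷ L) ‼_) (cnext-inject₁ i)) (cong ((l ∷ L) ‼_) (cnext-last (length L)))) (sym (map-tabulate id (cyclic (l ∷ L))))
    where
    cnext-inject₁ : ∀ {m} (i : Fin m) → cnext (F.inject₁ i) ≡ F.suc i
    cnext-inject₁ {m} i = FP.toℕ-injective (trans (FP.toℕ-fromℕ< _) (trans (m<n⇒m%n≡m (s≤s (subst (_< m) (sym (FP.toℕ-inject₁ i)) (FP.toℕ<n i)))) (cong suc (FP.toℕ-inject₁ i))))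
    cnext-last : ∀ m → cnext (F.fromℕ m) ≡ F.zero
    cnext-last m = FP.toℕ-injective (trans (FP.toℕ-fromℕ< _) (trans (cong (λ z → suc z % suc m) (FP.toℕ-fromℕ m)) (n%n≡0 (suc m))))
    go : ∀ u L z (f : Fin (suc (length L)) → V) → (∀ i → f (F.inject₁ i) ≡ L ‼ i) → f (F.fromℕ (length L)) ≡ z → pw (u ∷ L ++ z ∷ []) ≡ tabulate λ i → (u ∷ L) ‼ i , f i
    go u [] z f h e = cong (λ z → (u , z) ∷ []) (sym e)
    go u (x ∷ L) z f h e = cong₂ _∷_ (cong (u ,_) (sym (h F.zero))) (go x L z (f ∘ F.suc) (h ∘ F.suc) e)

  copies : (f : A → C) (js : List B) (ks : List A) → concat (replicate (length js) (map f ks)) ≡ map (f ∘ proj₂) (cartesianProduct js ks)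
  copies f [] ks = refl
  copies f (j ∷ js) ks = trans (cong₂ _++_ (map-∘ {g = f ∘ proj₂} {j ,_} ks) (copies f js ks)) (sym (map-++ (f ∘ proj₂) (map (j ,_) ks) _))

  lookup-injective : ∀ (L : List A) → Unique L → ∀ {i j} → L ‼ i ≡ L ‼ j → i ≡ j
  lookup-injective (x ∷ L) (a ∷ u) {F.zero}  {F.zero}  e = refl
  lookup-injective (x ∷ L) (a ∷ u) {F.zero}  {F.suc j} e = contradiction e (All.lookup a (∈-lookup j))
  lookup-injective (x ∷ L) (a ∷ u) {F.suc i} {F.zero}  e = contradiction (sym e) (All.lookup a (∈-lookup i))
  lookup-injective (x ∷ L) (a ∷ u) {F.suc i} {F.suc j} e = cong F.suc (lookup-injective L u e)

  immersion : ∀ {t r} (S : Subset (nV G)) → Target t r (Vec.lookup S) list → CImmersion t r G S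
  immersion {t} S record { L = L ; lengthL = refl ; unique = unique ; termL = termL ; imm = imm } = build (W-Imm imm (proj₁ (single (allFin (nE G)))))
    where
    js = allFin t
    ks = allFin (length L)
    K = cartesianProduct js ks
    copied : concat (replicate t (Words.cyc L)) ≡ map (cyclic L ∘ proj₂) K
    copied = trans (cong₂ (λ m C → concat (replicate m C)) {t} {length js} (sym (length-tabulate id)) (cyc-tabulate L)) (copies (cyclic L) js ks)
    build : Σ[ qs ∈ All W (concat (replicate t (Words.cyc L))) ] Σ[ D ∈ List Ed ] used (proj₁ (single (allFin (nE G)))) ↭ D ++ used qs → CImmersion t (length L) G S
    build (qs , D , i) = from (subst (λ E → Σ[ qs ∈ All W E ] Unique (used qs)) copied (qs , Unique-++ʳ D (Unique-↭ i (subst Unique (sym (proj₂ (single (allFin (nE G))))) (allFin⁺ _)))))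
      where
      from : Σ[ qs ∈ All W (map (cyclic L ∘ proj₂) K) ] Unique (used qs) → CImmersion t (length L) G S
      from (qs , u) = record
        { π = L ‼_ ; π-inj = lookup-injective L unique ; π-in-S = λ i → VecP.lookup⇒[]= _ S (termL (∈-lookup i))
        ; path = λ i j → proj₁ (short i j) ; path-isPath = λ i j → proj₁ (proj₂ (short i j))
        ; edge-disjoint = λ i j i' j' ne (a , b) → used-disjoint ws (subst Unique (sym (used-map⁻ K qs)) u) (at i j) (at i' j') (λ { refl → ne refl })
            (proj₂ (proj₂ (short i j)) a , proj₂ (proj₂ (short i' j')) b) }
        where
        ws : All (W ∘ (cyclic L ∘ proj₂)) K
        ws = AllP.map⁻ qs
        at : ∀ i j → (j , i) ∈ₗ K
        at i j = ∈-cartesianProduct⁺ (∈-allFin j) (∈-allFin i)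
        short : ∀ i j → Σ[ q ∈ Walk G (L ‼ i) (L ‼ cnext i) ] IsPath G q × (∀ {e} → e ∈ₗ edges G q → e ∈ₗ edges G (All.lookup ws (at i j)))
        short i j = shorten (All.lookup ws (at i j))

size-∣∣ : (S : Subset n) → size (Vec.lookup S) ≡ ∣ S ∣
size-∣∣ Vec.[] = refl
size-∣∣ {suc n} (s Vec.∷ S) = trans (cong (b2n s +_) (trans (cong (sumOf (b2n ∘ Vec.lookup (s Vec.∷ S))) (sym (map-tabulate id F.suc))) (trans (sumOf-map _ F.suc (allFin n)) (size-∣∣ S)))) (add s)
  where
  add : ∀ s → b2n s + ∣ S ∣ ≡ ∣ s Vec.∷ S ∣
  add true  = refl
  add false = refl

module _ (t' r : ℕ) (1≤r : 1 ≤ r) where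
  private
    t = suc t'
    k = 15 * t ∸ 6
    M = suc (tower t r)
    N = suc r * 2 ^ k

    k≡ : k ≡ 15 * t' + 9
    k≡ = trans (cong (_∸ 6) (re t')) (m+n∸n≡m (15 * t' + 9) 6)
      where re : ∀ t' → 15 * suc t' ≡ 15 * t' + 9 + 6
            re = solve-∀
    2≤k : 2 ≤ k
    2≤k = ≤-trans (≤-trans (s≤s (s≤s z≤n)) (m≤n+m 9 (15 * t'))) (≤-reflexive (sym k≡))
    6t≤k : 3 * (t + t) ≤ k
    6t≤k = ≤-trans (≤-trans (m≤m+n _ (9 * t' + 3)) (≤-reflexive (re t'))) (≤-reflexive (sym k≡))
      where re : ∀ t' → 3 * (suc t' + suc t') + (9 * t' + 3) ≡ 15 * t' + 9
            re = solve-∀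
    8t≤k+1 : 8 * t ≤ suc k
    8t≤k+1 = ≤-trans (≤-trans (m≤m+n _ (7 * t' + 2)) (≤-reflexive (re t'))) (s≤s (≤-reflexive (sym k≡)))
      where re : ∀ t' → 8 * suc t' + (7 * t' + 2) ≡ suc (15 * t' + 9)
            re = solve-∀

  bound : ℕ
  bound = suc (threshold M N)

  target : ∀ (S : VSet n) E → Conn k S E → bound ≤ size S → Target t r S E
  target {n} S E conn le with a , _ , Sa ← sumOf-positive S (allFin n) (≤-trans (s≤s z≤n) le) = reduce (minimise _ E ≤-refl conn)
    where
    weakenT : ∀ {S' E'} → Imm Any-v E E' → S' ⊆ S → Target t r S' E' → Target t r S E
    weakenT i s record { L = L ; lengthL = len ; unique = u ; termL = h ; imm = j } = record { L = L ; lengthL = len ; unique = u ; termL = λ m → s _ (h m) ; imm = i ⨾ j }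
    reduce : Σ[ E' ∈ List (Edge n) ] Imm Any-v E E' × Conn k S E' × AllTight k S E' → Target t r S E
    reduce (E₁ , i , conn₁ , tight) = split' (Dichotomy.star-or-chain k M N E₁ S a conn₁ tight Sa (≤-trans (n≤1+n _) le))
      where
      split' : Star M k S E₁ ⊎ Dichotomy.Chained k M E₁ S a N → Target t r S E
      split' (inj₁ (E₂ , S₂ , j , conn₂ , indep , big , sub)) = weakenT (i ⨾ j) sub (StarCase.star-target t' r 1≤r S₂ 2≤k 6t≤k E₂ conn₂ indep big)
      split' (inj₂ c) = weakenT i (λ _ e → e) (Chains.chain-target k M 2≤k S E₁ conn₁ a Sa t r 8t≤k+1 c)

theorem8p8 : (t r : ℕ) → 1 ≤ t → 1 ≤ r →
  Σ ℕ λ f → (G : Graph) → (S : Subset (nV G)) →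
    EdgeConnectedSet G (15 * t ∸ 6) S → ∣ S ∣ ≥ f →
    CImmersion t r G S
theorem8p8 (suc t') r 1≤t 1≤r = bound t' r 1≤r , λ G S conn le → let open Realise G in
  immersion S (target t' r 1≤r (Vec.lookup S) list (connected (15 * suc t' ∸ 6) S conn) (≤-trans le (≤-reflexive (sym (size-∣∣ S)))))
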